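{- Suppose $G$ is a $2$-edge connected graph (parallel edges allowed) of maximum degree $3$. If $G$ is not (isomorphic to) $H_1$ or $H_2$, then $\chi'_c(G) \leq 11/3$.
   Context: Graphs are finite, may have parallel edges, but have no loops. A graph is $2$-edge connected if it is connected, has at least two vertices, and has no cut edge (bridge). $K_2^3$ denotes the graph with two vertices joined by three parallel edges. $H_1$ is the graph obtained from $K_2^3$ by subdividing one edge (replacing one edge $uv$ by a path $u,w,v$ through a new vertex $w$). $H_2$ is the graph obtained from the complete graph $K_4$ by subdividing one edge in the same way. For positive integers $p \geq q$, a $(p,q)$-coloring of a graph $G=(V,E)$ is a mapping $f: V \to \{0,1,\ldots,p-1\}$ such that for every edge $xy$ of $G$, $q \leq |f(x)-f(y)| \leq p-q$. The circular chromatic number of $G$ is $\chi_c(G) = \inf\{p/q : G \text{ has a } (p,q)\text{ -coloring}\}$. The line graph $L(G)$ of $G$ has vertex set $E$, two distinct elements $e_1,e_2 \in E$ being adjacent if they have an end vertex in common (in particular, parallel edges are distinct adjacent vertices of $L(G)$). The circular chromatic index of $G$ is $\chi_c'(G) = \chi_c(L(G))$. -}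

module Defs where

open import Data.Fin using (Fin; zero; suc; toℕ; #_)
open import Data.Fin.Properties using (_≟_; suc-injective)
open import Data.Integer using (+_)
open import Data.List using (allFin; filter; length; map)
open import Data.List.Extrema.Nat using (max)
open import Data.Nat using (ℕ; suc; NonZero; _∸_; ∣_-_∣) renaming (_≤_ to _≤ℕ_)
open import Data.Product using (∃; ∃₂; _×_; _,_; proj₁; proj₂)
open import Data.Rational using (ℚ; _<_; _/_)
open import Data.Rational.Properties using (<-dense; <-trans)
open import Data.Sum using (_⊎_)
open import Data.Vec using (Vec; _∷_; []; lookup)
open import Function using (_∘_)
open import Function.Bundles using (_↔_; Inverse)
open import Level using (0ℓ)
open import Relation.Binary using (Rel; Symmetric; Irreflexive)
open import Relation.Binary.Construct.Closure.ReflexiveTransitive using (Star)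
open import Relation.Binary.PropositionalEquality using (_≡_; _≢_; refl; sym)
open import Relation.Nullary using (¬_; Dec; yes; no)
open import Relation.Nullary.Decidable using (_⊎-dec_)
open import Relation.Unary using (Pred; U; _∈_; _⊆_)

------------------------------------------------------------------------
-- Finite loopless multigraphs

-- The order of the two components of `ends e` is arbitrary; everything below
-- treats them symmetrically.
record Graph : Set where
  field
    #V #E    : ℕ
    ends     : Fin #E → Fin #V × Fin #V
    loopless : ∀ e → proj₁ (ends e) ≢ proj₂ (ends e)

  Joins : Fin #E → Fin #V → Fin #V → Set
  Joins e x y = ends e ≡ (x , y) ⊎ ends e ≡ (y , x)

  Incident : Fin #V → Fin #E → Set
  Incident v e = v ≡ proj₁ (ends e) ⊎ v ≡ proj₂ (ends e)

  incident? : ∀ v e → Dec (Incident v e)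
  incident? v e = (v ≟ proj₁ (ends e)) ⊎-dec (v ≟ proj₂ (ends e))

  degree : Fin #V → ℕ
  degree v = length (filter (incident? v) (allFin #E))

  maxDegree : ℕ
  maxDegree = max 0 (map degree (allFin #V))

  -- Reachability in the spanning subgraph whose edges are those satisfying P.
  ReachableVia : Pred (Fin #E) 0ℓ → Rel (Fin #V) 0ℓ
  ReachableVia P = Star (λ x y → ∃ λ e → e ∈ P × Joins e x y)

  Reachable : Rel (Fin #V) 0ℓ
  Reachable = ReachableVia U

  Connected : Set
  Connected = ∀ x y → Reachable x y

  -- Deleting e separates two vertices of the same component.
  IsCutEdge : Fin #E → Set
  IsCutEdge e = ∃₂ λ x y → Reachable x y × ¬ ReachableVia (_≢ e) x y

  TwoEdgeConnected : Set
  TwoEdgeConnected = Connected × 2 ≤ℕ #V × (∀ e → ¬ IsCutEdge e)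

open Graph public

record _≅_ (G H : Graph) : Set where
  field
    vertices  : Fin (#V G) ↔ Fin (#V H)
    edges     : Fin (#E G) ↔ Fin (#E H)
    preserves : ∀ {e x y} → Joins G e x y →
                Joins H (Inverse.to edges e)
                        (Inverse.to vertices x) (Inverse.to vertices y)

------------------------------------------------------------------------
-- Subdivision and the two exceptional graphs

-- If e joins u and v, then in `subdivide G e` the new vertex is `zero`, the
-- edge `suc e` joins u to it, and the new edge `zero` joins it to v.
subdivide : (G : Graph) → Fin (#E G) → Graph
subdivide G e = record
  { #V       = suc (#V G)
  ; #E       = suc (#E G)
  ; ends     = ends′
  ; loopless = loopless′
  }
  where
  ends′ : Fin (suc (#E G)) → Fin (suc (#V G)) × Fin (suc (#V G))
  ends′ zero    = zero , suc (proj₂ (ends G e))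
  ends′ (suc f) with f ≟ e
  ... | yes _ = suc (proj₁ (ends G f)) , zero
  ... | no  _ = suc (proj₁ (ends G f)) , suc (proj₂ (ends G f))

  loopless′ : ∀ f → proj₁ (ends′ f) ≢ proj₂ (ends′ f)
  loopless′ zero ()
  loopless′ (suc f) with f ≟ e
  ... | yes _ = λ ()
  ... | no  _ = loopless G f ∘ suc-injective

K₂³ : Graph
K₂³ = record
  { #V = 2 ; #E = 3 ; ends = λ _ → # 0 , # 1 ; loopless = λ _ () }

K₄ : Graph
K₄ = record { #V = 4 ; #E = 6 ; ends = lookup pairs ; loopless = distinct }
  where
  pairs : Vec (Fin 4 × Fin 4) 6
  pairs = (# 0 , # 1) ∷ (# 0 , # 2) ∷ (# 0 , # 3)
        ∷ (# 1 , # 2) ∷ (# 1 , # 3) ∷ (# 2 , # 3) ∷ []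

  distinct : ∀ e → proj₁ (lookup pairs e) ≢ proj₂ (lookup pairs e)
  distinct zero                                   ()
  distinct (suc zero)                             ()
  distinct (suc (suc zero))                       ()
  distinct (suc (suc (suc zero)))                 ()
  distinct (suc (suc (suc (suc zero))))           ()
  distinct (suc (suc (suc (suc (suc zero)))))     ()

-- All edges of K₂³, and all edges of K₄, are equivalent under automorphisms,
-- so the choice of subdivided edge is immaterial.
H₁ H₂ : Graph
H₁ = subdivide K₂³ zero
H₂ = subdivide K₄ zero

------------------------------------------------------------------------
-- Infima of sets of rationals

-- A real number presented by the set of rationals strictly above it (an upper
-- Dedekind cut).  The set of rationals above inf S is {s | r < s for some
-- r ∈ S}.  The empty and the full cut stand for +∞ and -∞; neither occurs as
-- the infimum of a nonempty set of positive rationals.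
record UpperReal : Set₁ where
  field
    Above   : Pred ℚ 0ℓ
    upward  : ∀ {s t} → s ∈ Above → s < t → t ∈ Above
    rounded : ∀ {s} → s ∈ Above → ∃ λ t → t ∈ Above × t < s

open UpperReal public

infix 4 _≤_
_≤_ : UpperReal → UpperReal → Set
a ≤ b = Above b ⊆ Above a

⌜_⌝ : ℚ → UpperReal
⌜ r ⌝ = record
  { Above   = r <_
  ; upward  = <-trans
  ; rounded = λ r<s → let t , r<t , t<s = <-dense r<s in t , r<t , t<s
  }

inf : Pred ℚ 0ℓ → UpperReal
inf S = record
  { Above   = λ s → ∃ λ r → r ∈ S × r < s
  ; upward  = λ (r , r∈S , r<s) s<t → r , r∈S , <-trans r<s s<t
  ; rounded = λ (r , r∈S , r<s) →
      let t , r<t , t<s = <-dense r<s in t , (r , r∈S , r<t) , t<s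
  }

inf-lowerBound : ∀ {S r} → r ∈ S → inf S ≤ ⌜ r ⌝
inf-lowerBound r∈S r<s = _ , r∈S , r<s

inf-greatest : ∀ {S} a → (∀ {r} → r ∈ S → a ≤ ⌜ r ⌝) → a ≤ inf S
inf-greatest a a≤S (r , r∈S , r<s) = a≤S r∈S r<s

------------------------------------------------------------------------
-- Circular colouring

-- Parallel edges impose the same colouring constraint, and line graphs have
-- none, so circular colouring is defined on simple graphs.
record SimpleGraph : Set₁ where
  field
    order  : ℕ
    Adj    : Rel (Fin order) 0ℓ
    symm   : Symmetric Adj
    irrefl : Irreflexive _≡_ Adj

Coloring : ℕ → ℕ → SimpleGraph → Set
Coloring p q G = ∃ λ (f : Fin order → Fin p) → ∀ {x y} → Adj x y →
  q ≤ℕ ∣ toℕ (f x) - toℕ (f y) ∣ × ∣ toℕ (f x) - toℕ (f y) ∣ ≤ℕ p ∸ q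
  where open SimpleGraph G

ColoringRatio : SimpleGraph → Pred ℚ 0ℓ
ColoringRatio G r = ∃₂ λ p q → ∃ λ (q≢0 : NonZero q) →
  q ≤ℕ p × Coloring p q G × r ≡ _/_ (+ p) q {{q≢0}}

χc : SimpleGraph → UpperReal
χc G = inf (ColoringRatio G)

lineGraph : Graph → SimpleGraph
lineGraph G = record
  { order  = #E G
  ; Adj    = λ e₁ e₂ → e₁ ≢ e₂ × ∃ λ v → Incident G v e₁ × Incident G v e₂
  ; symm   = λ (e₁≢e₂ , v , v∈e₁ , v∈e₂) → e₁≢e₂ ∘ sym , v , v∈e₂ , v∈e₁
  ; irrefl = λ e₁≡e₂ (e₁≢e₂ , _) → e₁≢e₂ e₁≡e₂
  }

χ′c : Graph → UpperReal
χ′c G = χc (lineGraph G)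

{-# OPTIONS --safe #-}

-- The edges have an (11,3)-colouring, obtained from a matching M that covers the vertices of degree
-- three and, as G is not H₁, meets every triangle.  For cubic graphs without a bridge a perfect
-- matching avoiding a prescribed edge comes from Frink's reduction: delete adjacent vertices u, v
-- and reconnect their four other neighbours in one of two ways, at least one of which creates no
-- bridge.  In general, contract the triangles and join the vertices of degree two in pairs; if one
-- of them remains, suppress it and avoid the resulting edge.
--
-- G - M consists of paths and cycles, and its odd cycles have length at least five.  Edges of M get
-- class 2; the others alternate between the classes 1 and 3, except that every odd cycle contains
-- one edge u v of class 0, with w u of class 1 and v x of class 3, where w u v x is a subpath of the
-- cycle.  An edge of class c gets the colour 3c + s modulo 11, where the level s ≥ 0 has to grow when
-- passing from class 3 to an adjacent edge of class 0 and must not drop from class c to c + 1.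
-- Class 0 can be reached again from u v only along an edge of M from {w, u} to the set {v, x} of
-- another odd cycle; call this an arc.  If no cycle has both incoming and outgoing arcs, then the
-- levels 0, 1, 2 suffice.
--
-- Choose the windows w u v x so that no arc runs within a cycle and the number of arcs is minimal.
-- A cycle with incoming and outgoing arcs has at least two.  But it has a window with at most one:
-- if the cycle has a chord, take a window that contains an end of a chord but is not split by any,
-- which exists except in H₂; otherwise use that its length is odd.

module Submission where

-- Four steps of 3 make 12, one more than the modulus, so a strict rise of the level is needed only
-- from class 3 to class 0; and classes that differ by two stay at distance 6 ± 2, within the bounds
-- 3 and 8, as long as levels are at most 2. The level of an exceptional edge `u v` is passed on to
-- `w u`, to the matched edges at `w` and `u`, and to the class 3 edges at their other ends. If such
-- an end is one of `v` and `x` on another odd cycle, the exceptional edge there needs a larger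
-- level. So an arc is a strict inequality between the exceptional edges of two cycles, and an arc
-- within one cycle would be a contradiction. Every exceptional edge needs at least level 1, hence
-- two arcs in succession would call for level 3; if no cycle has both kinds of arcs, level 2 where
-- an arc enters and level 1 elsewhere will do.

module EdgeColouring where

  open import Data.Bool using (Bool; _xor_; _∧_; _∨_; false; if_then_else_; not; true)
  import Data.Bool as Bool
  import Data.Bool.Properties as Bool
  open import Data.Empty using (⊥; ⊥-elim)
  open import Data.Fin using (#_; Fin; suc; toℕ; zero)
  open import Data.Fin.Permutation using (Permutation; permutation)
  open import Data.Fin.Properties using (_≟_; all?; any?; toℕ-injective)
  open import Data.Fin.Subset.Properties using (anySubset?)
  open import Data.List using (List; []; _++_; _∷_; _∷ʳ_; _∷ʳ′_; allFin; concatMap; filter; initLast; length; lookup; map; reverse; tabulate)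
  import Data.List.Extrema.Nat as Extrema
  open import Data.List.Membership.DecPropositional using (_∈?_)
  open import Data.List.Membership.Propositional using (_∈_; _∉_)
  open import Data.List.Membership.Propositional.Properties using (∈-++⁻; ∈-allFin; ∈-lookup; ∈-map⁺; ∈-∃++)
  open import Data.List.Properties using (++-assoc; ++-identityʳ; filter-accept; filter-reject; length-++; unfold-reverse)
  open import Data.List.Relation.Binary.Permutation.Propositional using (_↭_; prep; swap; ↭-sym) renaming (refl to ↭-refl; trans to ↭-tr)
  open import Data.List.Relation.Binary.Permutation.Propositional.Properties using (++-comm; All-resp-↭; ↭-length; ↭-reverse; ∈-resp-↭)
  open import Data.List.Relation.Unary.All using (All; []; _∷_)
  import Data.List.Relation.Unary.All as All
  open import Data.List.Relation.Unary.All.Properties using (map⁺; tabulate⁺)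
  open import Data.List.Relation.Unary.AllPairs using ([]; _∷_)
  open import Data.List.Relation.Unary.Any using (here; there)
  open import Data.List.Relation.Unary.Unique.Propositional using (Unique)
  open import Data.List.Relation.Unary.Unique.Propositional.Properties using (Unique[x∷xs]⇒x∉xs)
  open import Data.Maybe using (Maybe; just; maybe′; nothing)
  open import Data.Nat using (_+_; _<?_; _<_; _<ᵇ_; _≤?_; _≤_; _≤ᵇ_; suc; s≤s; zero; z≤n; ℕ; ∣_-_∣)
  import Data.Nat as ℕ
  open import Data.Nat.Properties using (+-0-commutativeMonoid; +-assoc; +-cancelˡ-≡; +-comm; +-identityʳ; +-mono-<-≤; +-mono-≤; +-monoˡ-≤; +-suc; m+n≡0⇒m≡0; m+n≡0⇒n≡0; m≤m+n; m≤n+m; n≤0⇒n≡0; n≤1+n; suc-injective; ∣-∣-comm; ≤-pred; ≤-refl; ≤-reflexive; ≤-trans; ≤ᵇ⇒≤)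
  open import Algebra.Properties.CommutativeMonoid.Sum +-0-commutativeMonoid using (sum; sum-cong-≗; sum-permute; sum-replicate-zero; ∑-distrib-+)
  open import Data.Nat.Tactic.RingSolver using (solve-∀)
  open import Data.Product using (_,_; _×_; proj₁; proj₂; Σ; ∃; ∃₂)
  open import Data.Sum using ([_,_]; _⊎_; inj₁; inj₂)
  import Data.Vec as Vec
  open import Data.Vec.Properties using (lookup∘tabulate)
  open import Function using (_∘_; id)
  open import Function.Bundles using (mk↔ₛ′)
  open import Relation.Binary.Construct.Closure.ReflexiveTransitive using (_◅_; ε)
  open import Relation.Binary.PropositionalEquality using (_≡_; _≢_; cong; cong₂; refl; subst; subst₂; sym; trans; ≢-sym)
  open import Relation.Nullary using (Dec; does; no; yes; ¬_)
  open import Relation.Nullary.Decidable using (_×-dec_; _→-dec_; dec-false; dec-true; decidable-stable; map′; toWitness; ¬?)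

  -- Edge lists up to order and orientation

  Edge : ℕ → Set
  Edge n = Fin n × Fin n

  infix 4 _≈_

  -- Parallel edges are repeated entries without identity. Every invariant is proved by induction on
  -- the derivation.
  data _≈_ {n : ℕ} : List (Edge n) → List (Edge n) → Set where
    ≈-refl  : ∀ {L} → L ≈ L
    ≈-sym   : ∀ {L K} → L ≈ K → K ≈ L
    ≈-trans : ∀ {L K J} → L ≈ K → K ≈ J → L ≈ J
    ≈-prep  : ∀ e {L K} → L ≈ K → e ∷ L ≈ e ∷ K
    ≈-swap  : ∀ e f {L} → e ∷ f ∷ L ≈ f ∷ e ∷ L
    ≈-flip  : ∀ x y {L} → (x , y) ∷ L ≈ (y , x) ∷ L

  xr : Bool → Bool → ℕ
  xr a b = if a xor b then 1 else 0

  xr-comm : ∀ a b → xr a b ≡ xr b a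
  xr-comm false false = refl
  xr-comm false true  = refl
  xr-comm true  false = refl
  xr-comm true  true  = refl

  module _ {n : ℕ} where

    ≈-++ˡ : (K : List (Edge n)) {L L′ : List (Edge n)} → L ≈ L′ → K ++ L ≈ K ++ L′
    ≈-++ˡ []      p = p
    ≈-++ˡ (e ∷ K) p = ≈-prep e (≈-++ˡ K p)

    ≈-shift : (e : Edge n) (K L : List (Edge n)) → K ++ e ∷ L ≈ e ∷ K ++ L
    ≈-shift e []      L = ≈-refl
    ≈-shift e (f ∷ K) L = ≈-trans (≈-prep f (≈-shift e K L)) (≈-swap f e)

    ≈-++-comm : (K L : List (Edge n)) → K ++ L ≈ L ++ K
    ≈-++-comm []      L = subst (L ≈_) (sym (++-identityʳ L)) ≈-refl
    ≈-++-comm (e ∷ K) L = ≈-trans (≈-prep e (≈-++-comm K L)) (≈-sym (≈-shift e L K))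

    ≈-++ : {K K′ L L′ : List (Edge n)} → K ≈ K′ → L ≈ L′ → K ++ L ≈ K′ ++ L′
    ≈-++ {K} {K′} {L} {L′} p q =
      ≈-trans (≈-++ˡ K q) (≈-trans (≈-++-comm K L′)
        (≈-trans (≈-++ˡ L′ p) (≈-++-comm L′ K′)))

    ≈-++ʳ : {K K′ : List (Edge n)} (L : List (Edge n)) → K ≈ K′ → K ++ L ≈ K′ ++ L
    ≈-++ʳ L p = ≈-++ p ≈-refl

    ≈-exchange : (A B C : List (Edge n)) → A ++ B ++ C ≈ B ++ A ++ C
    ≈-exchange A B C = subst₂ _≈_ (++-assoc A B C) (++-assoc B A C) (≈-++ʳ C (≈-++-comm A B))

    ≈-interchange : (A B C D : List (Edge n)) → (A ++ B) ++ C ++ D ≈ (A ++ C) ++ B ++ D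
    ≈-interchange A B C D =
      subst₂ _≈_ (sym (++-assoc A B (C ++ D))) (sym (++-assoc A C (B ++ D))) (≈-++ˡ A (≈-exchange B C D))

    ≈-length : {L K : List (Edge n)} → L ≈ K → length L ≡ length K
    ≈-length ≈-refl        = refl
    ≈-length (≈-sym p)     = sym (≈-length p)
    ≈-length (≈-trans p q) = trans (≈-length p) (≈-length q)
    ≈-length (≈-prep _ p)  = cong suc (≈-length p)
    ≈-length (≈-swap _ _)  = refl
    ≈-length (≈-flip _ _)  = refl

    total : (Edge n → ℕ) → List (Edge n) → ℕ
    total ω []      = 0
    total ω (e ∷ L) = ω e + total ω L

    total-≈ : ∀ ω → (∀ x y → ω (x , y) ≡ ω (y , x)) → {L K : List (Edge n)} → L ≈ K →
              total ω L ≡ total ω K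
    total-≈ ω s ≈-refl        = refl
    total-≈ ω s (≈-sym p)     = sym (total-≈ ω s p)
    total-≈ ω s (≈-trans p q) = trans (total-≈ ω s p) (total-≈ ω s q)
    total-≈ ω s (≈-prep e p)  = cong (ω e +_) (total-≈ ω s p)
    total-≈ ω s (≈-swap e f {L}) = lemma (ω e) (ω f) (total ω L)
      where
      lemma : ∀ a b c → a + (b + c) ≡ b + (a + c)
      lemma = solve-∀
    total-≈ ω s (≈-flip x y {L}) = cong (_+ total ω L) (s x y)

    δ : Fin n → Fin n → ℕ
    δ p q = if does (p ≟ q) then 1 else 0

    δ-refl : ∀ p → δ p p ≡ 1
    δ-refl p with p ≟ p
    ... | yes _   = refl
    ... | no p≢p = ⊥-elim (p≢p refl)

    δ-≢ : ∀ {p q} → p ≢ q → δ p q ≡ 0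
    δ-≢ {p} {q} p≢q with p ≟ q
    ... | yes p≡q = ⊥-elim (p≢q p≡q)
    ... | no _    = refl

    δ≡0⇒≢ : ∀ {p q} → δ p q ≡ 0 → p ≢ q
    δ≡0⇒≢ {p} eq refl with () ← trans (sym (δ-refl p)) eq

    inc : Fin n → Edge n → ℕ
    inc p (x , y) = δ p x + δ p y

    deg : Fin n → List (Edge n) → ℕ
    deg p []      = 0
    deg p (e ∷ L) = inc p e + deg p L

    deg≡total : ∀ p L → deg p L ≡ total (inc p) L
    deg≡total p []      = refl
    deg≡total p (e ∷ L) = cong (inc p e +_) (deg≡total p L)

    deg-≈ : ∀ p {L K : List (Edge n)} → L ≈ K → deg p L ≡ deg p K
    deg-≈ p {L} {K} r = trans (deg≡total p L)
      (trans (total-≈ (inc p) (λ x y → +-comm (δ p x) (δ p y)) r) (sym (deg≡total p K)))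

    deg-++ : ∀ p (K L : List (Edge n)) → deg p (K ++ L) ≡ deg p K + deg p L
    deg-++ p []      L = refl
    deg-++ p (e ∷ K) L = trans (cong (inc p e +_) (deg-++ p K L)) (sym (+-assoc (inc p e) _ _))

    crosses : (Fin n → Bool) → Edge n → ℕ
    crosses X (x , y) = xr (X x) (X y)

    cut : (Fin n → Bool) → List (Edge n) → ℕ
    cut X []      = 0
    cut X (e ∷ L) = crosses X e + cut X L

    cut≡total : ∀ X L → cut X L ≡ total (crosses X) L
    cut≡total X []      = refl
    cut≡total X (e ∷ L) = cong (crosses X e +_) (cut≡total X L)

    cut-≈ : ∀ X {L K : List (Edge n)} → L ≈ K → cut X L ≡ cut X K
    cut-≈ X {L} {K} r = trans (cut≡total X L)
      (trans (total-≈ (crosses X) (λ x y → xr-comm (X x) (X y)) r) (sym (cut≡total X K)))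

    cut-cong : ∀ {X Y : Fin n → Bool} → (∀ p → X p ≡ Y p) → ∀ L → cut X L ≡ cut Y L
    cut-cong X≗Y []            = refl
    cut-cong X≗Y ((x , y) ∷ L) = cong₂ _+_ (cong₂ xr (X≗Y x) (X≗Y y)) (cut-cong X≗Y L)

    Loopless : List (Edge n) → Set
    Loopless = All (λ (x , y) → x ≢ y)

    -- An edge is a bridge exactly if it is the only one to cross some vertex set. Quantifying over
    -- Boolean sets `X` replaces all reasoning about paths.
    Bridgeless : List (Edge n) → Set
    Bridgeless L = ∀ X → cut X L ≢ 1

    bridgeless-≈ : {L K : List (Edge n)} → L ≈ K → Bridgeless L → Bridgeless K
    bridgeless-≈ p b X c = b X (trans (cut-≈ X p) c)

    loopless-≈ : {L K : List (Edge n)} → L ≈ K → Loopless L → Loopless K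
    loopless-≈ p = proj₁ (go p)
      where
      -- Both directions are proved together because `≈-sym` exchanges them.
      go : {L K : List (Edge n)} → L ≈ K → (Loopless L → Loopless K) × (Loopless K → Loopless L)
      go ≈-refl        = (λ l → l) , (λ l → l)
      go (≈-sym p)     = proj₂ (go p) , proj₁ (go p)
      go (≈-trans p q) = (λ l → proj₁ (go q) (proj₁ (go p) l)) , (λ l → proj₂ (go p) (proj₂ (go q) l))
      go (≈-prep e p)  = (λ { (x ∷ l) → x ∷ proj₁ (go p) l }) , (λ { (x ∷ l) → x ∷ proj₂ (go p) l })
      go (≈-swap e f)  = (λ { (x ∷ y ∷ l) → y ∷ x ∷ l }) , (λ { (x ∷ y ∷ l) → y ∷ x ∷ l })
      go (≈-flip x y)  = (λ { (n ∷ l) → n ∘ sym ∷ l }) , (λ { (n ∷ l) → n ∘ sym ∷ l })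

    data Adj (x y : Fin n) : List (Edge n) → Set where
      here  : ∀ {L} → Adj x y ((x , y) ∷ L)
      here˘ : ∀ {L} → Adj x y ((y , x) ∷ L)
      there : ∀ {e L} → Adj x y L → Adj x y (e ∷ L)

    Adj-sym : ∀ {x y L} → Adj x y L → Adj y x L
    Adj-sym here      = here˘
    Adj-sym here˘     = here
    Adj-sym (there a) = there (Adj-sym a)

    Adj-≈ : ∀ {x y} {L K : List (Edge n)} → L ≈ K → Adj x y L → Adj x y K
    Adj-≈ {x} {y} p = proj₁ (go p)
      where
      sw : ∀ {e f L} → Adj x y (e ∷ f ∷ L) → Adj x y (f ∷ e ∷ L)
      sw here              = there here
      sw here˘             = there here˘
      sw (there here)      = here
      sw (there here˘)     = here˘
      sw (there (there a)) = there (there a)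
      fl : ∀ {p q L} → Adj x y ((p , q) ∷ L) → Adj x y ((q , p) ∷ L)
      fl here      = here˘
      fl here˘     = here
      fl (there a) = there a
      pr : ∀ {e L K} → (Adj x y L → Adj x y K) → Adj x y (e ∷ L) → Adj x y (e ∷ K)
      pr f here      = here
      pr f here˘     = here˘
      pr f (there a) = there (f a)
      go : {L K : List (Edge n)} → L ≈ K → (Adj x y L → Adj x y K) × (Adj x y K → Adj x y L)
      go ≈-refl        = (λ l → l) , (λ l → l)
      go (≈-sym p)     = proj₂ (go p) , proj₁ (go p)
      go (≈-trans p q) = (λ l → proj₁ (go q) (proj₁ (go p) l)) , (λ l → proj₂ (go p) (proj₂ (go q) l))
      go (≈-prep e p)  = pr (proj₁ (go p)) , pr (proj₂ (go p))
      go (≈-swap e f)  = sw , sw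
      go (≈-flip x y)  = fl , fl

    Adj-++ʳ : ∀ {x y} (K : List (Edge n)) {L} → Adj x y L → Adj x y (K ++ L)
    Adj-++ʳ []      a = a
    Adj-++ʳ (e ∷ K) a = there (Adj-++ʳ K a)

    Adj-++ˡ : ∀ {x y} {K : List (Edge n)} {L} → Adj x y K → Adj x y (K ++ L)
    Adj-++ˡ here      = here
    Adj-++ˡ here˘     = here˘
    Adj-++ˡ (there a) = there (Adj-++ˡ a)

    Adj-++⁻ : ∀ {x y} (K : List (Edge n)) {L} → Adj x y (K ++ L) → Adj x y K ⊎ Adj x y L
    Adj-++⁻ []      a         = inj₂ a
    Adj-++⁻ (e ∷ K) here      = inj₁ here
    Adj-++⁻ (e ∷ K) here˘     = inj₁ here˘
    Adj-++⁻ (e ∷ K) (there a) with Adj-++⁻ K a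
    ... | inj₁ b = inj₁ (there b)
    ... | inj₂ b = inj₂ b

    Adj-∷⁻ : ∀ {x y p q} {L : List (Edge n)} → Adj x y ((p , q) ∷ L) →
             (x ≡ p × y ≡ q) ⊎ (x ≡ q × y ≡ p) ⊎ Adj x y L
    Adj-∷⁻ here      = inj₁ (refl , refl)
    Adj-∷⁻ here˘     = inj₂ (inj₁ (refl , refl))
    Adj-∷⁻ (there a) = inj₂ (inj₂ a)

    Adj? : ∀ x y (L : List (Edge n)) → Dec (Adj x y L)
    Adj? x y []            = no λ ()
    Adj? x y ((p , q) ∷ L) with x ≟ p | y ≟ q | x ≟ q | y ≟ p | Adj? x y L
    ... | yes refl | yes refl | _ | _ | _ = yes here
    ... | _ | _ | yes refl | yes refl | _ = yes here˘
    ... | _ | _ | _ | _ | yes a = yes (there a)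
    ... | no a | _ | no b | _ | no c = no λ { here → a refl ; here˘ → b refl ; (there d) → c d }
    ... | no a | _ | yes _ | no b | no c = no λ { here → a refl ; here˘ → b refl ; (there d) → c d }
    ... | yes _ | no a | no b | _ | no c = no λ { here → a refl ; here˘ → b refl ; (there d) → c d }
    ... | yes _ | no a | yes _ | no b | no c = no λ { here → a refl ; here˘ → b refl ; (there d) → c d }

    Adj-extract : ∀ {x y} {L : List (Edge n)} → Adj x y L → ∃ λ R → L ≈ (x , y) ∷ R
    Adj-extract here  = _ , ≈-refl
    Adj-extract here˘ = _ , ≈-flip _ _
    Adj-extract {L = e ∷ _} (there a) with Adj-extract a
    ... | R , p = e ∷ R , ≈-trans (≈-prep e p) (≈-swap e _)

    deg-extract : ∀ p {k} (L : List (Edge n)) → deg p L ≡ suc k → ∃₂ λ q R → L ≈ (p , q) ∷ R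
    deg-extract p ((x , y) ∷ L) eq with p ≟ x | p ≟ y
    ... | yes refl | _        = y , L , ≈-refl
    ... | no _     | yes refl = x , L , ≈-flip x y
    ... | no _     | no _     with deg-extract p L eq
    ...   | q , R , r = q , (x , y) ∷ R , ≈-trans (≈-prep _ r) (≈-swap _ _)

    Adj⇒deg : ∀ {x y} {L : List (Edge n)} → Adj x y L → deg x L ≢ 0
    Adj⇒deg {x} {y} a eq with Adj-extract a
    ... | R , r with () ← trans (sym (trans (deg-≈ x r) (cong (λ d → d + δ x y + deg x R) (δ-refl x)))) eq

    Adj-loopless : ∀ {x y} {L : List (Edge n)} → Loopless L → Adj x y L → x ≢ y
    Adj-loopless (l ∷ ll) here      = l
    Adj-loopless (l ∷ ll) here˘     = l ∘ sym
    Adj-loopless (l ∷ ll) (there a) = Adj-loopless ll a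

    -- Apart from `b` the set `X` holds only isolated vertices, so the edges that cross it are those
    -- at `b`, each counted once as there are no loops.
    cut-single : ∀ {X : Fin n → Bool} {b} (L : List (Edge n)) → Loopless L → X b ≡ true →
                 (∀ p → X p ≡ true → p ≡ b ⊎ deg p L ≡ 0) → cut X L ≡ deg b L
    cut-single []            _        Xb h = refl
    cut-single {X} {b} ((x , y) ∷ L) (x≢y ∷ l) Xb h =
      cong₂ _+_ head (cut-single L l Xb λ p Xp → weaken p (h p Xp))
      where
      weaken : ∀ p → p ≡ b ⊎ deg p ((x , y) ∷ L) ≡ 0 → p ≡ b ⊎ deg p L ≡ 0
      weaken p (inj₁ e) = inj₁ e
      weaken p (inj₂ e) = inj₂ (m+n≡0⇒n≡0 (inc p (x , y)) e)
      out : ∀ {p} → p ≡ x ⊎ p ≡ y → p ≢ b → X p ≡ false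
      out {p} ends p≢b with X p in Xp
      ... | false = refl
      ... | true with h p Xp
      ...   | inj₁ e = ⊥-elim (p≢b e)
      ...   | inj₂ e with m+n≡0⇒m≡0 (inc p (x , y)) e
      ...     | z with ends
      ...       | inj₁ refl = ⊥-elim (δ≡0⇒≢ {p} {p} (m+n≡0⇒m≡0 (δ p x) z) refl)
      ...       | inj₂ refl = ⊥-elim (δ≡0⇒≢ {p} {p} (m+n≡0⇒n≡0 (δ p x) z) refl)
      head : xr (X x) (X y) ≡ inc b (x , y)
      head with b ≟ x | b ≟ y
      ... | yes refl | yes refl = ⊥-elim (x≢y refl)
      ... | yes refl | no b≢y rewrite Xb | out (inj₂ refl) (b≢y ∘ sym) = refl
      ... | no b≢x | yes refl rewrite Xb | out (inj₁ refl) (b≢x ∘ sym) = refl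
      ... | no b≢x | no b≢y rewrite out (inj₁ refl) (b≢x ∘ sym) | out (inj₂ refl) (b≢y ∘ sym) = refl

    cut-none : ∀ {X : Fin n → Bool} (L : List (Edge n)) →
               (∀ p → X p ≡ true → deg p L ≡ 0) → cut X L ≡ 0
    cut-none []            h = refl
    cut-none {X} ((x , y) ∷ L) h =
      cong₂ _+_ (cong₂ xr (out (inj₁ refl)) (out (inj₂ refl)))
                (cut-none L λ p Xp → m+n≡0⇒n≡0 (inc p (x , y)) (h p Xp))
      where
      out : ∀ {p} → p ≡ x ⊎ p ≡ y → X p ≡ false
      out {p} ends with X p in Xp
      ... | false = refl
      ... | true with m+n≡0⇒m≡0 (inc p (x , y)) (h p Xp)
      ...   | z with ends
      ...     | inj₁ refl = ⊥-elim (δ≡0⇒≢ {p} {p} (m+n≡0⇒m≡0 (δ p x) z) refl)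
      ...     | inj₂ refl = ⊥-elim (δ≡0⇒≢ {p} {p} (m+n≡0⇒n≡0 (δ p x) z) refl)

    _[_≔_] : (Fin n → Bool) → Fin n → Bool → Fin n → Bool
    (X [ u ≔ α ]) p = if does (p ≟ u) then α else X p

    upd-same : ∀ X u α → (X [ u ≔ α ]) u ≡ α
    upd-same X u α with u ≟ u
    ... | yes _   = refl
    ... | no u≢u = ⊥-elim (u≢u refl)

    upd-other : ∀ X {u} α {p} → p ≢ u → (X [ u ≔ α ]) p ≡ X p
    upd-other X {u} α {p} p≢u with p ≟ u
    ... | yes e = ⊥-elim (p≢u e)
    ... | no _  = refl

    fresh-∷ : ∀ {u x y} {L : List (Edge n)} → deg u ((x , y) ∷ L) ≡ 0 → u ≢ x × u ≢ y × deg u L ≡ 0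
    fresh-∷ {u} {x} {y} eq =
      δ≡0⇒≢ (m+n≡0⇒m≡0 (δ u x) z) , δ≡0⇒≢ (m+n≡0⇒n≡0 (δ u x) z) , m+n≡0⇒n≡0 (inc u (x , y)) eq
      where z = m+n≡0⇒m≡0 (inc u (x , y)) eq

    -- Evaluates a cut from known sides of the ends of the leading edges, so that a modified set can
    -- be compared with the original one by a Boolean case check.
    data CutIs (X : Fin n → Bool) : List (Edge n) → ℕ → Set where
      base : ∀ {R k} → cut X R ≡ k → CutIs X R k
      across : ∀ {x y α β R k} → X x ≡ α → X y ≡ β → CutIs X R k → CutIs X ((x , y) ∷ R) (xr α β + k)

    cutIs : ∀ X L {k} → CutIs X L k → cut X L ≡ k
    cutIs X L (base eq)                     = eq
    cutIs X ((x , y) ∷ R) (across refl refl c) = cong (xr (X x) (X y) +_) (cutIs X R c)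

    cut-upd : ∀ X {u} α (L : List (Edge n)) → deg u L ≡ 0 → cut (X [ u ≔ α ]) L ≡ cut X L
    cut-upd X α []            _  = refl
    cut-upd X α ((x , y) ∷ L) eq with fresh-∷ {L = L} eq
    ... | u≢x , u≢y , eq′ =
      cong₂ _+_ (cong₂ xr (upd-other X α (u≢x ∘ sym)) (upd-other X α (u≢y ∘ sym))) (cut-upd X α L eq′)

    -- Labels on edges and the sublists they select

    Labels : Set → List (Edge n) → Set
    Labels A = All (λ _ → A)

    sel : {A : Set} → (A → Bool) → {L : List (Edge n)} → Labels A L → List (Edge n)
    sel f {[]}    []       = []
    sel f {e ∷ L} (a ∷ as) = if f a then e ∷ sel f as else sel f as

    -- Edge sets are labels on positions, as an entry does not identify an edge. One relabelling
    -- serves all `f` at once, so the matched and the unmatched part, or several colour classes, are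
    -- carried along together.
    transport : {A : Set} {L K : List (Edge n)} → L ≈ K → (as : Labels A K) →
                Σ (Labels A L) λ bs → ∀ f → sel f bs ≈ sel f as
    transport {A} = proj₁ ∘ go
      where
      To : List (Edge n) → List (Edge n) → Set
      To L K = (as : Labels A K) → Σ (Labels A L) λ bs → ∀ f → sel f bs ≈ sel f as
      pr : ∀ {e L K} → To L K → To (e ∷ L) (e ∷ K)
      pr {e} t (a ∷ as) with t as
      ... | bs , h = a ∷ bs , k
        where
        k : ∀ f → sel f {e ∷ _} (a ∷ bs) ≈ sel f {e ∷ _} (a ∷ as)
        k f with f a
        ... | true  = ≈-prep e (h f)
        ... | false = h f
      sw : ∀ {e f L} → To (e ∷ f ∷ L) (f ∷ e ∷ L)
      sw {e} {g} (a ∷ b ∷ as) = b ∷ a ∷ as , k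
        where
        k : ∀ f → sel f {e ∷ g ∷ _} (b ∷ a ∷ as) ≈ sel f {g ∷ e ∷ _} (a ∷ b ∷ as)
        k f with f a | f b
        ... | true  | true  = ≈-swap _ _
        ... | true  | false = ≈-refl
        ... | false | true  = ≈-refl
        ... | false | false = ≈-refl
      fl : ∀ {x y L} → To ((x , y) ∷ L) ((y , x) ∷ L)
      fl {x} {y} (a ∷ as) = a ∷ as , k
        where
        k : ∀ f → sel f {(x , y) ∷ _} (a ∷ as) ≈ sel f {(y , x) ∷ _} (a ∷ as)
        k f with f a
        ... | true  = ≈-flip _ _
        ... | false = ≈-refl
      comp : ∀ {L K J} → To L K → To K J → To L J
      comp s t as with t as
      ... | bs , h with s bs
      ...   | cs , k = cs , λ f → ≈-trans (k f) (h f)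
      idt : ∀ {L} → To L L
      idt as = as , λ f → ≈-refl
      go : {L K : List (Edge n)} → L ≈ K → To L K × To K L
      go ≈-refl        = idt , idt
      go (≈-sym p)     = proj₂ (go p) , proj₁ (go p)
      go (≈-trans p q) = comp (proj₁ (go p)) (proj₁ (go q)) , comp (proj₂ (go q)) (proj₂ (go p))
      go (≈-prep e p)  = pr (proj₁ (go p)) , pr (proj₂ (go p))
      go (≈-swap e f)  = sw , sw
      go (≈-flip x y)  = fl , fl

  -- Perfect matchings of bridgeless cubic graphs

  -- Degree 0 is allowed because the vertex type stays fixed: a deleted vertex becomes isolated.
  data Cubic : ℕ → Set where
    isolated : Cubic 0
    cubic    : Cubic 3

  -- Applied to the degree `d` of a vertex and the number `m` of matched edges there; vertices of
  -- degree 0 or 2 may stay uncovered.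
  Covers : ℕ → ℕ → Set
  Covers d m = m ≤ 1 × (d ≡ 3 → m ≡ 1)

  one-covers : ∀ {d m} → m ≡ 1 → Covers d m
  one-covers refl = ≤-refl , λ _ → refl

  covers-≡ : ∀ {d d′ m m′} → d′ ≡ d → m′ ≡ m → Covers d m → Covers d′ m′
  covers-≡ refl refl c = c

  module _ {n : ℕ} where

    member : List (Fin n) → Fin n → Bool
    member []       p = false
    member (x ∷ xs) p = does (p ≟ x) ∨ member xs p

    member⁺ : ∀ {xs p} → p ∈ xs → member xs p ≡ true
    member⁺ {x ∷ xs} {p} p∈ with p ≟ x | p∈
    ... | yes _   | _         = refl
    ... | no p≢x | here e    = ⊥-elim (p≢x e)
    ... | no _   | there p∈′ = member⁺ p∈′

    member⁻ : ∀ xs {p} → member xs p ≡ true → p ∈ xs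
    member⁻ (x ∷ xs) {p} eq with p ≟ x
    ... | yes e = here e
    ... | no _  = there (member⁻ xs eq)

    member⁻ᶠ : ∀ xs p → p ∉ xs → member xs p ≡ false
    member⁻ᶠ xs p p∉ with member xs p in eq
    ... | false = refl
    ... | true  = ⊥-elim (p∉ (member⁻ xs eq))

    Inside : List (Fin n) → List (Edge n) → Set
    Inside S = All (λ (x , y) → x ∈ S × y ∈ S)

    cut-inside : ∀ {S} {K : List (Edge n)} (R : List (Edge n)) → Inside S K →
                 cut (member S) (K ++ R) ≡ cut (member S) R
    cut-inside R []                 = refl
    cut-inside R ((x∈ , y∈) ∷ ins) rewrite member⁺ x∈ | member⁺ y∈ = cut-inside R ins

    -- The one edge of `R` at `b` would be the only edge to cross `S`, hence a bridge. This excludes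
    -- most degenerate coincidences of neighbours below.
    no-single-exit : ∀ S b {K R : List (Edge n)} → Bridgeless (K ++ R) → Loopless R → Inside S K → b ∈ S →
                     (∀ {p} → p ∈ S → p ≡ b ⊎ deg p R ≡ 0) → deg b R ≢ 1
    no-single-exit S b {K} {R} bl ll ins b∈ h eq =
      bl (member S) (trans (cut-inside R ins)
        (trans (cut-single R ll (member⁺ b∈) (λ p e → h (member⁻ S e))) eq))

    pull : ∀ p {k} {L : List (Edge n)} → Loopless L → deg p L ≡ suc k →
           ∃₂ λ q R → L ≈ (p , q) ∷ R × p ≢ q × deg p R ≡ k
    pull p {k} {L} ll eq with deg-extract p L eq
    ... | q , R , r with loopless-≈ r ll
    ...   | p≢q ∷ _ = q , R , r , p≢q , suc-injective (trans (sym lemma) (trans (sym (deg-≈ p r)) eq))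
      where
      lemma : deg p ((p , q) ∷ R) ≡ suc (deg p R)
      lemma rewrite δ-refl p | δ-≢ p≢q = refl

    sel-fresh : ∀ {A : Set} (f : A → Bool) {u} {L : List (Edge n)} (as : Labels A L) → deg u L ≡ 0 → deg u (sel f as) ≡ 0
    sel-fresh f {L = []}          []       eq = refl
    sel-fresh f {u} {L = (x , y) ∷ L} (a ∷ as) eq with f a
    ... | true  = cong₂ _+_ (m+n≡0⇒m≡0 (inc u (x , y)) eq) (sel-fresh f as (m+n≡0⇒n≡0 (inc u (x , y)) eq))
    ... | false = sel-fresh f as (m+n≡0⇒n≡0 (inc u (x , y)) eq)

    -- Connectedness is not demanded, so the reductions need not preserve it.
    record CubicBridgeless (L : List (Edge n)) : Set where
      field
        degrees    : ∀ p → Cubic (deg p L)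
        loopless   : Loopless L
        bridgeless : Bridgeless L
    open CubicBridgeless

    cubicBridgeless-≈ : {L K : List (Edge n)} → L ≈ K → CubicBridgeless L → CubicBridgeless K
    cubicBridgeless-≈ r G = record
      { degrees    = λ p → subst Cubic (deg-≈ p r) (degrees G p)
      ; loopless   = loopless-≈ r (loopless G)
      ; bridgeless = bridgeless-≈ r (bridgeless G)
      }

    -- K is L, possibly with one more edge, which the matching has to avoid.
    MatchIn : List (Edge n) → List (Edge n) → Set
    MatchIn K L = Σ (Labels Bool L) λ ms → ∀ p → Covers (deg p K) (deg p (sel id ms))

    matchIn-≈ : {K K′ L L′ : List (Edge n)} → K ≈ K′ → L ≈ L′ → MatchIn K′ L′ → MatchIn K L
    matchIn-≈ {K} {K′} k l (ms , h) with transport l ms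
    ... | ns , g = ns , λ p → subst (λ m → Covers (deg p K) m) (sym (deg-≈ p (g id)))
                               (subst (λ d → Covers d _) (sym (deg-≈ p k)) (h p))

    degree-rest : ∀ {x y} {K : List (Edge n)} → CubicBridgeless ((x , y) ∷ K) → deg y K ≡ 2
    degree-rest {x} {y} {K} G with loopless G | degrees G y
    ... | x≢y ∷ _ | c rewrite δ-≢ (x≢y ∘ sym) | δ-refl y with deg y K | c
    ...   | 2 | cubic = refl

    -- Three parallel edges form a component of their own: it is discarded, and one of the two
    -- copies other than the avoided edge is matched.
    module DropDigon {a u : Fin n} {R : List (Edge n)} (a≢u : a ≢ u) (fa : deg a R ≡ 0) (fu : deg u R ≡ 0)
                     (G : CubicBridgeless ((a , u) ∷ (u , a) ∷ (u , a) ∷ R)) where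
      good : CubicBridgeless R
      good = record
        { degrees    = degs
        ; loopless   = case-ll (loopless G)
        ; bridgeless = λ X c → bridgeless G (X [ u ≔ X a ]) (trans (eqn X) c)
        }
        where
        case-ll : Loopless ((a , u) ∷ (u , a) ∷ (u , a) ∷ R) → Loopless R
        case-ll (_ ∷ _ ∷ _ ∷ ll) = ll
        degs : ∀ p → Cubic (deg p R)
        degs p with p ≟ a | p ≟ u
        ... | yes refl | _        = subst Cubic (sym fa) isolated
        ... | no _     | yes refl = subst Cubic (sym fu) isolated
        ... | no p≢a   | no p≢u  with degrees G p
        ...   | c rewrite δ-≢ p≢a | δ-≢ p≢u = c
        collapse : ∀ b k → xr b b + (xr b b + (xr b b + k)) ≡ k
        collapse true  k = refl
        collapse false k = refl
        eqn : ∀ X → cut (X [ u ≔ X a ]) ((a , u) ∷ (u , a) ∷ (u , a) ∷ R) ≡ cut X R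
        eqn X = trans (cutIs Z ((a , u) ∷ (u , a) ∷ (u , a) ∷ R) (across Xa Xu (across Xu Xa (across Xu Xa (base (cut-upd X (X a) R fu)))))) (collapse (X a) _)
          where
          Z  = X [ u ≔ X a ]
          Xa = upd-other X (X a) a≢u
          Xu = upd-same X u (X a)

      lift : MatchIn R R → MatchIn ((a , u) ∷ (u , a) ∷ (u , a) ∷ R) ((u , a) ∷ (u , a) ∷ R)
      lift (ms , h) = true ∷ false ∷ ms , cov
        where
        cov : ∀ p → Covers (deg p ((a , u) ∷ (u , a) ∷ (u , a) ∷ R)) (inc p (u , a) + deg p (sel id ms))
        cov p with p ≟ a | p ≟ u
        ... | yes refl | yes p≡u  = ⊥-elim (a≢u p≡u)
        ... | yes refl | no _     = one-covers (cong suc (sel-fresh id ms fa))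
        ... | no _     | yes refl = one-covers (cong suc (sel-fresh id ms fu))
        ... | no _     | no _     = h p

    -- e = a u is parallel to another edge: replace the path b u a c by the edge b c.
    module ReduceDigon {a u b c : Fin n} {R : List (Edge n)} (a≢b : a ≢ b) (fa : deg a R ≡ 0) (fu : deg u R ≡ 0) (b≢c : b ≢ c)
                       (G : CubicBridgeless ((a , u) ∷ (u , a) ∷ (u , b) ∷ (a , c) ∷ R)) where
      private
        L : List (Edge n)
        L = (a , u) ∷ (u , a) ∷ (u , b) ∷ (a , c) ∷ R

        ineqs : a ≢ u × u ≢ b × a ≢ c × Loopless R
        ineqs with loopless G
        ... | a≢u ∷ _ ∷ u≢b ∷ a≢c ∷ ll = a≢u , u≢b , a≢c , ll
        a≢u : a ≢ u
        a≢u = proj₁ ineqs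
        u≢b : u ≢ b
        u≢b = proj₁ (proj₂ ineqs)
        a≢c : a ≢ c
        a≢c = proj₁ (proj₂ (proj₂ ineqs))

        u≢c : u ≢ c
        u≢c refl = contra (degrees G u)
          where
          contra : ¬ Cubic (deg u L)
          contra c rewrite δ-refl u | δ-≢ (≢-sym a≢u) | δ-≢ u≢b with () ← c

        same : ∀ {p} → p ≢ a → p ≢ u → deg p ((b , c) ∷ R) ≡ deg p L
        same {p} p≢a p≢u rewrite δ-≢ p≢a | δ-≢ p≢u = +-assoc (δ p b) (δ p c) (deg p R)

      good : CubicBridgeless ((b , c) ∷ R)
      good = record
        { degrees    = degs
        ; loopless   = b≢c ∷ proj₂ (proj₂ (proj₂ ineqs))
        -- With `u` and `a` on the side of `b`, the old edges are crossed only at `a c`, hence as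
        -- often as the new edge `b c`.
        ; bridgeless = λ X c → bridgeless G ((X [ u ≔ X b ]) [ a ≔ X b ]) (trans (eqn X) c)
        }
        where
        degs : ∀ p → Cubic (deg p ((b , c) ∷ R))
        degs p with p ≟ a | p ≟ u
        ... | yes refl | _        rewrite δ-≢ a≢b | δ-≢ a≢c | fa = isolated
        ... | no _     | yes refl rewrite δ-≢ u≢b | δ-≢ u≢c | fu = isolated
        ... | no p≢a   | no p≢u   = subst Cubic (sym (same p≢a p≢u)) (degrees G p)
        collapse : ∀ b c k → xr b b + (xr b b + (xr b b + (xr b c + k))) ≡ xr b c + k
        collapse true  c k = refl
        collapse false c k = refl
        eqn : ∀ X → cut ((X [ u ≔ X b ]) [ a ≔ X b ]) L ≡ cut X ((b , c) ∷ R)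
        eqn X = trans (cutIs Z L (across Za Zu (across Zu Za (across Zu Zb (across Za Zc (base ZR)))))) (collapse (X b) (X c) _)
          where
          Y  = X [ u ≔ X b ]
          Z  = Y [ a ≔ X b ]
          Za = upd-same Y a (X b)
          Zu = trans (upd-other Y (X b) (≢-sym a≢u)) (upd-same X u (X b))
          Zb = trans (upd-other Y (X b) (≢-sym a≢b)) (upd-other X (X b) (≢-sym u≢b))
          Zc = trans (upd-other Y (X b) (≢-sym a≢c)) (upd-other X (X b) (≢-sym u≢c))
          ZR = trans (cut-upd Y (X b) R fa) (cut-upd X (X b) R fu)

      lift : MatchIn ((b , c) ∷ R) R → MatchIn L ((u , a) ∷ (u , b) ∷ (a , c) ∷ R)
      -- As `b c` was avoided, `u b` and `a c` stay free, and the second copy of `a u` covers both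
      -- deleted vertices.
      lift (ms , h) = true ∷ false ∷ false ∷ ms , cov
        where
        cov : ∀ p → Covers (deg p L) (inc p (u , a) + deg p (sel id ms))
        cov p with p ≟ a in ea | p ≟ u in eu
        ... | yes refl | yes p≡u  = ⊥-elim (a≢u p≡u)
        ... | yes refl | no _     = one-covers (cong suc (sel-fresh id ms fa))
        ... | no _     | yes refl = one-covers (cong suc (sel-fresh id ms fu))
        ... | no p≢a   | no p≢u   = covers-≡ (sym (+-assoc (δ p b) (δ p c) (deg p R))) refl (h p)

    -- u v is a double edge: replace the path a u v d by the edge a d.
    module ReduceDouble {a u v d : Fin n} {R : List (Edge n)} (a≢v : a ≢ v) (fu : deg u R ≡ 0) (fv : deg v R ≡ 0) (a≢d : a ≢ d)
                        (G : CubicBridgeless ((a , u) ∷ (u , v) ∷ (u , v) ∷ (v , d) ∷ R)) where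
      private
        L : List (Edge n)
        L = (a , u) ∷ (u , v) ∷ (u , v) ∷ (v , d) ∷ R

        ineqs : a ≢ u × u ≢ v × v ≢ d × Loopless R
        ineqs with loopless G
        ... | a≢u ∷ u≢v ∷ _ ∷ v≢d ∷ ll = a≢u , u≢v , v≢d , ll
        a≢u : a ≢ u
        a≢u = proj₁ ineqs
        u≢v : u ≢ v
        u≢v = proj₁ (proj₂ ineqs)
        v≢d : v ≢ d
        v≢d = proj₁ (proj₂ (proj₂ ineqs))

        u≢d : u ≢ d
        u≢d refl = contra (degrees G u)
          where
          contra : ¬ Cubic (deg u L)
          contra c rewrite δ-refl u | δ-≢ (≢-sym a≢u) | δ-≢ u≢v with () ← c

        same : ∀ {p} → p ≢ u → p ≢ v → deg p ((a , d) ∷ R) ≡ deg p L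
        same {p} p≢u p≢v rewrite δ-≢ p≢u | δ-≢ p≢v = lemma (δ p a) (δ p d) (deg p R)
          where
          lemma : ∀ a d r → a + d + r ≡ a + 0 + (d + r)
          lemma = solve-∀

      good : CubicBridgeless ((a , d) ∷ R)
      good = record
        { degrees    = degs
        ; loopless   = a≢d ∷ proj₂ (proj₂ (proj₂ ineqs))
        ; bridgeless = λ X c → bridgeless G ((X [ u ≔ X a ]) [ v ≔ X a ]) (trans (eqn X) c)
        }
        where
        degs : ∀ p → Cubic (deg p ((a , d) ∷ R))
        degs p with p ≟ u | p ≟ v
        ... | yes refl | _        rewrite δ-≢ (≢-sym a≢u) | δ-≢ u≢d | fu = isolated
        ... | no _     | yes refl rewrite δ-≢ (≢-sym a≢v) | δ-≢ v≢d | fv = isolated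
        ... | no p≢u   | no p≢v   = subst Cubic (sym (same p≢u p≢v)) (degrees G p)
        collapse : ∀ a d k → xr a a + (xr a a + (xr a a + (xr a d + k))) ≡ xr a d + k
        collapse true  d k = refl
        collapse false d k = refl
        eqn : ∀ X → cut ((X [ u ≔ X a ]) [ v ≔ X a ]) L ≡ cut X ((a , d) ∷ R)
        eqn X = trans (cutIs Z L (across Za Zu (across Zu Zv (across Zu Zv (across Zv Zd (base ZR)))))) (collapse (X a) (X d) _)
          where
          Y  = X [ u ≔ X a ]
          Z  = Y [ v ≔ X a ]
          Zv = upd-same Y v (X a)
          Zu = trans (upd-other Y (X a) u≢v) (upd-same X u (X a))
          Za = trans (upd-other Y (X a) a≢v) (upd-other X (X a) a≢u)
          Zd = trans (upd-other Y (X a) (≢-sym v≢d)) (upd-other X (X a) (≢-sym u≢d))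
          ZR = trans (cut-upd Y (X a) R fv) (cut-upd X (X a) R fu)

      lift : MatchIn ((a , d) ∷ R) R → MatchIn L ((u , v) ∷ (u , v) ∷ (v , d) ∷ R)
      lift (ms , h) = true ∷ false ∷ false ∷ ms , cov
        where
        cov : ∀ p → Covers (deg p L) (inc p (u , v) + deg p (sel id ms))
        cov p with p ≟ u | p ≟ v
        ... | yes refl | yes p≡v  = ⊥-elim (u≢v p≡v)
        ... | yes refl | no _     = one-covers (cong suc (sel-fresh id ms fu))
        ... | no _     | yes refl = one-covers (cong suc (sel-fresh id ms fv))
        ... | no p≢u   | no p≢v   = covers-≡ (lemma (δ p a) (δ p d) (deg p R)) refl (h p)
          where
          lemma : ∀ a d r → a + 0 + (d + r) ≡ a + d + r
          lemma = solve-∀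

  -- Frink's reduction and crossing cuts

  xr-self : ∀ a → xr a a ≡ 0
  xr-self true  = refl
  xr-self false = refl

  xr-split : ∀ a b → (a ≡ b × xr a b ≡ 0) ⊎ (a ≡ not b × xr a b ≡ 1)
  xr-split true  true  = inj₁ (refl , refl)
  xr-split true  false = inj₂ (refl , refl)
  xr-split false true  = inj₂ (refl , refl)
  xr-split false false = inj₁ (refl , refl)

  infix 8 _≐_
  _≐_ : Bool → Bool → Bool
  a ≐ b = not (a xor b)

  ≐-not : ∀ a → a ≐ not a ≡ false
  ≐-not true  = refl
  ≐-not false = refl

  not-≐ : ∀ a → not a ≐ a ≡ false
  not-≐ true  = refl
  not-≐ false = refl

  ∧-falseʳ : ∀ a → a ∧ false ≡ false
  ∧-falseʳ true  = refl
  ∧-falseʳ false = refl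

  -- Case check on the sides of the neighbours a, b of `u` and c, d of `v`. Unless a, c lie on one
  -- side and b, d on the other, sides α of `u` and β of `v` can be chosen such that the original
  -- graph is crossed only once as well.
  exit-or-split : ∀ a b c d k → xr a c + (xr b d + k) ≡ 1 →
    (∃₂ λ α β → xr a α + (xr α β + (xr α b + (xr β c + (xr β d + k)))) ≡ 1) ⊎
    (a ≡ c × b ≡ d × a ≡ not b × k ≡ 1)
  exit-or-split false false false false k e = inj₁ (false , false , e)
  exit-or-split false false false true  k e = inj₁ (false , false , e)
  exit-or-split false false true  false k e = inj₁ (false , false , e)
  exit-or-split false false true  true  k ()
  exit-or-split false true  false false k e = inj₁ (false , false , e)
  exit-or-split false true  false true  k e = inj₂ (refl , refl , refl , e)
  exit-or-split false true  true  false k ()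
  exit-or-split false true  true  true  k e = inj₁ (true , true , e)
  exit-or-split true  false false false k e = inj₁ (false , false , e)
  exit-or-split true  false false true  k ()
  exit-or-split true  false true  false k e = inj₂ (refl , refl , refl , e)
  exit-or-split true  false true  true  k e = inj₁ (true , true , e)
  exit-or-split true  true  false false k ()
  exit-or-split true  true  false true  k e = inj₁ (true , true , e)
  exit-or-split true  true  true  false k e = inj₁ (true , true , e)
  exit-or-split true  true  true  true  k e = inj₁ (true , true , e)

  -- The four neighbours lie in the four different quadrants of two cuts. So any quadrant, with `u`
  -- and `v` outside, is entered by exactly one of the five deleted edges.
  corner : ∀ {a b c d s t} σ τ → a ≡ c → b ≡ d → a ≡ not b → s ≡ not t → ∀ {s₁ s₂} → s₁ ≡ s → s₂ ≡ t →
    xr (a ≐ σ ∧ s ≐ τ) false + (xr false false + (xr false (b ≐ σ ∧ t ≐ τ) +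
      (xr false (c ≐ σ ∧ s₂ ≐ τ) + (xr false (d ≐ σ ∧ s₁ ≐ τ) + 0)))) ≡ 1
  corner {b = true}  {t = true}  true  true  refl refl refl refl refl refl = refl
  corner {b = true}  {t = true}  true  false refl refl refl refl refl refl = refl
  corner {b = true}  {t = true}  false true  refl refl refl refl refl refl = refl
  corner {b = true}  {t = true}  false false refl refl refl refl refl refl = refl
  corner {b = true}  {t = false} true  true  refl refl refl refl refl refl = refl
  corner {b = true}  {t = false} true  false refl refl refl refl refl refl = refl
  corner {b = true}  {t = false} false true  refl refl refl refl refl refl = refl
  corner {b = true}  {t = false} false false refl refl refl refl refl refl = refl
  corner {b = false} {t = true}  true  true  refl refl refl refl refl refl = refl
  corner {b = false} {t = true}  true  false refl refl refl refl refl refl = refl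
  corner {b = false} {t = true}  false true  refl refl refl refl refl refl = refl
  corner {b = false} {t = true}  false false refl refl refl refl refl refl = refl
  corner {b = false} {t = false} true  true  refl refl refl refl refl refl = refl
  corner {b = false} {t = false} true  false refl refl refl refl refl refl = refl
  corner {b = false} {t = false} false true  refl refl refl refl refl refl = refl
  corner {b = false} {t = false} false false refl refl refl refl refl refl = refl

  module _ {n : ℕ} where

    open CubicBridgeless

    quadrant : (X Y : Fin n → Bool) → Bool → Bool → Fin n → Bool
    quadrant X Y σ τ p = X p ≐ σ ∧ Y p ≐ τ

    -- If both ways of reconnecting in Frink's reduction have a bridge, given by X and Y, then
    -- a quadrant that R does not cross is left by a single edge of the original graph.
    module Quadrants (X Y : Fin n → Bool) where

      uncrossed₀₀ : ∀ R → cut X R ≡ 0 → cut Y R ≡ 0 → ∀ σ τ → cut (quadrant X Y σ τ) R ≡ 0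
      uncrossed₀₀ [] _ _ σ τ = refl
      uncrossed₀₀ ((x , y) ∷ R) eX eY σ τ with xr-split (X x) (X y) | xr-split (Y x) (Y y)
      ... | inj₂ (_ , o) | _ rewrite o with () ← eX
      ... | _ | inj₂ (_ , o) rewrite o with () ← eY
      ... | inj₁ (p , o) | inj₁ (q , o′) rewrite o | o′ | p | q | xr-self (X y ≐ σ ∧ Y y ≐ τ) = uncrossed₀₀ R eX eY σ τ

      uncrossed₁₀ : ∀ R → cut X R ≡ 1 → cut Y R ≡ 0 → ∃ λ τ → ∀ σ → cut (quadrant X Y σ τ) R ≡ 0
      uncrossed₁₀ ((x , y) ∷ R) eX eY with xr-split (X x) (X y) | xr-split (Y x) (Y y)
      ... | _ | inj₂ (_ , o) rewrite o with () ← eY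
      uncrossed₁₀ ((x , y) ∷ R) eX eY | inj₁ (p , o) | inj₁ (q , o′) rewrite o | o′ with uncrossed₁₀ R eX eY
      ... | τ , h = τ , k
        where
        k : ∀ σ → cut (quadrant X Y σ τ) ((x , y) ∷ R) ≡ 0
        k σ rewrite p | q | xr-self (X y ≐ σ ∧ Y y ≐ τ) = h σ
      uncrossed₁₀ ((x , y) ∷ R) eX eY | inj₂ (p , o) | inj₁ (q , o′) rewrite o | o′ = not (Y y) , k
        where
        k : ∀ σ → cut (quadrant X Y σ (not (Y y))) ((x , y) ∷ R) ≡ 0
        k σ rewrite q | ≐-not (Y y) | ∧-falseʳ (X x ≐ σ) | ∧-falseʳ (X y ≐ σ) =
          uncrossed₀₀ R (suc-injective eX) eY σ (not (Y y))

      uncrossed₀₁ : ∀ R → cut X R ≡ 0 → cut Y R ≡ 1 → ∃ λ σ → ∀ τ → cut (quadrant X Y σ τ) R ≡ 0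
      uncrossed₀₁ ((x , y) ∷ R) eX eY with xr-split (X x) (X y) | xr-split (Y x) (Y y)
      ... | inj₂ (_ , o) | _ rewrite o with () ← eX
      uncrossed₀₁ ((x , y) ∷ R) eX eY | inj₁ (p , o) | inj₁ (q , o′) rewrite o | o′ with uncrossed₀₁ R eX eY
      ... | σ , h = σ , k
        where
        k : ∀ τ → cut (quadrant X Y σ τ) ((x , y) ∷ R) ≡ 0
        k τ rewrite p | q | xr-self (X y ≐ σ ∧ Y y ≐ τ) = h τ
      uncrossed₀₁ ((x , y) ∷ R) eX eY | inj₁ (p , o) | inj₂ (q , o′) rewrite o | o′ = not (X y) , k
        where
        k : ∀ τ → cut (quadrant X Y (not (X y)) τ) ((x , y) ∷ R) ≡ 0
        k τ rewrite p | ≐-not (X y) = uncrossed₀₀ R eX (suc-injective eY) (not (X y)) τ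

      -- If one edge crosses `X` on one side of `Y` and another crosses `Y` on one side of `X`, the
      -- quadrant opposite to these two sides is free. A single edge that crosses both joins
      -- opposite quadrants, and the other two are free.
      uncrossed₁₁ : ∀ R → cut X R ≡ 1 → cut Y R ≡ 1 → ∃₂ λ σ τ → cut (quadrant X Y σ τ) R ≡ 0
      uncrossed₁₁ ((x , y) ∷ R) eX eY with xr-split (X x) (X y) | xr-split (Y x) (Y y)
      uncrossed₁₁ ((x , y) ∷ R) eX eY | inj₁ (p , o) | inj₁ (q , o′) rewrite o | o′ with uncrossed₁₁ R eX eY
      ... | σ , τ , h = σ , τ , k
        where
        k : cut (quadrant X Y σ τ) ((x , y) ∷ R) ≡ 0
        k rewrite p | q | xr-self (X y ≐ σ ∧ Y y ≐ τ) = h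
      uncrossed₁₁ ((x , y) ∷ R) eX eY | inj₂ (p , o) | inj₁ (q , o′) rewrite o | o′
        with uncrossed₀₁ R (suc-injective eX) eY
      ... | σ , h = σ , not (Y y) , k
        where
        k : cut (quadrant X Y σ (not (Y y))) ((x , y) ∷ R) ≡ 0
        k rewrite q | ≐-not (Y y) | ∧-falseʳ (X x ≐ σ) | ∧-falseʳ (X y ≐ σ) = h (not (Y y))
      uncrossed₁₁ ((x , y) ∷ R) eX eY | inj₁ (p , o) | inj₂ (q , o′) rewrite o | o′
        with uncrossed₁₀ R eX (suc-injective eY)
      ... | τ , h = not (X y) , τ , k
        where
        k : cut (quadrant X Y (not (X y)) τ) ((x , y) ∷ R) ≡ 0
        k rewrite p | ≐-not (X y) = h (not (X y))
      uncrossed₁₁ ((x , y) ∷ R) eX eY | inj₂ (p , o) | inj₂ (q , o′) rewrite o | o′ = X y , not (Y y) , k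
        where
        k : cut (quadrant X Y (X y) (not (Y y))) ((x , y) ∷ R) ≡ 0
        k rewrite p | ≐-not (Y y) | ∧-falseʳ (X y ≐ X y) | not-≐ (X y) =
          uncrossed₀₀ R (suc-injective eX) (suc-injective eY) (X y) (not (Y y))

    -- The choice between the two reconnections has to be made effectively: it is decided by running
    -- through all vertex subsets, and a failure comes with a cut.
    bridgeless? : (L : List (Edge n)) → Bridgeless L ⊎ ∃ λ X → cut X L ≡ 1
    bridgeless? L with anySubset? (λ S → cut (Vec.lookup S) L ℕ.≟ 1)
    ... | yes (S , eq) = inj₂ (Vec.lookup S , eq)
    ... | no none      = inj₁ λ X eq → none (Vec.tabulate X , trans (cut-cong (lookup∘tabulate X) L) eq)

    -- Frink's reduction: delete u and v and join a to c and b to d.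
    module Frink {a u b v c d : Fin n} {R : List (Edge n)}
                 (a≢v : a ≢ v) (b≢v : b ≢ v) (c≢u : c ≢ u) (d≢u : d ≢ u)
                 (fu : deg u R ≡ 0) (fv : deg v R ≡ 0)
                 (G : CubicBridgeless ((a , u) ∷ (u , v) ∷ (u , b) ∷ (v , c) ∷ (v , d) ∷ R)) where
      private
        L : List (Edge n)
        L = (a , u) ∷ (u , v) ∷ (u , b) ∷ (v , c) ∷ (v , d) ∷ R

        ineqs : a ≢ u × u ≢ v × u ≢ b × v ≢ c × v ≢ d × Loopless R
        ineqs with loopless G
        ... | a≢u ∷ u≢v ∷ u≢b ∷ v≢c ∷ v≢d ∷ ll = a≢u , u≢v , u≢b , v≢c , v≢d , ll
        a≢u : a ≢ u
        a≢u = proj₁ ineqs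
        u≢v : u ≢ v
        u≢v = proj₁ (proj₂ ineqs)
        u≢b : u ≢ b
        u≢b = proj₁ (proj₂ (proj₂ ineqs))
        v≢c : v ≢ c
        v≢c = proj₁ (proj₂ (proj₂ (proj₂ ineqs)))
        v≢d : v ≢ d
        v≢d = proj₁ (proj₂ (proj₂ (proj₂ (proj₂ ineqs))))

        same : ∀ {p} → p ≢ u → p ≢ v → deg p ((a , c) ∷ (b , d) ∷ R) ≡ deg p L
        same {p} p≢u p≢v rewrite δ-≢ p≢u | δ-≢ p≢v = lemma (δ p a) (δ p b) (δ p c) (δ p d) (deg p R)
          where
          lemma : ∀ a b c d r → a + c + (b + d + r) ≡ a + 0 + (b + (c + (d + r)))
          lemma = solve-∀

      extend : ∀ X α β → cut ((X [ u ≔ α ]) [ v ≔ β ]) L ≡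
               xr (X a) α + (xr α β + (xr α (X b) + (xr β (X c) + (xr β (X d) + cut X R))))
      extend X α β = cutIs Z L (across Za Zu (across Zu Zv (across Zu Zb (across Zv Zc (across Zv Zd (base ZR))))))
        where
        Y  = X [ u ≔ α ]
        Z  = Y [ v ≔ β ]
        Zv = upd-same Y v β
        Zu = trans (upd-other Y β u≢v) (upd-same X u α)
        Za = trans (upd-other Y β a≢v) (upd-other X α a≢u)
        Zb = trans (upd-other Y β b≢v) (upd-other X α (≢-sym u≢b))
        Zc = trans (upd-other Y β (≢-sym v≢c)) (upd-other X α c≢u)
        Zd = trans (upd-other Y β (≢-sym v≢d)) (upd-other X α d≢u)
        ZR = trans (cut-upd Y β R fv) (cut-upd X α R fu)

      splits : ∀ X → cut X ((a , c) ∷ (b , d) ∷ R) ≡ 1 →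
               X a ≡ X c × X b ≡ X d × X a ≡ not (X b) × cut X R ≡ 1
      splits X eq with exit-or-split (X a) (X b) (X c) (X d) (cut X R) eq
      ... | inj₂ s            = s
      ... | inj₁ (α , β , e) = ⊥-elim (bridgeless G ((X [ u ≔ α ]) [ v ≔ β ]) (trans (extend X α β) e))

      good : a ≢ c → b ≢ d → Bridgeless ((a , c) ∷ (b , d) ∷ R) → CubicBridgeless ((a , c) ∷ (b , d) ∷ R)
      good a≢c b≢d bl = record
        { degrees    = degs
        ; loopless   = a≢c ∷ b≢d ∷ proj₂ (proj₂ (proj₂ (proj₂ (proj₂ ineqs))))
        ; bridgeless = bl
        }
        where
        degs : ∀ p → Cubic (deg p ((a , c) ∷ (b , d) ∷ R))
        degs p with p ≟ u | p ≟ v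
        ... | yes refl | _        rewrite δ-≢ (≢-sym a≢u) | δ-≢ u≢b | δ-≢ (≢-sym c≢u) | δ-≢ (≢-sym d≢u) = subst Cubic (sym fu) isolated
        ... | no _     | yes refl rewrite δ-≢ (≢-sym a≢v) | δ-≢ v≢c | δ-≢ (≢-sym b≢v) | δ-≢ v≢d = subst Cubic (sym fv) isolated
        ... | no p≢u   | no p≢v   = subst Cubic (sym (same p≢u p≢v)) (degrees G p)

      lift : MatchIn ((a , c) ∷ (b , d) ∷ R) ((b , d) ∷ R) →
             MatchIn L ((u , v) ∷ (u , b) ∷ (v , c) ∷ (v , d) ∷ R)
      lift (true ∷ ms , h) = false ∷ true ∷ false ∷ true ∷ ms , cov
        where
        cov : ∀ p → Covers (deg p L) (inc p (u , b) + (inc p (v , d) + deg p (sel id ms)))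
        cov p with p ≟ u in eu | p ≟ v in ev
        ... | yes refl | yes p≡v  = ⊥-elim (u≢v p≡v)
        ... | yes refl | no _     rewrite δ-≢ u≢b | δ-≢ (≢-sym d≢u) = one-covers (cong suc (sel-fresh id ms fu))
        ... | no _     | yes refl rewrite δ-≢ (≢-sym b≢v) | δ-≢ v≢d = one-covers (cong suc (sel-fresh id ms fv))
        ... | no p≢u   | no p≢v  = covers-≡ (lemma (δ p a) (δ p b) (δ p c) (δ p d) (deg p R))
                                            (sym (+-assoc (δ p b) (δ p d) _)) (h p)
          where
          lemma : ∀ a b c d r → a + 0 + (b + (c + (d + r))) ≡ a + c + (b + d + r)
          lemma = solve-∀
      lift (false ∷ ms , h) = true ∷ false ∷ false ∷ false ∷ ms , cov
        where
        cov : ∀ p → Covers (deg p L) (inc p (u , v) + deg p (sel id ms))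
        cov p with p ≟ u in eu | p ≟ v in ev
        ... | yes refl | yes p≡v  = ⊥-elim (u≢v p≡v)
        ... | yes refl | no _     = one-covers (cong suc (sel-fresh id ms fu))
        ... | no _     | yes refl = one-covers (cong suc (sel-fresh id ms fv))
        ... | no p≢u   | no p≢v  = covers-≡ (lemma (δ p a) (δ p b) (δ p c) (δ p d) (deg p R)) refl (h p)
          where
          lemma : ∀ a b c d r → a + 0 + (b + (c + (d + r))) ≡ a + c + (b + d + r)
          lemma = solve-∀

  not-fixed : ∀ b → b ≢ not b
  not-fixed true  ()
  not-fixed false ()

  cubic-rest : ∀ {d} k {x} → d ≡ suc k + x → Cubic d → suc k + x ≡ 3
  cubic-rest k () isolated
  cubic-rest k eq cubic = sym eq

  module _ {n : ℕ} where

    open CubicBridgeless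

    loopless-tail : ∀ {e : Edge n} {L} → Loopless (e ∷ L) → Loopless L
    loopless-tail (_ ∷ ll) = ll

    fresh-≈ : ∀ {u x y} {L R : List (Edge n)} → L ≈ (x , y) ∷ R → deg u L ≡ 0 → u ≢ x × u ≢ y × deg u R ≡ 0
    fresh-≈ {u} {x} {y} {R = R} r eq = fresh-∷ {u = u} {x} {y} {R} (trans (sym (deg-≈ u r)) eq)

    -- Avoidance drives the induction: a reduction that adds edges passes the condition on to one of
    -- them, and this ensures that the deleted vertices can be covered without `a u`.
    Avoiding : ℕ → Set
    Avoiding k = ∀ {a u} (L : List (Edge n)) → length L ≤ k → CubicBridgeless ((a , u) ∷ L) → MatchIn ((a , u) ∷ L) L

    module _ {k} (recurse : Avoiding k) where

      -- Any edge may serve as the avoided one; the first is taken.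
      matching-from : ∀ (L : List (Edge n)) → length L ≤ suc k → CubicBridgeless L → MatchIn L L
      matching-from [] le G = [] , λ p → z≤n , λ ()
      matching-from ((a , u) ∷ L) (s≤s le) G with recurse L le G
      ... | ms , h = false ∷ ms , h

      matching-digon : ∀ {a u b} (R : List (Edge n)) → length R ≤ k → deg u R ≡ 0 →
                       CubicBridgeless ((a , u) ∷ (u , a) ∷ (u , b) ∷ R) →
                       MatchIn ((a , u) ∷ (u , a) ∷ (u , b) ∷ R) ((u , a) ∷ (u , b) ∷ R)
      matching-digon {a} {u} {b} R le fu G with loopless G | b ≟ a
      ... | a≢u ∷ _ ∷ u≢b ∷ ll | yes refl = DropDigon.lift a≢u fa fu G (matching-from R (≤-trans le (n≤1+n k)) (DropDigon.good a≢u fa fu G))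
        where
        count : deg a ((a , u) ∷ (u , a) ∷ (u , a) ∷ R) ≡ 3 + deg a R
        count rewrite δ-refl a | δ-≢ a≢u = refl
        fa : deg a R ≡ 0
        fa = +-cancelˡ-≡ 3 _ _ (cubic-rest 2 count (degrees G a))
      ... | a≢u ∷ _ ∷ u≢b ∷ ll | no b≢a with pull a ll (+-cancelˡ-≡ 2 (deg a R) 1 (cubic-rest 1 count (degrees G a)))
        where
        count : deg a ((a , u) ∷ (u , a) ∷ (u , b) ∷ R) ≡ 2 + deg a R
        count rewrite δ-refl a | δ-≢ a≢u | δ-≢ (≢-sym b≢a) = refl
      ...   | c , R′ , r , a≢c , fa with fresh-≈ r fu
      ...     | _ , u≢c , fu′ = matchIn-≈ (≈-prep _ (≈-prep _ (≈-prep _ r))) (≈-prep _ (≈-prep _ r)) reduced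
        where
        G′ : CubicBridgeless ((a , u) ∷ (u , a) ∷ (u , b) ∷ (a , c) ∷ R′)
        G′ = cubicBridgeless-≈ (≈-prep _ (≈-prep _ (≈-prep _ r))) G
        ll′ : Loopless R′
        ll′ = loopless-tail (loopless-≈ r ll)
        -- Otherwise the third edge at `b` would be the only exit from `a`, `u`, `b`.
        b≢c : b ≢ c
        b≢c refl = no-single-exit (a ∷ u ∷ b ∷ []) b {K = (a , u) ∷ (u , a) ∷ (u , b) ∷ (a , b) ∷ []} (bridgeless G′) ll′
          ((here refl , there (here refl)) ∷ (there (here refl) , here refl) ∷
           (there (here refl) , there (there (here refl))) ∷ (here refl , there (there (here refl))) ∷ [])
          (there (there (here refl)))
          (λ { (here refl) → inj₂ fa ; (there (here refl)) → inj₂ fu′ ; (there (there (here refl))) → inj₁ refl })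
          (+-cancelˡ-≡ 2 _ _ (cubic-rest 1 count (degrees G′ b)))
          where
          count : deg b ((a , u) ∷ (u , a) ∷ (u , b) ∷ (a , b) ∷ R′) ≡ 2 + deg b R′
          count rewrite δ-refl b | δ-≢ (≢-sym u≢b) | δ-≢ b≢a = refl
        reduced : MatchIn ((a , u) ∷ (u , a) ∷ (u , b) ∷ (a , c) ∷ R′) ((u , a) ∷ (u , b) ∷ (a , c) ∷ R′)
        reduced = ReduceDigon.lift (≢-sym b≢a) fa fu′ b≢c G′
          (recurse R′ (≤-trans (n≤1+n _) (subst (_≤ k) (≈-length r) le))
            (ReduceDigon.good (≢-sym b≢a) fa fu′ b≢c G′))

      matching-double : ∀ {a u v} (R : List (Edge n)) → length R ≤ k → deg u R ≡ 0 → a ≢ v →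
                        CubicBridgeless ((a , u) ∷ (u , v) ∷ (u , v) ∷ R) →
                        MatchIn ((a , u) ∷ (u , v) ∷ (u , v) ∷ R) ((u , v) ∷ (u , v) ∷ R)
      matching-double {a} {u} {v} R le fu a≢v G with loopless G
      ... | a≢u ∷ u≢v ∷ _ ∷ ll with pull v ll (+-cancelˡ-≡ 2 _ _ (cubic-rest 1 count (degrees G v)))
        where
        count : deg v ((a , u) ∷ (u , v) ∷ (u , v) ∷ R) ≡ 2 + deg v R
        count rewrite δ-refl v | δ-≢ (≢-sym a≢v) | δ-≢ (≢-sym u≢v) = refl
      ...   | d , R′ , r , v≢d , fv with fresh-≈ r fu
      ...     | _ , u≢d , fu′ = matchIn-≈ (≈-prep _ (≈-prep _ (≈-prep _ r))) (≈-prep _ (≈-prep _ r)) reduced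
        where
        G′ : CubicBridgeless ((a , u) ∷ (u , v) ∷ (u , v) ∷ (v , d) ∷ R′)
        G′ = cubicBridgeless-≈ (≈-prep _ (≈-prep _ (≈-prep _ r))) G
        ll′ : Loopless R′
        ll′ = loopless-tail (loopless-≈ r ll)
        a≢d : a ≢ d
        a≢d refl = no-single-exit (u ∷ v ∷ a ∷ []) a {K = (a , u) ∷ (u , v) ∷ (u , v) ∷ (v , a) ∷ []} (bridgeless G′) ll′
          ((there (there (here refl)) , here refl) ∷ (here refl , there (here refl)) ∷
           (here refl , there (here refl)) ∷ (there (here refl) , there (there (here refl))) ∷ [])
          (there (there (here refl)))
          (λ { (here refl) → inj₂ fu′ ; (there (here refl)) → inj₂ fv ; (there (there (here refl))) → inj₁ refl })
          (+-cancelˡ-≡ 2 _ _ (cubic-rest 1 count (degrees G′ a)))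
          where
          count : deg a ((a , u) ∷ (u , v) ∷ (u , v) ∷ (v , a) ∷ R′) ≡ 2 + deg a R′
          count rewrite δ-refl a | δ-≢ a≢v | δ-≢ a≢u = refl
        reduced : MatchIn ((a , u) ∷ (u , v) ∷ (u , v) ∷ (v , d) ∷ R′) ((u , v) ∷ (u , v) ∷ (v , d) ∷ R′)
        reduced = ReduceDouble.lift a≢v fu′ fv a≢d G′
          (recurse R′ (≤-trans (n≤1+n _) (subst (_≤ k) (≈-length r) le))
            (ReduceDouble.good a≢v fu′ fv a≢d G′))

      matching-frink : ∀ {a u v b} (R : List (Edge n)) → length R ≤ k → deg u R ≡ 0 → a ≢ v → b ≢ v → a ≢ b →
                       CubicBridgeless ((a , u) ∷ (u , v) ∷ (u , b) ∷ R) →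
                       MatchIn ((a , u) ∷ (u , v) ∷ (u , b) ∷ R) ((u , v) ∷ (u , b) ∷ R)
      matching-frink {a} {u} {v} {b} R le fu a≢v b≢v a≢b G with loopless G
      ... | a≢u ∷ u≢v ∷ u≢b ∷ ll with pull v ll (+-cancelˡ-≡ 1 _ _ (cubic-rest 0 count (degrees G v)))
        where
        count : deg v ((a , u) ∷ (u , v) ∷ (u , b) ∷ R) ≡ 1 + deg v R
        count rewrite δ-refl v | δ-≢ (≢-sym a≢v) | δ-≢ (≢-sym u≢v) | δ-≢ (≢-sym b≢v) = refl
      ...   | c , R₁ , r₁ , v≢c , eq with pull v (loopless-tail (loopless-≈ r₁ ll)) eq
      ...     | d , R′ , r₂ , v≢d , fv with fresh-≈ r₁ fu
      ...       | _ , u≢c , fu₁ with fresh-≈ r₂ fu₁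
      ...         | _ , u≢d , fu′ = matchIn-≈ (≈-prep _ (≈-prep _ (≈-prep _ r))) (≈-prep _ (≈-prep _ r)) reduced
        where
        r : R ≈ (v , c) ∷ (v , d) ∷ R′
        r = ≈-trans r₁ (≈-prep _ r₂)
        Target : Fin n → Fin n → Set
        Target c d = MatchIn ((a , u) ∷ (u , v) ∷ (u , b) ∷ (v , c) ∷ (v , d) ∷ R′) ((u , v) ∷ (u , b) ∷ (v , c) ∷ (v , d) ∷ R′)
        G′ : CubicBridgeless ((a , u) ∷ (u , v) ∷ (u , b) ∷ (v , c) ∷ (v , d) ∷ R′)
        G′ = cubicBridgeless-≈ (≈-prep _ (≈-prep _ (≈-prep _ r))) G
        swapped : (a , u) ∷ (u , v) ∷ (u , b) ∷ (v , c) ∷ (v , d) ∷ R′ ≈ (a , u) ∷ (u , v) ∷ (u , b) ∷ (v , d) ∷ (v , c) ∷ R′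
        swapped = ≈-prep _ (≈-prep _ (≈-prep _ (≈-swap _ _)))
        G″ : CubicBridgeless ((a , u) ∷ (u , v) ∷ (u , b) ∷ (v , d) ∷ (v , c) ∷ R′)
        G″ = cubicBridgeless-≈ swapped G′
        ll′ : Loopless R′
        ll′ = loopless-tail (loopless-tail (loopless-≈ r ll))
        module Straight = Frink a≢v b≢v (≢-sym u≢c) (≢-sym u≢d) fu′ fv G′
        module Cross    = Frink a≢v b≢v (≢-sym u≢d) (≢-sym u≢c) fu′ fv G″
        short : suc (length R′) ≤ k
        short = ≤-trans (n≤1+n _) (subst (_≤ k) (≈-length r) le)
        straight : a ≢ c → b ≢ d → Bridgeless ((a , c) ∷ (b , d) ∷ R′) → Target c d
        straight a≢c b≢d bl = Straight.lift (recurse ((b , d) ∷ R′) short (Straight.good a≢c b≢d bl))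
        cross : a ≢ d → b ≢ c → Bridgeless ((a , d) ∷ (b , c) ∷ R′) → Target c d
        cross a≢d b≢c bl = matchIn-≈ swapped (≈-prep _ (≈-prep _ (≈-swap _ _)))
          (Cross.lift (recurse ((b , c) ∷ R′) short (Cross.good a≢d b≢c bl)))
        -- A double edge between `v` and a neighbour `w` of `u` saturates `v` and `w`, so `u o`
        -- would be a bridge.
        one-exit : ∀ {w o} → w ≢ u → w ≢ v → w ≢ o → u ≢ o → v ≢ o →
                   ¬ CubicBridgeless ((w , u) ∷ (u , v) ∷ (v , w) ∷ (v , w) ∷ (u , o) ∷ R′)
        one-exit {w} {o} w≢u w≢v w≢o u≢o v≢o H =
          no-single-exit (w ∷ u ∷ v ∷ []) u {K = (w , u) ∷ (u , v) ∷ (v , w) ∷ (v , w) ∷ []} (bridgeless H) (u≢o ∷ ll′)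
            ((here refl , there (here refl)) ∷ (there (here refl) , there (there (here refl))) ∷
             (there (there (here refl)) , here refl) ∷ (there (there (here refl)) , here refl) ∷ [])
            (there (here refl))
            (λ { (here refl) → inj₂ freshw ; (there (here refl)) → inj₁ refl ; (there (there (here refl))) → inj₂ freshv })
            exit
          where
          count : deg w ((w , u) ∷ (u , v) ∷ (v , w) ∷ (v , w) ∷ (u , o) ∷ R′) ≡ 3 + deg w R′
          count rewrite δ-refl w | δ-≢ w≢u | δ-≢ w≢v | δ-≢ w≢o = refl
          freshw : deg w ((u , o) ∷ R′) ≡ 0
          freshw rewrite δ-≢ w≢u | δ-≢ w≢o = +-cancelˡ-≡ 3 _ _ (cubic-rest 2 count (degrees H w))
          freshv : deg v ((u , o) ∷ R′) ≡ 0
          freshv rewrite δ-≢ (≢-sym u≢v) | δ-≢ v≢o = fv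
          exit : deg u ((u , o) ∷ R′) ≡ 1
          exit rewrite δ-refl u | δ-≢ u≢o = cong suc fu′
        crossed : Bridgeless ((a , c) ∷ (b , d) ∷ R′) ⊎ Bridgeless ((a , d) ∷ (b , c) ∷ R′)
        crossed with bridgeless? ((a , c) ∷ (b , d) ∷ R′)
        ... | inj₁ bl       = inj₁ bl
        ... | inj₂ (X , eX) = inj₂ λ Y eY → contra Y (Cross.splits Y eY)
          where
          contra : ∀ Y → ¬ (Y a ≡ Y d × Y b ≡ Y c × Y a ≡ not (Y b) × cut Y R′ ≡ 1)
          contra Y (ad , bc , ab , eY) with Straight.splits X eX
          ... | ac , bd , ab′ , eX′ with Quadrants.uncrossed₁₁ X Y R′ eX′ eY
          -- The quadrant is not crossed by the remaining edges; keeping `u` and `v` outside leaves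
          -- the single edge to its one corner.
          ...   | σ , τ , eq = bridgeless G′ ((Q [ u ≔ false ]) [ v ≔ false ])
                    (trans (Straight.extend Q false false)
                      (trans (cong (λ k → xr (Q a) false + (xr false false + (xr false (Q b) + (xr false (Q c) + (xr false (Q d) + k))))) eq)
                        (corner σ τ ac bd ab′ ab (sym ad) (sym bc))))
            where
            Q = quadrant X Y σ τ
        reduced : Target c d
        reduced with a ≟ c | b ≟ d | a ≟ d | b ≟ c
        ... | yes refl | _        | yes refl | _        = ⊥-elim (one-exit a≢u a≢v a≢b u≢b (≢-sym b≢v) (cubicBridgeless-≈ reorder G′))
          where
          reorder : (a , u) ∷ (u , v) ∷ (u , b) ∷ (v , a) ∷ (v , a) ∷ R′ ≈ (a , u) ∷ (u , v) ∷ (v , a) ∷ (v , a) ∷ (u , b) ∷ R′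
          reorder = ≈-prep _ (≈-prep _ (≈-trans (≈-swap _ _) (≈-prep _ (≈-swap _ _))))
        ... | yes refl | _        | no _     | yes refl = ⊥-elim (a≢b refl)
        -- A bridge would have `a` and `b` on different sides but `b` and `c` on the same one,
        -- impossible as `c` is `a`. The three similar cases below are excluded in the same way.
        ... | yes refl | _        | no a≢d   | no b≢c   = cross a≢d b≢c λ X eX → let _ , bc , ab , _ = Cross.splits X eX in
                                                            not-fixed (X b) (trans bc ab)
        ... | no _     | yes refl | yes refl | _        = ⊥-elim (a≢b refl)
        ... | no _     | yes refl | no _     | yes refl = ⊥-elim (one-exit (≢-sym u≢b) b≢v (≢-sym a≢b) (≢-sym a≢u) (≢-sym a≢v) (cubicBridgeless-≈ reorder G′))
          where
          reorder : (a , u) ∷ (u , v) ∷ (u , b) ∷ (v , b) ∷ (v , b) ∷ R′ ≈ (b , u) ∷ (u , v) ∷ (v , b) ∷ (v , b) ∷ (u , a) ∷ R′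
          reorder =
            ≈-trans (≈-flip _ _) (≈-trans (≈-swap _ _) (≈-trans (≈-prep _ (≈-swap _ _)) (≈-trans (≈-swap _ _)
            (≈-trans (≈-flip _ _) (≈-prep _ (≈-prep _ (≈-trans (≈-swap _ _) (≈-prep _ (≈-swap _ _)))))))))
        ... | no _     | yes refl | no a≢d   | no b≢c   = cross a≢d b≢c λ X eX → let ad , _ , ab , _ = Cross.splits X eX in
                                                            not-fixed (X b) (trans (sym ad) ab)
        ... | no a≢c   | no b≢d   | yes refl | _        = straight a≢c b≢d λ X eX → let _ , bd , ab , _ = Straight.splits X eX in
                                                            not-fixed (X b) (trans bd ab)
        ... | no a≢c   | no b≢d   | no _     | yes refl = straight a≢c b≢d λ X eX → let ac , _ , ab , _ = Straight.splits X eX in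
                                                            not-fixed (X b) (trans (sym ac) ab)
        ... | no a≢c   | no b≢d   | no a≢d   | no b≢c   with crossed
        ...   | inj₁ bl = straight a≢c b≢d bl
        ...   | inj₂ bl = cross a≢d b≢c bl

    -- The reduction takes place at the end `u` of the avoided edge. Coincidences among its three
    -- neighbours `a`, `v`, `b` are parallel edges and have their own reductions; `k` bounds the
    -- number of edges other than the avoided one.
    matching-avoiding : ∀ k → Avoiding k
    matching-avoiding zero    [] z≤n G with () ← degree-rest G
    matching-avoiding (suc k) {a} {u} L le G
      with pull u (loopless-tail (loopless G)) (degree-rest G)
    ... | v , L₁ , r₁ , _ , eq₁ with pull u (loopless-tail (loopless-≈ r₁ (loopless-tail (loopless G)))) eq₁
    ...   | b , R , r₂ , _ , fu = matchIn-≈ (≈-prep _ r) r shape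
      where
      r : L ≈ (u , v) ∷ (u , b) ∷ R
      r = ≈-trans r₁ (≈-prep _ r₂)
      G′ : CubicBridgeless ((a , u) ∷ (u , v) ∷ (u , b) ∷ R)
      G′ = cubicBridgeless-≈ (≈-prep _ r) G
      short : length R ≤ k
      short = ≤-trans (n≤1+n _) (≤-pred (subst (_≤ suc k) (≈-length r) le))
      shape : MatchIn ((a , u) ∷ (u , v) ∷ (u , b) ∷ R) ((u , v) ∷ (u , b) ∷ R)
      shape with a ≟ v | a ≟ b | b ≟ v
      ... | yes refl | _        | _        = matching-digon (matching-avoiding k) R short fu G′
      ... | no _     | yes refl | _        =
        matchIn-≈ (≈-prep _ (≈-swap _ _ {R})) (≈-swap _ _ {R})
          (matching-digon (matching-avoiding k) {b = v} R short fu (cubicBridgeless-≈ (≈-prep _ (≈-swap _ _)) G′))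
      ... | no a≢v   | no _     | yes refl = matching-double (matching-avoiding k) R short fu a≢v G′
      ... | no a≢v   | no a≢b   | no b≢v   = matching-frink (matching-avoiding k) R short fu a≢v b≢v a≢b G′

    matching : ∀ (L : List (Edge n)) → CubicBridgeless L → MatchIn L L
    matching L = matching-from (matching-avoiding (length L)) L (n≤1+n (length L))

  -- Covering the vertices of degree three when there are also vertices of degree two

  data Subcubic : ℕ → Set where
    deg0 : Subcubic 0
    deg2 : Subcubic 2
    deg3 : Subcubic 3

  module _ {n : ℕ} where

    -- `connected` concerns only vertices that are not isolated. It guarantees that an additional
    -- edge between two of them is not a bridge.
    record Bridgeless₂₃ (L : List (Edge n)) : Set where
      field
        degrees    : ∀ p → Subcubic (deg p L)
        loopless   : Loopless L
        bridgeless : Bridgeless L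
        connected  : ∀ X p q → deg p L ≢ 0 → deg q L ≢ 0 → cut X L ≡ 0 → X p ≡ X q
    open Bridgeless₂₃

    bridgeless₂₃-≈ : {L K : List (Edge n)} → L ≈ K → Bridgeless₂₃ L → Bridgeless₂₃ K
    bridgeless₂₃-≈ r G = record
      { degrees    = λ p → subst Subcubic (deg-≈ p r) (degrees G p)
      ; loopless   = loopless-≈ r (loopless G)
      ; bridgeless = bridgeless-≈ r (bridgeless G)
      ; connected  = λ X p q p∈ q∈ c → connected G X p q (p∈ ∘ trans (sym (deg-≈ p r))) (q∈ ∘ trans (sym (deg-≈ q r)))
                                         (trans (cut-≈ X r) c)
      }

    suppress : ∀ {t} {L : List (Edge n)} → Bridgeless₂₃ L → deg t L ≡ 2 → (∀ p → deg p L ≡ 2 → p ≡ t) → MatchIn L L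
    suppress {t} {L} G eq₂ only with pull t (loopless G) eq₂
    ... | a , L₁ , r₁ , t≢a , eq₁ with pull t (loopless-tail (loopless-≈ r₁ (loopless G))) eq₁
    ...   | b , R , r₂ , t≢b , ft = matchIn-≈ r r lifted
      where
      r : L ≈ (t , a) ∷ (t , b) ∷ R
      r = ≈-trans r₁ (≈-prep _ r₂)
      G′ : Bridgeless₂₃ ((t , a) ∷ (t , b) ∷ R)
      G′ = bridgeless₂₃-≈ r G
      only′ : ∀ p → deg p ((t , a) ∷ (t , b) ∷ R) ≡ 2 → p ≡ t
      only′ p e = only p (trans (deg-≈ p r) e)
      ll : Loopless R
      ll = loopless-tail (loopless-tail (loopless G′))
      -- If both neighbours of `t` coincide, that vertex has degree three, `t` being the only one of
      -- degree two, and its third edge is a bridge.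
      a≢b : a ≢ b
      a≢b refl = no-single-exit (t ∷ a ∷ []) a {K = (t , a) ∷ (t , a) ∷ []} (bridgeless G′) ll
        ((here refl , there (here refl)) ∷ (here refl , there (here refl)) ∷ []) (there (here refl))
        (λ { (here refl) → inj₂ ft ; (there (here refl)) → inj₁ refl }) (exit _ count (degrees G′ a))
        where
        count : deg a ((t , a) ∷ (t , a) ∷ R) ≡ 2 + deg a R
        count rewrite δ-refl a | δ-≢ (≢-sym t≢a) = refl
        exit : ∀ d → d ≡ 2 + deg a R → Subcubic d → deg a R ≡ 1
        exit _ () deg0
        exit _ e deg2 = ⊥-elim (t≢a (sym (only′ a (trans count (sym e)))))
        exit _ e deg3 = sym (+-cancelˡ-≡ 2 _ _ e)
      same : ∀ {p} → p ≢ t → deg p ((a , b) ∷ R) ≡ deg p ((t , a) ∷ (t , b) ∷ R)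
      same {p} p≢t rewrite δ-≢ p≢t = +-assoc (δ p a) (δ p b) (deg p R)
      good : CubicBridgeless ((a , b) ∷ R)
      good = record
        { degrees    = degs
        ; loopless   = a≢b ∷ ll
        ; bridgeless = λ X c → bridgeless G′ (X [ t ≔ X a ]) (trans (eqn X) c)
        }
        where
        degs : ∀ p → Cubic (deg p ((a , b) ∷ R))
        degs p with p ≟ t
        ... | yes refl rewrite δ-≢ t≢a | δ-≢ t≢b = subst Cubic (sym ft) isolated
        ... | no p≢t = to-cubic (degrees G′ p) (only′ p) (same p≢t)
          where
          to-cubic : ∀ {d d′} → Subcubic d → (d ≡ 2 → p ≡ t) → d′ ≡ d → Cubic d′
          to-cubic deg0 _ refl = isolated
          to-cubic deg2 o refl = ⊥-elim (p≢t (o refl))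
          to-cubic deg3 _ refl = cubic
        eqn : ∀ X → cut (X [ t ≔ X a ]) ((t , a) ∷ (t , b) ∷ R) ≡ cut X ((a , b) ∷ R)
        eqn X = trans (cutIs Z ((t , a) ∷ (t , b) ∷ R) (across Zt Za (across Zt Zb (base (cut-upd X (X a) R ft)))))
                      (cong (_+ (xr (X a) (X b) + cut X R)) (xr-self (X a)))
          where
          Z  = X [ t ≔ X a ]
          Zt = upd-same X t (X a)
          Za = upd-other X (X a) (≢-sym t≢a)
          Zb = upd-other X (X a) (≢-sym t≢b)
      lifted : MatchIn ((t , a) ∷ (t , b) ∷ R) ((t , a) ∷ (t , b) ∷ R)
      lifted with matching-avoiding (length R) R ≤-refl good
      ... | ms , h = false ∷ false ∷ ms , cov
        where
        count : deg t ((t , a) ∷ (t , b) ∷ R) ≡ 2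
        count rewrite δ-refl t | δ-≢ t≢a | δ-≢ t≢b = cong (2 +_) ft
        cov : ∀ p → Covers (deg p ((t , a) ∷ (t , b) ∷ R)) (deg p (sel id ms))
        cov p with p ≟ t in et
        ... | yes refl rewrite δ-≢ t≢a | δ-≢ t≢b =
          ≤-trans (≤-reflexive (sel-fresh id ms ft)) z≤n , λ e → ⊥-elim (two≢three (trans (sym (cong (2 +_) ft)) e))
          where
          two≢three : 2 ≢ 3
          two≢three ()
        ... | no p≢t = covers-≡ (sym (+-assoc (δ p a) (δ p b) (deg p R))) refl (h p)

    -- Vertices of degree two are joined in pairs by new edges: ps are the vertices not yet
    -- inspected, and t is the vertex of degree two that waits for a partner.
    matching₂₃ : (ps : List (Fin n)) (t : Maybe (Fin n)) {L : List (Edge n)} → Bridgeless₂₃ L →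
                 (∀ p → deg p L ≡ 2 → p ∈ ps ⊎ t ≡ just p) → MatchIn L L
    matching₂₃ [] nothing {L} G todo = matching L (record
      { degrees    = λ p → to-cubic p (degrees G p) refl
      ; loopless   = loopless G
      ; bridgeless = bridgeless G })
      where
      to-cubic : ∀ p {d} → Subcubic d → d ≡ deg p L → Cubic (deg p L)
      to-cubic p deg0 e = subst Cubic e isolated
      to-cubic p deg2 e with todo p (sym e)
      ... | inj₁ ()
      ... | inj₂ ()
      to-cubic p deg3 e = subst Cubic e cubic
    matching₂₃ [] (just t) {L} G todo with deg t L ℕ.≟ 2
    ... | yes eq = suppress G eq only
      where
      only : ∀ p → deg p L ≡ 2 → p ≡ t
      only p e with todo p e
      ... | inj₂ refl = refl
    ... | no neq = matching₂₃ [] nothing G none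
      where
      none : ∀ p → deg p L ≡ 2 → p ∈ [] ⊎ nothing ≡ just p
      none p e with todo p e
      ... | inj₂ refl = ⊥-elim (neq e)
    matching₂₃ (p ∷ ps) t {L} G todo with deg p L ℕ.≟ 2
    ... | no neq = matching₂₃ ps t G λ q e → step q e (todo q e)
      where
      step : ∀ q → deg q L ≡ 2 → q ∈ p ∷ ps ⊎ t ≡ just q → q ∈ ps ⊎ t ≡ just q
      step q e (inj₁ (here refl)) = ⊥-elim (neq e)
      step q e (inj₁ (there q∈))  = inj₁ q∈
      step q e (inj₂ e′)          = inj₂ e′
    matching₂₃ (p ∷ ps) nothing {L} G todo | yes eq = matching₂₃ ps (just p) G λ q e → step q (todo q e)
      where
      step : ∀ q → q ∈ p ∷ ps ⊎ nothing ≡ just q → q ∈ ps ⊎ just p ≡ just q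
      step q (inj₁ (here refl)) = inj₂ refl
      step q (inj₁ (there q∈))  = inj₁ q∈
    matching₂₃ (p ∷ ps) (just t) {L} G todo | yes eq with p ≟ t | deg t L ℕ.≟ 2
    ... | yes refl | _ = matching₂₃ ps (just p) G λ q e → step q (todo q e)
      where
      step : ∀ q → q ∈ p ∷ ps ⊎ just p ≡ just q → q ∈ ps ⊎ just p ≡ just q
      step q (inj₁ (here refl)) = inj₂ refl
      step q (inj₁ (there q∈))  = inj₁ q∈
      step q (inj₂ e)           = inj₂ e
    ... | no _ | no neq = matching₂₃ ps (just p) G λ q e → step q e (todo q e)
      where
      step : ∀ q → deg q L ≡ 2 → q ∈ p ∷ ps ⊎ just t ≡ just q → q ∈ ps ⊎ just p ≡ just q
      step q e (inj₁ (here refl)) = inj₂ refl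
      step q e (inj₁ (there q∈))  = inj₁ q∈
      step q e (inj₂ refl)        = ⊥-elim (neq e)
    ... | no p≢t | yes eqt = restrict (matching₂₃ ps nothing good λ q e → step q e)
      where
      K : List (Edge n)
      K = (p , t) ∷ L
      away : ∀ {q} → q ≢ p → q ≢ t → deg q K ≡ deg q L
      away q≢p q≢t rewrite δ-≢ q≢p | δ-≢ q≢t = refl
      support : ∀ q → deg q K ≢ 0 → deg q L ≢ 0
      support q h e with q ≟ p | q ≟ t
      ... | yes refl | _        with () ← trans (sym eq) e
      support q h e | no _ | yes refl with () ← trans (sym eqt) e
      support q h e | no q≢p | no q≢t = h e
      good : Bridgeless₂₃ K
      good = record
        { degrees    = degs
        ; loopless   = p≢t ∷ loopless G
        ; bridgeless = λ X c → bl X c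
        ; connected  = λ X q q′ h h′ c → connected G X q q′ (support q h) (support q′ h′) (m+n≡0⇒n≡0 (xr (X p) (X t)) c)
        }
        where
        degs : ∀ q → Subcubic (deg q K)
        degs q with q ≟ p in e₁ | q ≟ t in e₂
        ... | yes refl | yes refl = ⊥-elim (p≢t refl)
        ... | yes refl | no _     = subst (Subcubic ∘ suc) (sym eq) deg3
        ... | no _     | yes refl = subst (Subcubic ∘ suc) (sym eqt) deg3
        ... | no q≢p   | no q≢t   = degrees G q
        bl : ∀ X → xr (X p) (X t) + cut X L ≢ 1
        bl X c with xr-split (X p) (X t)
        ... | inj₁ (_ , o) rewrite o = bridgeless G X c
        ... | inj₂ (d , o) rewrite o =
          not-fixed (X t) (sym (trans (sym d) (connected G X p t (λ z → 0≢2 (trans (sym z) eq)) (λ z → 0≢2 (trans (sym z) eqt))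
                                                    (suc-injective c))))
          where
          0≢2 : 0 ≢ 2
          0≢2 ()
      step : ∀ q → deg q K ≡ 2 → q ∈ ps ⊎ nothing ≡ just q
      step q e with q ≟ p | q ≟ t
      ... | yes refl | yes refl = ⊥-elim (p≢t refl)
      ... | yes refl | no _ with () ← trans (sym (cong suc eq)) e
      step q e | no _ | yes refl with () ← trans (sym (cong suc eqt)) e
      step q e | no q≢p | no q≢t with todo q e
      ...   | inj₁ (here q≡p) = ⊥-elim (q≢p q≡p)
      ...   | inj₁ (there q∈) = inj₁ q∈
      ...   | inj₂ refl       = ⊥-elim (q≢t refl)
      -- The matching may contain the new edge `p t`; removing it uncovers only `p` and `t`, which
      -- have degree two in `L`.
      restrict : MatchIn K K → MatchIn L L
      restrict (β ∷ ms , h) = ms , λ q → cov q β (h q)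
        where
        cov : ∀ q β → Covers (deg q K) (deg q (sel id {L = K} (β ∷ ms))) → Covers (deg q L) (deg q (sel id ms))
        cov q true (le , h) = ≤-trans (m≤n+m _ (inc q (p , t))) le , top
          where
          top : deg q L ≡ 3 → deg q (sel id ms) ≡ 1
          top e with q ≟ p | q ≟ t
          ... | yes refl | _        with () ← trans (sym eq) e
          top e | no _ | yes refl with () ← trans (sym eqt) e
          top e | no _ | no _ = h e
        cov q false (le , h) = le , top
          where
          top : deg q L ≡ 3 → deg q (sel id ms) ≡ 1
          top e with q ≟ p | q ≟ t
          ... | yes refl | _        with () ← trans (sym eq) e
          top e | no _ | yes refl with () ← trans (sym eqt) e
          top e | no _ | no _ = h e

  -- Matchings that meet every triangle

  module _ {n : ℕ} where

    open Bridgeless₂₃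

    record Triangle (L : List (Edge n)) (x y z : Fin n) : Set where
      constructor triangle
      field
        xy : Adj x y L
        yz : Adj y z L
        zx : Adj z x L
        x≢y : x ≢ y
        y≢z : y ≢ z
        z≢x : z ≢ x
    open Triangle

    rotate : ∀ {L x y z} → Triangle L x y z → Triangle L y z x
    rotate (triangle a b c d e f) = triangle b c a e f d

    mapTriangle : ∀ {L K x y z} → (∀ {p q} → Adj p q L → Adj p q K) → Triangle L x y z → Triangle K x y z
    mapTriangle f (triangle a b c d e g) = triangle (f a) (f b) (f c) d e g

    two-neighbours : ∀ {L : List (Edge n)} {p q x} → Adj x p L → Adj x q L → p ≢ q → x ≢ p → x ≢ q → deg x L ≢ 0 × deg x L ≢ 1
    two-neighbours {L} {p} {q} {x} ap aq p≢q x≢p x≢q with Adj-extract ap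
    ... | R , r with Adj-∷⁻ (Adj-≈ r aq)
    ...   | inj₁ (_ , e)        = ⊥-elim (p≢q (sym e))
    ...   | inj₂ (inj₁ (e , _)) = ⊥-elim (x≢p e)
    ...   | inj₂ (inj₂ b) = Adj⇒deg ap , λ e → Adj⇒deg b (suc-injective (trans (sym (trans (deg-≈ x r) count)) e))
      where
      count : deg x ((x , p) ∷ R) ≡ suc (deg x R)
      count rewrite δ-refl x | δ-≢ x≢p = refl

    -- A vertex of a triangle has two different neighbours, but `l` has only `w`.
    triangle-peel : ∀ {N x y z} l w → deg l N ≡ 0 → Triangle ((l , w) ∷ N) x y z → Triangle N x y z
    triangle-peel {N} l w fl t = triangle (one t) (one (rotate t)) (one (rotate (rotate t))) (x≢y t) (y≢z t) (z≢x t)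
      where
      nbr : ∀ {p} → Adj l p ((l , w) ∷ N) → l ≢ p → p ≡ w
      nbr a l≢p with Adj-∷⁻ a
      ... | inj₁ (_ , e)        = e
      ... | inj₂ (inj₁ (_ , e)) = ⊥-elim (l≢p (sym e))
      ... | inj₂ (inj₂ b)       = ⊥-elim (Adj⇒deg b fl)
      one : ∀ {x y z} → Triangle ((l , w) ∷ N) x y z → Adj x y N
      one t with Adj-∷⁻ (xy t)
      ... | inj₁ (refl , refl)        = ⊥-elim (y≢z t (sym (nbr (Adj-sym (zx t)) (≢-sym (z≢x t)))))
      ... | inj₂ (inj₁ (refl , refl)) = ⊥-elim (z≢x t (nbr (yz t) (y≢z t)))
      ... | inj₂ (inj₂ a)             = a

    -- The only neighbours of `c` are `s` and `s′`; as these are not adjacent, `c` lies in no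
    -- triangle.
    triangle-vee : ∀ {N x y z} c s s′ → deg c N ≡ 0 → c ≢ s → c ≢ s′ → ¬ Adj s s′ N →
                   Triangle ((c , s) ∷ (c , s′) ∷ N) x y z → Triangle N x y z
    triangle-vee {N} c s s′ fc c≢s c≢s′ non t = triangle (one t) (one (rotate t)) (one (rotate (rotate t))) (x≢y t) (y≢z t) (z≢x t)
      where
      M = (c , s) ∷ (c , s′) ∷ N
      nbr : ∀ {p} → Adj c p M → c ≢ p → p ≡ s ⊎ p ≡ s′
      nbr a c≢p with Adj-∷⁻ a
      ... | inj₁ (_ , e)        = inj₁ e
      ... | inj₂ (inj₁ (_ , e)) = ⊥-elim (c≢p (sym e))
      ... | inj₂ (inj₂ b) with Adj-∷⁻ b
      ...   | inj₁ (_ , e)        = inj₂ e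
      ...   | inj₂ (inj₁ (_ , e)) = ⊥-elim (c≢p (sym e))
      ...   | inj₂ (inj₂ d)       = ⊥-elim (Adj⇒deg d fc)
      inner : ∀ {p q} → Adj p q M → c ≢ p → c ≢ q → Adj p q N
      inner a c≢p c≢q with Adj-∷⁻ a
      ... | inj₁ (e , _)        = ⊥-elim (c≢p (sym e))
      ... | inj₂ (inj₁ (_ , e)) = ⊥-elim (c≢q (sym e))
      ... | inj₂ (inj₂ b) with Adj-∷⁻ b
      ...   | inj₁ (e , _)        = ⊥-elim (c≢p (sym e))
      ...   | inj₂ (inj₁ (_ , e)) = ⊥-elim (c≢q (sym e))
      ...   | inj₂ (inj₂ d)       = d
      apart : ∀ {p q} → p ≡ s ⊎ p ≡ s′ → q ≡ s ⊎ q ≡ s′ → p ≢ q → ¬ Adj p q M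
      apart (inj₁ refl) (inj₁ refl) p≢q a = p≢q refl
      apart (inj₁ refl) (inj₂ refl) p≢q a = non (inner a c≢s c≢s′)
      apart (inj₂ refl) (inj₁ refl) p≢q a = non (Adj-sym (inner a c≢s′ c≢s))
      apart (inj₂ refl) (inj₂ refl) p≢q a = p≢q refl
      through : ∀ {y z} → ¬ Triangle M c y z
      through t = apart (nbr (xy t) (x≢y t)) (nbr (Adj-sym (zx t)) (≢-sym (z≢x t))) (y≢z t) (yz t)
      one : ∀ {x y z} → Triangle M x y z → Adj x y N
      one {x} {y} t with c ≟ x | c ≟ y
      ... | yes refl | _        = ⊥-elim (through t)
      ... | no _     | yes refl = ⊥-elim (through (rotate t))
      ... | no c≢x   | no c≢y   = inner (xy t) c≢x c≢y

    deg-split : ∀ p {L : List (Edge n)} (ms : Labels Bool L) → deg p (sel id ms) + deg p (sel not ms) ≡ deg p L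
    deg-split p {[]}    []           = refl
    deg-split p {e ∷ L} (true ∷ ms)  = trans (+-assoc (inc p e) _ _) (cong (inc p e +_) (deg-split p ms))
    deg-split p {e ∷ L} (false ∷ ms) = trans (lemma (deg p (sel id ms)) (inc p e) _) (cong (inc p e +_) (deg-split p ms))
      where
      lemma : ∀ a b c → a + (b + c) ≡ b + (a + c)
      lemma = solve-∀

    Adj-sel : ∀ {A : Set} {p q} (f : A → Bool) {L : List (Edge n)} (as : Labels A L) → Adj p q (sel f as) → Adj p q L
    Adj-sel f {e ∷ L} (a ∷ as) adj with f a
    Adj-sel f {e ∷ L} (a ∷ as) here        | true  = here
    Adj-sel f {e ∷ L} (a ∷ as) here˘       | true  = here˘
    Adj-sel f {e ∷ L} (a ∷ as) (there adj) | true  = there (Adj-sel f as adj)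
    Adj-sel f {e ∷ L} (a ∷ as) adj         | false = there (Adj-sel f as adj)

    Avoids : (Fin n → Bool) → Fin n → Fin n → Fin n → Set
    Avoids P x y z = P x ≡ false × P y ≡ false × P z ≡ false

    -- P holds the vertices that arose by contraction; triangles through them need not be hit.
    record HittingMatching (P : Fin n → Bool) (L : List (Edge n)) : Set where
      constructor hitting
      field
        marks  : Labels Bool L
        covers : ∀ p → Covers (deg p L) (deg p (sel id marks))
        hits   : ∀ {x y z} → Avoids P x y z → ¬ Triangle (sel not marks) x y z
    open HittingMatching

    hittingMatching-≈ : ∀ {P} {L K : List (Edge n)} → L ≈ K → HittingMatching P K → HittingMatching P L
    hittingMatching-≈ {L = L} {K} r (hitting ms cov hit) with transport r ms
    ... | ns , g = hitting ns
      (λ p → covers-≡ (deg-≈ p r) (deg-≈ p (g id)) (cov p))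
      (λ av t → hit av (mapTriangle (Adj-≈ (g not)) t))

    -- A closed triangle spans a component, namely K₃ or H₁.
    NoClosedTriangle : (Fin n → Bool) → List (Edge n) → Set
    NoClosedTriangle P L = ∀ {x y z} → Avoids P x y z → Triangle L x y z → cut (member (x ∷ y ∷ z ∷ [])) L ≢ 0

    -- The triangle is contracted to `x`, which takes over the edges `y q` and `z r` and keeps its
    -- own third edge, if there is one, in `R`; `y` and `z` become isolated.
    module Contract {x y z q r : Fin n} {R : List (Edge n)} (P : Fin n → Bool)
                    (x≢q : x ≢ q) (x≢r : x ≢ r) (y≢r : y ≢ r) (z≢q : z ≢ q)
                    (fy : deg y R ≡ 0) (fz : deg z R ≡ 0) (fx : deg x R ≡ 0 ⊎ deg x R ≡ 1)
                    (G : Bridgeless₂₃ ((x , y) ∷ (y , z) ∷ (z , x) ∷ (y , q) ∷ (z , r) ∷ R))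
                    (H : NoClosedTriangle P ((x , y) ∷ (y , z) ∷ (z , x) ∷ (y , q) ∷ (z , r) ∷ R)) where
      L K : List (Edge n)
      L = (x , y) ∷ (y , z) ∷ (z , x) ∷ (y , q) ∷ (z , r) ∷ R
      K = (x , q) ∷ (x , r) ∷ R

      P′ : Fin n → Bool
      P′ = P [ x ≔ true ]

      ineqs : x ≢ y × y ≢ z × z ≢ x × y ≢ q × z ≢ r × Loopless R
      ineqs with loopless G
      ... | a ∷ b ∷ c ∷ d ∷ e ∷ ll = a , b , c , d , e , ll
      x≢y′ : x ≢ y
      x≢y′ = proj₁ ineqs
      y≢z′ : y ≢ z
      y≢z′ = proj₁ (proj₂ ineqs)
      z≢x′ : z ≢ x
      z≢x′ = proj₁ (proj₂ (proj₂ ineqs))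
      y≢q : y ≢ q
      y≢q = proj₁ (proj₂ (proj₂ (proj₂ ineqs)))
      z≢r : z ≢ r
      z≢r = proj₁ (proj₂ (proj₂ (proj₂ (proj₂ ineqs))))

      same : ∀ {p} → p ≢ y → p ≢ z → deg p K ≡ deg p L
      same {p} p≢y p≢z rewrite δ-≢ p≢y | δ-≢ p≢z = lemma (δ p x) (δ p q) (δ p r) (deg p R)
        where
        lemma : ∀ x q r k → x + q + (x + r + k) ≡ x + 0 + (x + (q + (r + k)))
        lemma = solve-∀

      goneʸ : deg y K ≡ 0
      goneʸ rewrite δ-≢ (≢-sym x≢y′) | δ-≢ y≢q | δ-≢ y≢r = fy
      goneᶻ : deg z K ≡ 0
      goneᶻ rewrite δ-≢ z≢x′ | δ-≢ z≢q | δ-≢ z≢r = fz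

      expand : ∀ X α → X x ≡ α → cut ((X [ y ≔ α ]) [ z ≔ α ]) L ≡ cut X K
      expand X α Xx = trans (cutIs Z L (across Zx Zy (across Zy Zz (across Zz Zx (across Zy Zq (across Zz Zr (base ZR)))))))
                            (trans (collapse α _) (cong₂ (λ s k → s + (k + cut X R)) (cong (λ s → xr s (X q)) (sym Xx)) (cong (λ s → xr s (X r)) (sym Xx))))
        where
        Y  = X [ y ≔ α ]
        Z  = Y [ z ≔ α ]
        Zz = upd-same Y z α
        Zy = trans (upd-other Y α y≢z′) (upd-same X y α)
        Zx = trans (trans (upd-other Y α (≢-sym z≢x′)) (upd-other X α x≢y′)) Xx
        Zq = trans (upd-other Y α (≢-sym z≢q)) (upd-other X α (≢-sym y≢q))
        Zr = trans (upd-other Y α (≢-sym z≢r)) (upd-other X α (≢-sym y≢r))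
        ZR = trans (cut-upd Y α R fz) (cut-upd X α R fy)
        collapse : ∀ a k → xr a a + (xr a a + (xr a a + k)) ≡ k
        collapse true  k = refl
        collapse false k = refl

      good : Bridgeless₂₃ K
      good = record
        { degrees    = degs
        ; loopless   = x≢q ∷ x≢r ∷ proj₂ (proj₂ (proj₂ (proj₂ (proj₂ ineqs))))
        ; bridgeless = λ X c → bridgeless G ((X [ y ≔ X x ]) [ z ≔ X x ]) (trans (expand X (X x) refl) c)
        ; connected  = conn
        }
        where
        degs : ∀ p → Subcubic (deg p K)
        degs p with p ≟ y | p ≟ z
        ... | yes refl | _        = subst Subcubic (sym goneʸ) deg0
        ... | no _     | yes refl = subst Subcubic (sym goneᶻ) deg0
        ... | no p≢y   | no p≢z   = subst Subcubic (sym (same p≢y p≢z)) (degrees G p)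
        off : ∀ {p} → deg p K ≢ 0 → p ≢ y × p ≢ z
        off h = (λ { refl → h goneʸ }) , (λ { refl → h goneᶻ })
        conn : ∀ X p p′ → deg p K ≢ 0 → deg p′ K ≢ 0 → cut X K ≡ 0 → X p ≡ X p′
        conn X p p′ h h′ c with off h | off h′
        ... | p≢y , p≢z | p′≢y , p′≢z =
          trans (sym (trans (upd-other (X [ y ≔ X x ]) (X x) p≢z) (upd-other X (X x) p≢y)))
            (trans (connected G ((X [ y ≔ X x ]) [ z ≔ X x ]) p p′
                      (h ∘ trans (same p≢y p≢z)) (h′ ∘ trans (same p′≢y p′≢z)) (trans (expand X (X x) refl) c))
              (trans (upd-other (X [ y ≔ X x ]) (X x) p′≢z) (upd-other X (X x) p′≢y)))

      avoid-x : ∀ {p} → P′ p ≡ false → p ≢ x × P p ≡ false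
      avoid-x {p} e with p ≟ x
      ... | no p≢x = p≢x , e

      -- A triangle that avoids `P′` misses `x`, and it misses `y` and `z`, which are isolated in
      -- `K`. So it is already a triangle of `L`, with the same edges leaving it.
      noClosed : NoClosedTriangle P′ K
      noClosed {u} {v} {w} (Pu , Pv , Pw) t c =
        H (proj₂ (avoid-x Pu) , proj₂ (avoid-x Pv) , proj₂ (avoid-x Pw))
          (triangle (inL (xy t) (out Pu) (out Pv)) (inL (yz t) (out Pv) (out Pw)) (inL (zx t) (out Pw) (out Pu))
                    (x≢y t) (y≢z t) (z≢x t))
          (trans (cut-cong same-set L) (trans (expand W false Wx) c))
        where
        W : Fin n → Bool
        W = member (u ∷ v ∷ w ∷ [])
        out : ∀ {p} → P′ p ≡ false → p ≢ x
        out e = proj₁ (avoid-x e)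
        inL : ∀ {a b} → Adj a b K → a ≢ x → b ≢ x → Adj a b L
        inL a p≢x q≢x with Adj-∷⁻ a
        ... | inj₁ (e , _)        = ⊥-elim (p≢x e)
        ... | inj₂ (inj₁ (_ , e)) = ⊥-elim (q≢x e)
        ... | inj₂ (inj₂ b) with Adj-∷⁻ b
        ...   | inj₁ (e , _)        = ⊥-elim (p≢x e)
        ...   | inj₂ (inj₁ (_ , e)) = ⊥-elim (q≢x e)
        ...   | inj₂ (inj₂ d)       = there (there (there (there (there d))))
        Wx : W x ≡ false
        Wx = member⁻ᶠ (u ∷ v ∷ w ∷ []) x λ { (here refl) → out Pu refl ; (there (here refl)) → out Pv refl ; (there (there (here refl))) → out Pw refl }
        isolated-out : ∀ p → deg p K ≡ 0 → W p ≡ false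
        isolated-out p e = member⁻ᶠ (u ∷ v ∷ w ∷ []) p λ { (here refl) → Adj⇒deg (xy t) e ; (there (here refl)) → Adj⇒deg (yz t) e ; (there (there (here refl))) → Adj⇒deg (zx t) e }
        same-set : ∀ p → W p ≡ ((W [ y ≔ false ]) [ z ≔ false ]) p
        same-set p with p ≟ y | p ≟ z
        ... | _        | yes refl = isolated-out z goneᶻ
        ... | yes refl | no _     = isolated-out y goneʸ
        ... | no _     | no _     = refl

      -- With at most one edge at `x` in `N`, no triangle of `N` contains `x`, so marking `x` as
      -- contracted makes no difference.
      inside : ∀ {N u v w} → deg x N ≡ 0 ⊎ deg x N ≡ 1 → Avoids P u v w → Triangle N u v w → Avoids P′ u v w
      inside {N} dx (Pu , Pv , Pw) t = extend t Pu , extend (rotate t) Pv , extend (rotate (rotate t)) Pw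
        where
        extend : ∀ {u v w} → Triangle N u v w → P u ≡ false → P′ u ≡ false
        extend {u} t Pu with u ≟ x
        ... | no _     = Pu
        ... | yes refl = ⊥-elim (neither dx)
          where
          many : deg x N ≢ 0 × deg x N ≢ 1
          many = two-neighbours (xy t) (Adj-sym (zx t)) (y≢z t) (x≢y t) (≢-sym (z≢x t))
          neither : ¬ (deg x N ≡ 0 ⊎ deg x N ≡ 1)
          neither (inj₁ e) = proj₁ many e
          neither (inj₂ e) = proj₂ many e

      unmarked-x : (ms : Labels Bool R) → deg x (sel not ms) ≡ 0 ⊎ deg x (sel not ms) ≡ 1
      unmarked-x ms = small (deg x (sel id ms)) (deg x (sel not ms)) (deg-split x ms) fx
        where
        small : ∀ a b {k} → a + b ≡ k → k ≡ 0 ⊎ k ≡ 1 → b ≡ 0 ⊎ b ≡ 1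
        small a zero                e _         = inj₁ refl
        small a (suc zero)          e _         = inj₂ refl
        small a (suc (suc b)) e (inj₁ refl) with () ← m+n≡0⇒n≡0 a e
        small a (suc (suc b)) e (inj₂ refl) with () ← m+n≡0⇒n≡0 a (suc-injective (trans (sym (+-suc a (suc b))) e))

      -- A matched `x q` or `x r` becomes `y q` or `z r`, and the other two vertices of the triangle
      -- are matched to each other; if neither is matched, `y z` is added. Each time exactly one
      -- edge of the triangle is matched, so the triangle is hit.
      lift : HittingMatching P′ K → HittingMatching P L
      lift (hitting (true ∷ true ∷ ms) cov hit) = ⊥-elim (excess (proj₁ (cov x)))
        where
        excess : ¬ (inc x (x , q) + (inc x (x , r) + deg x (sel id ms)) ≤ 1)
        excess le rewrite δ-refl x | δ-≢ x≢q | δ-≢ x≢r with s≤s () ← le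
      lift (hitting (true ∷ false ∷ ms) cov hit) = hitting (false ∷ false ∷ true ∷ true ∷ false ∷ ms) cov′ hit′
        where
        cov′ : ∀ p → Covers (deg p L) (inc p (z , x) + (inc p (y , q) + deg p (sel id ms)))
        cov′ p with p ≟ y in ey | p ≟ z in ez
        ... | yes refl | yes p≡z  = ⊥-elim (y≢z′ p≡z)
        ... | yes refl | no _     rewrite δ-≢ (≢-sym x≢y′) | δ-≢ y≢q = one-covers (cong suc (sel-fresh id ms fy))
        ... | no _     | yes refl rewrite δ-≢ z≢x′ | δ-≢ z≢q = one-covers (cong suc (sel-fresh id ms fz))
        ... | no p≢y   | no p≢z   = covers-≡ (lemma (δ p x) (δ p q) (δ p r) (deg p R)) (sym (+-assoc (δ p x) (δ p q) _)) (cov p)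
          where
          lemma : ∀ x q r k → x + 0 + (x + (q + (r + k))) ≡ x + q + (x + r + k)
          lemma = solve-∀
        -- The neighbours `x` and `z` of `y` are no longer adjacent, and then `z r` is a pendant
        -- edge; without these edges the triangle lies in the unmatched part of `R`.
        hit′ : ∀ {u v w} → Avoids P u v w → ¬ Triangle ((x , y) ∷ (y , z) ∷ (z , r) ∷ sel not ms) u v w
        hit′ {u} {v} {w} av t = hit (inside {N = sel not ms} (unmarked-x ms) av t₂) (mapTriangle there t₂)
          where
          t₁ : Triangle ((z , r) ∷ sel not ms) u v w
          t₁ = triangle-vee y x z free (≢-sym x≢y′) y≢z′ apart (mapTriangle (Adj-≈ (≈-flip _ _)) t)
            where
            free : deg y ((z , r) ∷ sel not ms) ≡ 0
            free rewrite δ-≢ y≢z′ | δ-≢ y≢r = sel-fresh not ms fy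
            apart : ¬ Adj x z ((z , r) ∷ sel not ms)
            apart a with Adj-∷⁻ (Adj-sym a)
            ... | inj₁ (_ , e)        = x≢r e
            ... | inj₂ (inj₁ (e , _)) = z≢r e
            ... | inj₂ (inj₂ b)       = Adj⇒deg b (sel-fresh not ms fz)
          t₂ : Triangle (sel not ms) u v w
          t₂ = triangle-peel z r (sel-fresh not ms fz) t₁
      lift (hitting (false ∷ true ∷ ms) cov hit) = hitting (true ∷ false ∷ false ∷ false ∷ true ∷ ms) cov′ hit′
        where
        cov′ : ∀ p → Covers (deg p L) (inc p (x , y) + (inc p (z , r) + deg p (sel id ms)))
        cov′ p with p ≟ y in ey | p ≟ z in ez
        ... | yes refl | yes p≡z  = ⊥-elim (y≢z′ p≡z)
        ... | yes refl | no _     rewrite δ-≢ (≢-sym x≢y′) | δ-≢ y≢r = one-covers (cong suc (sel-fresh id ms fy))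
        ... | no _     | yes refl rewrite δ-≢ z≢x′ | δ-≢ z≢r = one-covers (cong suc (sel-fresh id ms fz))
        ... | no p≢y   | no p≢z   = covers-≡ (lemma (δ p x) (δ p q) (δ p r) (deg p R)) (lemma₂ (δ p x) (δ p r) _) (cov p)
          where
          lemma : ∀ x q r k → x + 0 + (x + (q + (r + k))) ≡ x + q + (x + r + k)
          lemma = solve-∀
          lemma₂ : ∀ x r k → x + 0 + (r + k) ≡ x + r + k
          lemma₂ = solve-∀
        hit′ : ∀ {u v w} → Avoids P u v w → ¬ Triangle ((y , z) ∷ (z , x) ∷ (y , q) ∷ sel not ms) u v w
        hit′ {u} {v} {w} av t = hit (inside {N = sel not ms} (unmarked-x ms) av t₂) (mapTriangle there t₂)
          where
          t₁ : Triangle ((y , q) ∷ sel not ms) u v w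
          t₁ = triangle-vee z y x free (≢-sym y≢z′) z≢x′ apart (mapTriangle (Adj-≈ (≈-flip _ _)) t)
            where
            free : deg z ((y , q) ∷ sel not ms) ≡ 0
            free rewrite δ-≢ (≢-sym y≢z′) | δ-≢ z≢q = sel-fresh not ms fz
            apart : ¬ Adj y x ((y , q) ∷ sel not ms)
            apart a with Adj-∷⁻ a
            ... | inj₁ (_ , e)        = x≢q e
            ... | inj₂ (inj₁ (e , _)) = y≢q e
            ... | inj₂ (inj₂ b)       = Adj⇒deg b (sel-fresh not ms fy)
          t₂ : Triangle (sel not ms) u v w
          t₂ = triangle-peel y q (sel-fresh not ms fy) t₁
      lift (hitting (false ∷ false ∷ ms) cov hit) = hitting (false ∷ true ∷ false ∷ false ∷ false ∷ ms) cov′ hit′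
        where
        cov′ : ∀ p → Covers (deg p L) (inc p (y , z) + deg p (sel id ms))
        cov′ p with p ≟ y in ey | p ≟ z in ez
        ... | yes refl | yes p≡z  = ⊥-elim (y≢z′ p≡z)
        ... | yes refl | no _     = one-covers (cong suc (sel-fresh id ms fy))
        ... | no _     | yes refl = one-covers (cong suc (sel-fresh id ms fz))
        ... | no p≢y   | no p≢z   = covers-≡ (lemma (δ p x) (δ p q) (δ p r) (deg p R)) refl (cov p)
          where
          lemma : ∀ x q r k → x + 0 + (x + (q + (r + k))) ≡ x + q + (x + r + k)
          lemma = solve-∀
        -- If `x` has a third edge, it has degree three in `K`; as `x q` and `x r` are unmatched,
        -- the third edge is matched.
        covered-x : deg x (sel not ms) ≡ 0
        covered-x = go fx
          where
          go : deg x R ≡ 0 ⊎ deg x R ≡ 1 → deg x (sel not ms) ≡ 0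
          go (inj₁ e) = m+n≡0⇒n≡0 (deg x (sel id ms)) (trans (deg-split x ms) e)
          go (inj₂ e) = +-cancelˡ-≡ 1 _ _ (trans (cong (_+ deg x (sel not ms)) (sym (proj₂ (cov x) full))) (trans (deg-split x ms) e))
            where
            full : deg x K ≡ 3
            full rewrite δ-refl x | δ-≢ x≢q | δ-≢ x≢r = cong (2 +_) e
        hit′ : ∀ {u v w} → Avoids P u v w → ¬ Triangle ((x , y) ∷ (z , x) ∷ (y , q) ∷ (z , r) ∷ sel not ms) u v w
        hit′ {u} {v} {w} av t = hit (inside {N = sel not ms} (unmarked-x ms) av t₃) (mapTriangle (λ a → there (there a)) t₃)
          where
          t₁ : Triangle ((y , q) ∷ (z , r) ∷ sel not ms) u v w
          t₁ = triangle-vee x y z free x≢y′ (≢-sym z≢x′) apart (mapTriangle (Adj-≈ (≈-prep _ (≈-flip _ _))) t)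
            where
            free : deg x ((y , q) ∷ (z , r) ∷ sel not ms) ≡ 0
            free rewrite δ-≢ x≢y′ | δ-≢ x≢q | δ-≢ (≢-sym z≢x′) | δ-≢ x≢r = covered-x
            apart : ¬ Adj y z ((y , q) ∷ (z , r) ∷ sel not ms)
            apart a with Adj-∷⁻ a
            ... | inj₁ (_ , e)        = z≢q e
            ... | inj₂ (inj₁ (e , _)) = y≢q e
            ... | inj₂ (inj₂ b) with Adj-∷⁻ b
            ...   | inj₁ (e , _)        = y≢z′ e
            ...   | inj₂ (inj₁ (e , _)) = y≢r e
            ...   | inj₂ (inj₂ d)       = Adj⇒deg d (sel-fresh not ms fy)
          t₂ : Triangle ((z , r) ∷ sel not ms) u v w
          t₂ = triangle-peel y q free t₁
            where
            free : deg y ((z , r) ∷ sel not ms) ≡ 0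
            free rewrite δ-≢ y≢z′ | δ-≢ y≢r = sel-fresh not ms fy
          t₃ : Triangle (sel not ms) u v w
          t₃ = triangle-peel z r (sel-fresh not ms fz) t₂

  module _ {n : ℕ} where

    open Bridgeless₂₃
    open Triangle

    noClosed-≈ : ∀ {P} {L K : List (Edge n)} → L ≈ K → NoClosedTriangle P L → NoClosedTriangle P K
    noClosed-≈ r H {x} {y} {z} av t c = H av (mapTriangle (Adj-≈ (≈-sym r)) t) (trans (cut-≈ (member (x ∷ y ∷ z ∷ [])) r) c)

    at-most-one : ∀ {d} k → d ≡ 2 + k → Subcubic d → k ≡ 0 ⊎ k ≡ 1
    at-most-one k () deg0
    at-most-one k e deg2 = inj₁ (sym (+-cancelˡ-≡ 2 _ _ e))
    at-most-one k e deg3 = inj₂ (sym (+-cancelˡ-≡ 2 _ _ e))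

    module AtTriangle {x y z : Fin n} {R : List (Edge n)} (G : Bridgeless₂₃ ((x , y) ∷ (y , z) ∷ (z , x) ∷ R)) where
      x≢y′ : x ≢ y
      x≢y′ with loopless G
      ... | a ∷ _ = a
      y≢z′ : y ≢ z
      y≢z′ with loopless G
      ... | _ ∷ b ∷ _ = b
      z≢x′ : z ≢ x
      z≢x′ with loopless G
      ... | _ ∷ _ ∷ c ∷ _ = c
      ll : Loopless R
      ll with loopless G
      ... | _ ∷ _ ∷ _ ∷ ll = ll

      S : List (Fin n)
      S = x ∷ y ∷ z ∷ []

      rotated : (x , y) ∷ (y , z) ∷ (z , x) ∷ R ≈ (y , z) ∷ (z , x) ∷ (x , y) ∷ R
      rotated = ≈-trans (≈-swap _ _) (≈-prep _ (≈-swap _ _))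

      degree-x : deg x R ≡ 0 ⊎ deg x R ≡ 1
      degree-x = at-most-one (deg x R) count (degrees G x)
        where
        count : deg x ((x , y) ∷ (y , z) ∷ (z , x) ∷ R) ≡ 2 + deg x R
        count rewrite δ-refl x | δ-≢ x≢y′ | δ-≢ (≢-sym z≢x′) = refl

      inside-S : Inside S ((x , y) ∷ (y , z) ∷ (z , x) ∷ [])
      inside-S = (here refl , there (here refl)) ∷ (there (here refl) , there (there (here refl))) ∷
                 (there (there (here refl)) , here refl) ∷ []

      -- If no edge leaves the triangle at its other two vertices, an edge leaving at `b` is a
      -- bridge, and without it the triangle is closed.
      lonely : ∀ {b} → cut (member S) ((x , y) ∷ (y , z) ∷ (z , x) ∷ R) ≢ 0 → b ∈ S →
               (∀ {p} → p ∈ S → p ≡ b ⊎ deg p R ≡ 0) → ¬ (deg b R ≡ 0 ⊎ deg b R ≡ 1)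
      lonely nc b∈ h (inj₁ e) = nc (trans (cut-inside {S = S} R inside-S) (trans (cut-single R ll (member⁺ b∈) (λ p m → h (member⁻ S m))) e))
      lonely nc b∈ h (inj₂ e) = no-single-exit S _ (bridgeless G) ll inside-S b∈ h e

    rotate-S : ∀ {x y z} {L : List (Edge n)} → cut (member (x ∷ y ∷ z ∷ [])) L ≢ 0 → cut (member (y ∷ z ∷ x ∷ [])) L ≢ 0
    rotate-S {x} {y} {z} {L} nc e = nc (trans (cut-cong cyc L) e)
      where
      cyc : ∀ p → member (x ∷ y ∷ z ∷ []) p ≡ member (y ∷ z ∷ x ∷ []) p
      cyc p with p ≟ x | p ≟ y | p ≟ z
      ... | yes _ | yes _ | yes _ = refl
      ... | yes _ | yes _ | no _  = refl
      ... | yes _ | no _  | yes _ = refl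
      ... | yes _ | no _  | no _  = refl
      ... | no _  | yes _ | yes _ = refl
      ... | no _  | yes _ | no _  = refl
      ... | no _  | no _  | yes _ = refl
      ... | no _  | no _  | no _  = refl

    -- A second edge `x y` saturates `x` and `y`. Then a third edge at `z` is a bridge, and without
    -- it the triangle is closed.
    no-chord : ∀ {x y z} {R : List (Edge n)} → Bridgeless₂₃ ((x , y) ∷ (y , z) ∷ (z , x) ∷ R) →
               cut (member (x ∷ y ∷ z ∷ [])) ((x , y) ∷ (y , z) ∷ (z , x) ∷ R) ≢ 0 → ¬ Adj x y R
    no-chord {x} {y} {z} {R} G nc a with Adj-extract a
    ... | R′ , r = only-z degree-z
      where
      module T  = AtTriangle G
      G₂ = bridgeless₂₃-≈ T.rotated G
      module T₂ = AtTriangle G₂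
      module T₃ = AtTriangle (bridgeless₂₃-≈ T₂.rotated G₂)
      small : ∀ {k d} → d ≡ suc k → d ≡ 0 ⊎ d ≡ 1 → k ≡ 0
      small refl (inj₂ refl) = refl
      xcount : deg x R ≡ suc (deg x R′)
      xcount = trans (deg-≈ x r) count
        where
        count : deg x ((x , y) ∷ R′) ≡ suc (deg x R′)
        count rewrite δ-refl x | δ-≢ T.x≢y′ = refl
      ycount : deg y R ≡ suc (deg y R′)
      ycount = trans (deg-≈ y r) count
        where
        count : deg y ((x , y) ∷ R′) ≡ suc (deg y R′)
        count rewrite δ-refl y | δ-≢ (≢-sym T.x≢y′) = refl
      fx : deg x R′ ≡ 0
      fx = small xcount T.degree-x
      fy : deg y R′ ≡ 0
      fy = small ycount T₂.degree-x
      degree-z : deg z R′ ≡ 0 ⊎ deg z R′ ≡ 1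
      degree-z = subst (λ d → d ≡ 0 ⊎ d ≡ 1) (trans (deg-≈ z r) count) T₃.degree-x
        where
        count : deg z ((x , y) ∷ R′) ≡ deg z R′
        count rewrite δ-≢ T.z≢x′ | δ-≢ (≢-sym T.y≢z′) = refl
      ll′ : Loopless R′
      ll′ = loopless-tail (loopless-≈ r T.ll)
      fresh : ∀ {p} → p ∈ T.S → p ≡ z ⊎ deg p R′ ≡ 0
      fresh (here refl)                 = inj₂ fx
      fresh (there (here refl))         = inj₂ fy
      fresh (there (there (here refl))) = inj₁ refl
      inside : Inside T.S ((x , y) ∷ (y , z) ∷ (z , x) ∷ (x , y) ∷ [])
      inside = (here refl , there (here refl)) ∷ (there (here refl) , there (there (here refl))) ∷
               (there (there (here refl)) , here refl) ∷ (here refl , there (here refl)) ∷ []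
      r′ : (x , y) ∷ (y , z) ∷ (z , x) ∷ R ≈ (x , y) ∷ (y , z) ∷ (z , x) ∷ (x , y) ∷ R′
      r′ = ≈-prep _ (≈-prep _ (≈-prep _ r))
      only-z : ¬ (deg z R′ ≡ 0 ⊎ deg z R′ ≡ 1)
      only-z (inj₁ e) = nc (trans (cut-≈ (member T.S) r′) (trans (cut-inside {S = T.S} R′ inside)
        (trans (cut-single R′ ll′ (member⁺ {xs = T.S} (there (there (here refl)))) (λ p m → fresh (member⁻ T.S m))) e)))
      only-z (inj₂ e) = no-single-exit T.S z (bridgeless (bridgeless₂₃-≈ r′ G)) ll′ inside (there (there (here refl))) fresh e

    triangle-extract : ∀ {x y z} {L : List (Edge n)} → Loopless L → Adj x y L → Adj y z L → Adj z x L →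
                       ∃ λ R → L ≈ (x , y) ∷ (y , z) ∷ (z , x) ∷ R
    triangle-extract ll a b c with Adj-extract a
    ... | R₁ , r₁ with Adj-∷⁻ (Adj-≈ r₁ b)
    ...   | inj₁ (e , _)        = ⊥-elim (Adj-loopless ll a (sym e))
    ...   | inj₂ (inj₁ (_ , e)) = ⊥-elim (Adj-loopless ll c e)
    ...   | inj₂ (inj₂ b′) with Adj-extract b′
    ...     | R₂ , r₂ with Adj-∷⁻ (Adj-≈ (≈-trans r₁ (≈-prep _ r₂)) c)
    ...       | inj₁ (e , _)        = ⊥-elim (Adj-loopless ll c e)
    ...       | inj₂ (inj₁ (e , _)) = ⊥-elim (Adj-loopless ll b (sym e))
    ...       | inj₂ (inj₂ c′) with Adj-∷⁻ c′
    ...         | inj₁ (e , _)        = ⊥-elim (Adj-loopless ll b (sym e))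
    ...         | inj₂ (inj₁ (_ , e)) = ⊥-elim (Adj-loopless ll a e)
    ...         | inj₂ (inj₂ c″) with Adj-extract c″
    ...           | R , r₃ = R , ≈-trans r₁ (≈-prep _ (≈-trans r₂ (≈-prep _ r₃)))

    -- Each contraction saves three edges. Once no triangle avoids `P`, every matching that covers
    -- the vertices of degree three will do.
    hitting-matching : ∀ k {L : List (Edge n)} P → length L ≤ k → Bridgeless₂₃ L → NoClosedTriangle P L → HittingMatching P L

    contract : ∀ k {x y z} {R : List (Edge n)} P → length R ≤ k → Avoids P x y z →
               Bridgeless₂₃ ((x , y) ∷ (y , z) ∷ (z , x) ∷ R) → NoClosedTriangle P ((x , y) ∷ (y , z) ∷ (z , x) ∷ R) →
               deg y R ≡ 1 → deg z R ≡ 1 → HittingMatching P ((x , y) ∷ (y , z) ∷ (z , x) ∷ R)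
    contract k {x} {y} {z} {R} P le av G H ey ez with pull y (AtTriangle.ll G) ey
    ... | q , R₁ , r₁ , y≢q , fy₁ with pull z (loopless-tail (loopless-≈ r₁ (AtTriangle.ll G))) ez₁
      where
      module T  = AtTriangle G
      z≢q : z ≢ q
      z≢q refl = no-chord (bridgeless₂₃-≈ T.rotated G) (λ c → rotate-S {L = (x , y) ∷ (y , z) ∷ (z , x) ∷ R}
                   (H av (triangle here (there here) (there (there here)) T.x≢y′ T.y≢z′ T.z≢x′))
                   (trans (cut-≈ (member (y ∷ z ∷ x ∷ [])) T.rotated) c)) (Adj-≈ (≈-sym r₁) here)
      ez₁ : deg z R₁ ≡ 1
      ez₁ = trans (sym count) (trans (sym (deg-≈ z r₁)) ez)
        where
        count : deg z ((y , q) ∷ R₁) ≡ deg z R₁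
        count rewrite δ-≢ (≢-sym T.y≢z′) | δ-≢ z≢q = refl
    ...   | r , R″ , r₂ , z≢r , fz = hittingMatching-≈ s
              (C.lift (hitting-matching k (P [ x ≔ true ]) (subst (_≤ k) (≈-length rR) le) C.good C.noClosed))
      where
      module T  = AtTriangle G
      t : Triangle ((x , y) ∷ (y , z) ∷ (z , x) ∷ R) x y z
      t = triangle here (there here) (there (there here)) T.x≢y′ T.y≢z′ T.z≢x′
      rR : R ≈ (y , q) ∷ (z , r) ∷ R″
      rR = ≈-trans r₁ (≈-prep _ r₂)
      s : (x , y) ∷ (y , z) ∷ (z , x) ∷ R ≈ (x , y) ∷ (y , z) ∷ (z , x) ∷ (y , q) ∷ (z , r) ∷ R″
      s = ≈-prep _ (≈-prep _ (≈-prep _ rR))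
      G₂ = bridgeless₂₃-≈ T.rotated G
      module T₂ = AtTriangle G₂
      G₃ = bridgeless₂₃-≈ T₂.rotated G₂
      c₁ : cut (member (x ∷ y ∷ z ∷ [])) ((x , y) ∷ (y , z) ∷ (z , x) ∷ R) ≢ 0
      c₁ = H av t
      c₂ : cut (member (y ∷ z ∷ x ∷ [])) ((y , z) ∷ (z , x) ∷ (x , y) ∷ R) ≢ 0
      c₂ e = rotate-S {L = (x , y) ∷ (y , z) ∷ (z , x) ∷ R} c₁ (trans (cut-≈ (member (y ∷ z ∷ x ∷ [])) T.rotated) e)
      c₃ : cut (member (z ∷ x ∷ y ∷ [])) ((z , x) ∷ (x , y) ∷ (y , z) ∷ R) ≢ 0
      c₃ e = rotate-S {L = (y , z) ∷ (z , x) ∷ (x , y) ∷ R} c₂ (trans (cut-≈ (member (z ∷ x ∷ y ∷ [])) T₂.rotated) e)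
      inR-q : Adj y q R
      inR-q = Adj-≈ (≈-sym rR) here
      inR-r : Adj z r R
      inR-r = Adj-≈ (≈-sym rR) (there here)
      x≢q : x ≢ q
      x≢q refl = no-chord G c₁ (Adj-sym inR-q)
      z≢q : z ≢ q
      z≢q refl = no-chord G₂ c₂ inR-q
      y≢r : y ≢ r
      y≢r refl = no-chord G₂ c₂ (Adj-sym inR-r)
      x≢r : x ≢ r
      x≢r refl = no-chord G₃ c₃ inR-r
      fy : deg y R″ ≡ 0
      fy = proj₂ (proj₂ (fresh-≈ {u = y} r₂ fy₁))
      fx : deg x R″ ≡ 0 ⊎ deg x R″ ≡ 1
      fx = subst (λ d → d ≡ 0 ⊎ d ≡ 1) (trans (deg-≈ x rR) count) T.degree-x
        where
        count : deg x ((y , q) ∷ (z , r) ∷ R″) ≡ deg x R″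
        count rewrite δ-≢ T.x≢y′ | δ-≢ x≢q | δ-≢ (≢-sym T.z≢x′) | δ-≢ x≢r = refl
      module C = Contract P x≢q x≢r y≢r z≢q fy fz fx (bridgeless₂₃-≈ s G) (noClosed-≈ s H)

    hitting-matching k {L} P le G H
      with any? (λ x → any? λ y → any? λ z → (P x Bool.≟ false ×-dec P y Bool.≟ false ×-dec P z Bool.≟ false) ×-dec
                       Adj? x y L ×-dec Adj? y z L ×-dec Adj? z x L)
    ... | no none with matching₂₃ (allFin n) nothing G (λ p _ → inj₁ (∈-allFin p))
    ...   | ms , cov = hitting ms cov λ av t → none (_ , _ , _ , av , Adj-sel not ms (xy t) , Adj-sel not ms (yz t) , Adj-sel not ms (zx t))
    hitting-matching zero {[]} P le G H | yes (x , y , z , av , () , _)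
    hitting-matching (suc k) {L} P le G H | yes (x , y , z , av , a , b , c) with triangle-extract (loopless G) a b c
    ... | R , s = hittingMatching-≈ s (dispatch T.degree-x T₂.degree-x T₃.degree-x)
      where
      K : List (Edge n)
      K = (x , y) ∷ (y , z) ∷ (z , x) ∷ R
      G₁ = bridgeless₂₃-≈ s G
      H₁ : NoClosedTriangle P K
      H₁ = noClosed-≈ s H
      module T  = AtTriangle G₁
      G₂ = bridgeless₂₃-≈ T.rotated G₁
      module T₂ = AtTriangle G₂
      G₃ = bridgeless₂₃-≈ T₂.rotated G₂
      module T₃ = AtTriangle G₃
      short : length R ≤ k
      short = ≤-trans (n≤1+n _) (≤-trans (n≤1+n _) (≤-pred (subst (_≤ suc k) (≈-length s) le)))
      nc : cut (member (x ∷ y ∷ z ∷ [])) K ≢ 0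
      nc = H₁ av (triangle here (there here) (there (there here)) T.x≢y′ T.y≢z′ T.z≢x′)
      -- At least two vertices of the triangle have a third edge; a rotation makes them the `y` and
      -- `z` of `contract`.
      dispatch : deg x R ≡ 0 ⊎ deg x R ≡ 1 → deg y R ≡ 0 ⊎ deg y R ≡ 1 → deg z R ≡ 0 ⊎ deg z R ≡ 1 → HittingMatching P K
      dispatch _        (inj₂ ey) (inj₂ ez) = contract k P short av G₁ H₁ ey ez
      dispatch (inj₂ ex) (inj₁ _) (inj₂ ez) = hittingMatching-≈ T.rotated
        (contract k P short (proj₁ (proj₂ av) , proj₂ (proj₂ av) , proj₁ av) G₂ (noClosed-≈ T.rotated H₁) ez ex)
      dispatch (inj₂ ex) (inj₂ ey) (inj₁ _) = hittingMatching-≈ (≈-trans T.rotated T₂.rotated)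
        (contract k P short (proj₂ (proj₂ av) , proj₁ av , proj₁ (proj₂ av)) G₃ (noClosed-≈ (≈-trans T.rotated T₂.rotated) H₁) ex ey)
      dispatch (inj₁ ex) (inj₁ ey) dz = ⊥-elim (T.lonely nc (there (there (here refl)))
        (λ { (here refl) → inj₂ ex ; (there (here refl)) → inj₂ ey ; (there (there (here refl))) → inj₁ refl }) dz)
      dispatch (inj₁ ex) dy (inj₁ ez) = ⊥-elim (T.lonely nc (there (here refl))
        (λ { (here refl) → inj₂ ex ; (there (here refl)) → inj₁ refl ; (there (there (here refl))) → inj₂ ez }) dy)
      dispatch dx (inj₁ ey) (inj₁ ez) = ⊥-elim (T.lonely nc (here refl)
        (λ { (here refl) → inj₁ refl ; (there (here refl)) → inj₂ ey ; (there (there (here refl))) → inj₂ ez }) dx)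

  -- Decomposition into trails

  data Even : ℕ → Set
  data Odd : ℕ → Set

  data Even where
    even-0 : Even 0
    even-s : ∀ {k} → Odd k → Even (suc k)

  data Odd where
    odd-s : ∀ {k} → Even k → Odd (suc k)

  parity : ∀ k → Even k ⊎ Odd k
  parity zero    = inj₁ even-0
  parity (suc k) with parity k
  ... | inj₁ e = inj₂ (odd-s e)
  ... | inj₂ o = inj₁ (even-s o)

  unique-↭ : ∀ {A : Set} {xs ys : List A} → xs ↭ ys → Unique xs → Unique ys
  unique-↭ ↭-refl u = u
  unique-↭ (prep x p) (a ∷ u) = All-resp-↭ p a ∷ unique-↭ p u
  unique-↭ (swap x y p) ((x≢y ∷ a) ∷ b ∷ u) = (≢-sym x≢y ∷ All-resp-↭ p b) ∷ All-resp-↭ p a ∷ unique-↭ p u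
  unique-↭ (↭-tr p q) u = unique-↭ q (unique-↭ p u)

  module _ {n : ℕ} where

    fresh-all : ∀ {x : Fin n} {xs} → x ∉ xs → All (x ≢_) xs
    fresh-all {xs = []}     h = []
    fresh-all {xs = y ∷ xs} h = (h ∘ here) ∷ fresh-all (h ∘ there)

    path : Fin n → List (Fin n) → List (Edge n)
    path h []       = []
    path h (y ∷ ys) = (h , y) ∷ path y ys

    cycle : List (Fin n) → List (Edge n)
    cycle []       = []
    cycle (h ∷ as) = path h (as ++ h ∷ [])

    path-++ : ∀ h as z bs → path h (as ++ z ∷ bs) ≡ path h (as ++ z ∷ []) ++ path z bs
    path-++ h []       z bs = refl
    path-++ h (a ∷ as) z bs = cong ((h , a) ∷_) (path-++ a as z bs)

    1≤inc-fst : ∀ p (y : Fin n) → 1 ≤ inc p (p , y)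
    1≤inc-fst p y rewrite δ-refl p = s≤s z≤n

    1≤inc-snd : ∀ p (y : Fin n) → 1 ≤ inc p (y , p)
    1≤inc-snd p y rewrite δ-refl p = m≤n+m 1 (δ p y)

    1≤deg-end : ∀ p h as → 1 ≤ deg p (path h (as ++ p ∷ []))
    1≤deg-end p h []       = ≤-trans (1≤inc-snd p h) (m≤m+n _ _)
    1≤deg-end p h (a ∷ as) = ≤-trans (1≤deg-end p a as) (m≤n+m _ (inc p (h , a)))

    2≤deg-interior : ∀ p h as b bs → 2 ≤ deg p (path h (as ++ p ∷ b ∷ bs))
    2≤deg-interior p h as b bs rewrite path-++ h as p (b ∷ bs) | deg-++ p (path h (as ++ p ∷ [])) (path p (b ∷ bs)) =
      +-mono-≤ (1≤deg-end p h as) (≤-trans (1≤inc-fst p b) (m≤m+n _ _))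

    deg-end : ∀ {p} h as → p ∉ h ∷ as → deg p (path h (as ++ p ∷ [])) ≡ 1
    deg-end {p} h []       p∉ rewrite δ-refl p | δ-≢ {p = p} {h} (p∉ ∘ here) = refl
    deg-end {p} h (a ∷ as) p∉ rewrite δ-≢ {p = p} {h} (p∉ ∘ here) | δ-≢ {p = p} {a} (λ e → p∉ (there (here e))) = deg-end a as (p∉ ∘ there)

    cycle-rotate : ∀ as bs → cycle (as ++ bs) ≈ cycle (bs ++ as)
    cycle-rotate []       bs rewrite ++-identityʳ bs = ≈-refl
    cycle-rotate (a ∷ as) [] rewrite ++-identityʳ as = ≈-refl
    cycle-rotate (a ∷ as) (b ∷ bs)
      rewrite ++-assoc as (b ∷ bs) (a ∷ []) | ++-assoc bs (a ∷ as) (b ∷ [])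
            | path-++ a as b (bs ++ a ∷ []) | path-++ b bs a (as ++ b ∷ []) =
      ≈-++-comm (path a (as ++ b ∷ [])) (path b (bs ++ a ∷ []))

    deg-cycle-head : ∀ h as → h ∉ as → deg h (cycle (h ∷ as)) ≡ 2
    deg-cycle-head h []       h∉ rewrite δ-refl h = refl
    deg-cycle-head h (a ∷ as) h∉ rewrite δ-refl h | δ-≢ {p = h} {a} (h∉ ∘ here) = cong suc (deg-end a as h∉)

    deg-cycle-∈ : ∀ {p} c → Unique c → p ∈ c → deg p (cycle c) ≡ 2
    deg-cycle-∈ {p} c u p∈ with ∈-∃++ p∈
    ... | as , bs , refl = trans (deg-≈ p (cycle-rotate as (p ∷ bs)))
                             (deg-cycle-head p (bs ++ as) (Unique[x∷xs]⇒x∉xs (unique-↭ (++-comm as (p ∷ bs)) u)))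

    -- Positions are counted from 0, so `evens` contains the first edge of the path.
    evens odds : Fin n → List (Fin n) → List (Edge n)
    evens h []       = []
    evens h (y ∷ ys) = (h , y) ∷ odds y ys
    odds  h []       = []
    odds  h (y ∷ ys) = evens y ys

    path-split : ∀ h ys → path h ys ≈ evens h ys ++ odds h ys
    path-split h []       = ≈-refl
    path-split h (y ∷ ys) = ≈-prep (h , y) (≈-trans (path-split y ys) (≈-++-comm (evens y ys) (odds y ys)))

    deg-evens-∉ : ∀ {p} h ys → p ∉ h ∷ ys → deg p (evens h ys) ≡ 0
    deg-odds-∉  : ∀ {p} h ys → p ∉ h ∷ ys → deg p (odds h ys) ≡ 0
    deg-evens-∉     h []       p∉ = refl
    deg-evens-∉ {p} h (y ∷ ys) p∉ rewrite δ-≢ {p = p} {h} (p∉ ∘ here) | δ-≢ {p = p} {y} (λ e → p∉ (there (here e))) = deg-odds-∉ y ys (p∉ ∘ there)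
    deg-odds-∉ h []       p∉ = refl
    deg-odds-∉ h (y ∷ ys) p∉ = deg-evens-∉ y ys (p∉ ∘ there)

    deg-odds-head : ∀ h ys → Unique (h ∷ ys) → deg h (odds h ys) ≡ 0
    deg-odds-head h []       u = refl
    deg-odds-head h (y ∷ ys) u = deg-evens-∉ y ys (Unique[x∷xs]⇒x∉xs u)

    deg-evens≤1 : ∀ p h ys → Unique (h ∷ ys) → deg p (evens h ys) ≤ 1
    deg-odds≤1  : ∀ p h ys → Unique (h ∷ ys) → deg p (odds h ys) ≤ 1
    deg-evens≤1 p h []       u = z≤n
    deg-evens≤1 p h (y ∷ ys) (h≢ ∷ u) with p ≟ h | p ≟ y
    ... | yes refl | yes refl = ⊥-elim (Unique[x∷xs]⇒x∉xs (h≢ ∷ u) (here refl))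
    ... | yes refl | no _     = s≤s (≤-reflexive (deg-odds-∉ y ys (Unique[x∷xs]⇒x∉xs (h≢ ∷ u))))
    ... | no _     | yes refl = s≤s (≤-reflexive (deg-odds-head y ys u))
    ... | no _     | no _     = deg-odds≤1 p y ys u
    deg-odds≤1 p h []       u       = z≤n
    deg-odds≤1 p h (y ∷ ys) (_ ∷ u) = deg-evens≤1 p y ys u

    whole-path : List (Fin n) → List (Edge n)
    whole-path []       = []
    whole-path (h ∷ ys) = path h ys

    whole-path-snoc : ∀ ys y x → whole-path (ys ∷ʳ y ∷ʳ x) ≈ (x , y) ∷ whole-path (ys ∷ʳ y)
    whole-path-snoc []            y x = ≈-flip y x
    whole-path-snoc (a ∷ [])      y x = ≈-trans (≈-prep _ (≈-flip y x)) (≈-swap _ _)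
    whole-path-snoc (a ∷ b ∷ ys) y x = ≈-trans (≈-prep _ (whole-path-snoc (b ∷ ys) y x)) (≈-swap _ _)

    whole-path-reverse : ∀ ys → whole-path (reverse ys) ≈ whole-path ys
    whole-path-reverse []            = ≈-refl
    whole-path-reverse (x ∷ [])      = ≈-refl
    whole-path-reverse (x ∷ y ∷ ys) =
      subst (λ zs → whole-path zs ≈ path x (y ∷ ys)) (sym unfold₂)
        (≈-trans (whole-path-snoc (reverse ys) y x)
          (≈-prep _ (subst (λ zs → whole-path zs ≈ path y ys) (unfold-reverse y ys) (whole-path-reverse (y ∷ ys)))))
      where
      unfold₂ : reverse (x ∷ y ∷ ys) ≡ reverse ys ∷ʳ y ∷ʳ x
      unfold₂ = trans (unfold-reverse x (y ∷ ys)) (cong (_∷ʳ x) (unfold-reverse y ys))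

    DegreeTwo : List (Edge n) → Set
    DegreeTwo L = ∀ p → deg p L ≤ 2

    data Shape : List (Edge n) → List (Fin n) → Set where
      open-trail   : ∀ h ys → 1 ≤ length ys → Unique (h ∷ ys) → Shape (path h ys) (h ∷ ys)
      closed-trail : ∀ h ys → Unique (h ∷ ys) → Shape (cycle (h ∷ ys)) (h ∷ ys)

    record Component (L : List (Edge n)) : Set where
      field
        {edges remainder} : List (Edge n)
        {vertices}        : List (Fin n)
        shape     : Shape edges vertices
        splits    : L ≈ edges ++ remainder
        fresh     : ∀ {p} → p ∈ vertices → deg p remainder ≡ 0

    component-≈ : ∀ {L K : List (Edge n)} → L ≈ K → Component K → Component L
    component-≈ r C = record { shape = shape ; splits = ≈-trans r splits ; fresh = fresh }
      where open Component C

    private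
      spent : ∀ {a b} → 2 ≤ a → a + b ≤ 2 → b ≡ 0
      spent {suc (suc a)} {b} _ (s≤s (s≤s le)) = m+n≡0⇒n≡0 a (n≤0⇒n≡0 le)
      spent {suc zero} (s≤s ())

    interior-fresh : ∀ p h as b bs {R} → DegreeTwo (path h (as ++ p ∷ b ∷ bs) ++ R) → deg p R ≡ 0
    interior-fresh p h as b bs {R} d2 =
      spent (2≤deg-interior p h as b bs) (subst (_≤ 2) (deg-++ p (path h (as ++ p ∷ b ∷ bs)) R) (d2 p))

    interior-snoc : ∀ p h as bs l {R} → DegreeTwo (path h ((as ++ p ∷ bs) ∷ʳ l) ++ R) → deg p R ≡ 0
    interior-snoc p h as []       l {R} d2 =
      interior-fresh p h as l [] (subst (λ ws → DegreeTwo (path h ws ++ R)) (++-assoc as (p ∷ []) (l ∷ [])) d2)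
    interior-snoc p h as (b ∷ bs) l {R} d2 =
      interior-fresh p h as b (bs ∷ʳ l) (subst (λ ws → DegreeTwo (path h ws ++ R)) (++-assoc as (p ∷ b ∷ bs) (l ∷ [])) d2)

    degreeTwo-≈ : ∀ {L K : List (Edge n)} → L ≈ K → DegreeTwo L → DegreeTwo K
    degreeTwo-≈ r d p = subst (_≤ 2) (deg-≈ p r) (d p)

    loopless-++ʳ : ∀ (K : List (Edge n)) {L} → Loopless (K ++ L) → Loopless L
    loopless-++ʳ []      ll       = ll
    loopless-++ʳ (e ∷ K) (_ ∷ ll) = loopless-++ʳ K ll

    -- The path is extended at its head; when the head is exhausted, the path is reversed and
    -- extended at the other end. Interior vertices have spent their degree two, so an extension
    -- reaches either a new vertex or the far end, where it closes a cycle.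
    grow   : ∀ k h ys {R} → 1 ≤ length ys → length R ≤ k → Loopless (path h ys ++ R) → DegreeTwo (path h ys ++ R) → Unique (h ∷ ys) →
             Component (path h ys ++ R)
    extend : ∀ k h ys {R} d → deg h R ≡ suc d → length R ≤ k → Loopless (path h ys ++ R) → DegreeTwo (path h ys ++ R) →
             Unique (h ∷ ys) → Component (path h ys ++ R)

    grow k h ys {R} ne le ll d2 u with deg h R in eq
    ... | suc d = extend k h ys d eq le ll d2 u
    ... | zero with initLast ys
    ...   | [] with () ← ne
    grow k h .(zs ∷ʳ l) {R} ne le ll d2 u | zero | zs ∷ʳ′ l with deg l R in eql
    ...     | zero = record { shape = open-trail h (zs ∷ʳ l) ne u ; splits = ≈-refl ; fresh = all-fresh }
      where
      all-fresh : ∀ {p} → p ∈ h ∷ zs ∷ʳ l → deg p R ≡ 0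
      all-fresh (here refl) = eq
      all-fresh {p} (there p∈) with ∈-++⁻ zs p∈
      ... | inj₂ (here refl) = eql
      ... | inj₁ p∈zs with ∈-∃++ p∈zs
      ...   | as , bs , refl = interior-snoc p h as bs l d2
    ...     | suc d = component-≈ reversed (extend k l (reverse (h ∷ zs)) d eql le
                        (loopless-≈ reversed ll) (degreeTwo-≈ reversed d2)
                        (subst Unique rev≡ (unique-↭ (↭-sym (↭-reverse (h ∷ zs ∷ʳ l))) u)))
      where
      rev≡ : reverse (h ∷ zs ∷ʳ l) ≡ l ∷ reverse (h ∷ zs)
      rev≡ = reverse-snoc (h ∷ zs)
        where
        reverse-snoc : ∀ ws → reverse (ws ∷ʳ l) ≡ l ∷ reverse ws
        reverse-snoc []       = refl
        reverse-snoc (w ∷ ws) rewrite unfold-reverse w (ws ∷ʳ l) | unfold-reverse w ws | reverse-snoc ws = refl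
      reversed : path h (zs ∷ʳ l) ++ R ≈ path l (reverse (h ∷ zs)) ++ R
      reversed = ≈-++ (≈-sym (subst (λ ws → whole-path ws ≈ path h (zs ∷ʳ l)) rev≡ (whole-path-reverse (h ∷ zs ∷ʳ l)))) ≈-refl

    extend zero    h ys {[]} d () le ll d2 u
    extend (suc k) h ys {R} d eq le ll d2 u with pull h (loopless-++ʳ (path h ys) ll) eq
    ... | w , R′ , r , h≢w , eq′ with _∈?_ _≟_ w ys
    ...   | no w∉ = component-≈ moved (grow k w (h ∷ ys) (s≤s z≤n) short (loopless-≈ moved ll) (degreeTwo-≈ moved d2)
                      (fresh-all (λ { (here e) → h≢w (sym e) ; (there w∈) → w∉ w∈ }) ∷ u))
      where
      moved : path h ys ++ R ≈ path w (h ∷ ys) ++ R′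
      moved = ≈-trans (≈-++ˡ (path h ys) (≈-trans r (≈-flip _ _))) (≈-shift (w , h) (path h ys) R′)
      short : length R′ ≤ k
      short = ≤-pred (subst (_≤ suc k) (≈-length r) le)
    ...   | yes w∈ with ∈-∃++ w∈
    ...     | as , b ∷ bs , refl with () ← subst (1 ≤_)
                 (m+n≡0⇒m≡0 (inc w (h , w)) (trans (sym (deg-≈ w r)) (interior-fresh w h as b bs d2))) (1≤inc-snd w h)
    extend (suc k) h ys {R} d eq le ll d2 u | w , R′ , r , h≢w , eq′ | yes w∈ | as , [] , refl =
      record { shape = closed-trail h (as ∷ʳ w) u ; splits = closed ; fresh = λ p∈ → spent
        (≤-reflexive (sym (deg-cycle-∈ (h ∷ as ∷ʳ w) u p∈)))
        (subst (_≤ 2) (deg-++ _ (cycle (h ∷ as ∷ʳ w)) R′) (degreeTwo-≈ closed d2 _)) }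
      where
      cycle≡ : cycle (h ∷ as ∷ʳ w) ≡ path h (as ∷ʳ w) ++ (w , h) ∷ []
      cycle≡ = trans (cong (path h) (++-assoc as (w ∷ []) (h ∷ []))) (path-++ h as w (h ∷ []))
      closed : path h (as ∷ʳ w) ++ R ≈ cycle (h ∷ as ∷ʳ w) ++ R′
      closed rewrite cycle≡ | ++-assoc (path h (as ∷ʳ w)) ((w , h) ∷ []) R′ =
        ≈-++ˡ (path h (as ∷ʳ w)) (≈-trans r (≈-flip _ _))

    -- `T₁` and `T₃` collect the alternate edges of paths and even cycles and become parts of the
    -- classes 1 and 3; the odd cycles `D` are left for later.
    record Trails (N : List (Edge n)) : Set where
      field
        {T₁ T₃} : List (Edge n)
        {D}     : List (List (Fin n))
        splits  : N ≈ T₁ ++ T₃ ++ concatMap cycle D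
        deg₁    : ∀ p → deg p T₁ ≤ 1
        deg₃    : ∀ p → deg p T₃ ≤ 1
        unique  : All Unique D
        odd     : All (Odd ∘ length) D

    length-path : ∀ h ys → length (path h ys) ≡ length ys
    length-path h []       = refl
    length-path h (y ∷ ys) = cong suc (length-path y ys)

    length-cycle : ∀ c → length (cycle c) ≡ length c
    length-cycle []       = refl
    length-cycle (h ∷ as) = trans (length-path h (as ∷ʳ h)) (trans (length-++ as) (+-comm (length as) 1))

    evens-snoc : ∀ h ys x → Odd (length ys) → evens h (ys ∷ʳ x) ≡ evens h ys
    evens-snoc h (a ∷ [])      x o                  = refl
    evens-snoc h (a ∷ b ∷ ys) x (odd-s (even-s o)) = cong ((h , a) ∷_) (evens-snoc b ys x o)

    -- The second half is written as the `evens` of the rotated cycle, so that `deg-evens≤1` applies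
    -- to both halves.
    even-cycle-split : ∀ h a as → Odd (length (a ∷ as)) → cycle (h ∷ a ∷ as) ≈ evens h (a ∷ as) ++ evens a (as ∷ʳ h)
    even-cycle-split h a as o =
      subst (λ E → cycle (h ∷ a ∷ as) ≈ E ++ evens a (as ∷ʳ h)) (evens-snoc h (a ∷ as) h o) (path-split h (a ∷ as ∷ʳ h))

    deg-++-≤1 : ∀ p (E T : List (Edge n)) → deg p E ≤ 1 → deg p T ≤ 1 → deg p E ≡ 0 ⊎ deg p T ≡ 0 → deg p (E ++ T) ≤ 1
    deg-++-≤1 p E T e t (inj₁ z) rewrite deg-++ p E T | z = t
    deg-++-≤1 p E T e t (inj₂ z) rewrite deg-++ p E T | z | +-identityʳ (deg p E) = e

    module _ {N T₁ T₃ C : List (Edge n)} (s : N ≈ T₁ ++ T₃ ++ C) {p : Fin n} (z : deg p N ≡ 0) where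
      private
        total-zero : deg p T₁ + (deg p T₃ + deg p C) ≡ 0
        total-zero = trans (cong (deg p T₁ +_) (sym (deg-++ p T₃ C)))
                       (trans (sym (deg-++ p T₁ (T₃ ++ C))) (trans (sym (deg-≈ p s)) z))
      part₁ : deg p T₁ ≡ 0
      part₁ = m+n≡0⇒m≡0 (deg p T₁) total-zero
      part₃ : deg p T₃ ≡ 0
      part₃ = m+n≡0⇒m≡0 (deg p T₃) (m+n≡0⇒n≡0 (deg p T₁) total-zero)

    two-coloured : ∀ {N E₁ E₃ R : List (Edge n)} {vs} → N ≈ (E₁ ++ E₃) ++ R →
      (∀ p → deg p E₁ ≤ 1) → (∀ p → deg p E₃ ≤ 1) → (∀ {p} → p ∉ vs → deg p E₁ ≡ 0 × deg p E₃ ≡ 0) →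
      (∀ {p} → p ∈ vs → deg p R ≡ 0) → Trails R → Trails N
    two-coloured {N} {E₁} {E₃} {R} {vs} r e₁ e₃ off fresh T = record
      { T₁     = E₁ ++ T₁
      ; T₃     = E₃ ++ T₃
      ; D      = D
      ; splits = ≈-trans r (≈-trans (≈-++ˡ (E₁ ++ E₃) splits) regroup)
      ; deg₁   = λ p → deg-++-≤1 p E₁ T₁ (e₁ p) (deg₁ p) (apart₁ p)
      ; deg₃   = λ p → deg-++-≤1 p E₃ T₃ (e₃ p) (deg₃ p) (apart₃ p)
      ; unique = unique
      ; odd    = odd
      }
      where
      open Trails T
      C : List (Edge n)
      C = concatMap cycle D
      apart₁ : ∀ p → deg p E₁ ≡ 0 ⊎ deg p T₁ ≡ 0
      apart₁ p with _∈?_ _≟_ p vs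
      ... | yes p∈ = inj₂ (part₁ {T₁ = T₁} {T₃} {C} splits (fresh p∈))
      ... | no p∉  = inj₁ (proj₁ (off p∉))
      apart₃ : ∀ p → deg p E₃ ≡ 0 ⊎ deg p T₃ ≡ 0
      apart₃ p with _∈?_ _≟_ p vs
      ... | yes p∈ = inj₂ (part₃ {T₁ = T₁} {T₃} {C} splits (fresh p∈))
      ... | no p∉  = inj₁ (proj₂ (off p∉))
      regroup : (E₁ ++ E₃) ++ T₁ ++ T₃ ++ C ≈ (E₁ ++ T₁) ++ (E₃ ++ T₃) ++ C
      regroup = ≈-trans (≈-interchange E₁ E₃ T₁ (T₃ ++ C))
        (subst (λ A → (E₁ ++ T₁) ++ E₃ ++ T₃ ++ C ≈ (E₁ ++ T₁) ++ A) (sym (++-assoc E₃ T₃ C)) ≈-refl)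

    trails : ∀ k (N : List (Edge n)) → length N ≤ k → Loopless N → DegreeTwo N → Trails N
    trails k [] le ll d2 = record { T₁ = [] ; T₃ = [] ; D = [] ; splits = ≈-refl ; deg₁ = λ _ → z≤n ; deg₃ = λ _ → z≤n ; unique = [] ; odd = [] }
    trails (suc k) N@((x , y) ∷ R₀) le ll@(x≢y ∷ _) d2
      with grow (length R₀) x (y ∷ []) (s≤s z≤n) ≤-refl ll d2 ((x≢y ∷ []) ∷ [] ∷ [])
    ... | record { edges = E ; remainder = R ; shape = shape ; splits = r ; fresh = fresh } = assemble shape r fresh
      where
      assemble : ∀ {E vs} → Shape E vs → N ≈ E ++ R → (∀ {p} → p ∈ vs → deg p R ≡ 0) → Trails N
      rest-trails : ∀ E → N ≈ E ++ R → 1 ≤ length E → Trails R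
      rest-trails E r ne = trails k R
        (≤-pred (≤-trans (+-mono-≤ ne ≤-refl) (≤-trans (≤-reflexive (sym (trans (≈-length r) (length-++ E)))) le)))
        (loopless-++ʳ E (loopless-≈ r ll))
        (λ p → ≤-trans (m≤n+m _ (deg p E)) (subst (_≤ 2) (trans (deg-≈ p r) (deg-++ p E R)) (d2 p)))
      assemble (open-trail h ys ne u) r fresh = two-coloured {E₁ = evens h ys} {E₃ = odds h ys} (≈-trans r (≈-++ (path-split h ys) ≈-refl))
        (λ p → deg-evens≤1 p h ys u) (λ p → deg-odds≤1 p h ys u) (λ p∉ → deg-evens-∉ h ys p∉ , deg-odds-∉ h ys p∉)
        fresh (rest-trails (path h ys) r (subst (1 ≤_) (sym (length-path h ys)) ne))
      assemble (closed-trail h ys u) r fresh with parity (length ys)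
      ... | inj₁ ev = record
        { T₁ = Trails.T₁ T ; T₃ = Trails.T₃ T ; D = (h ∷ ys) ∷ Trails.D T
        ; splits = ≈-trans r (≈-trans (≈-++ˡ (cycle (h ∷ ys)) (Trails.splits T)) regroup)
        ; deg₁ = Trails.deg₁ T ; deg₃ = Trails.deg₃ T
        ; unique = u ∷ Trails.unique T ; odd = odd-s ev ∷ Trails.odd T }
        where
        T : Trails R
        T = rest-trails (cycle (h ∷ ys)) r (subst (1 ≤_) (sym (length-cycle (h ∷ ys))) (s≤s z≤n))
        regroup : cycle (h ∷ ys) ++ Trails.T₁ T ++ Trails.T₃ T ++ concatMap cycle (Trails.D T) ≈
                  Trails.T₁ T ++ Trails.T₃ T ++ cycle (h ∷ ys) ++ concatMap cycle (Trails.D T)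
        regroup = ≈-trans (≈-exchange (cycle (h ∷ ys)) (Trails.T₁ T) _) (≈-++ˡ (Trails.T₁ T) (≈-exchange (cycle (h ∷ ys)) (Trails.T₃ T) _))
      assemble (closed-trail h [] u) r fresh | inj₂ ()
      assemble (closed-trail h (a ∷ as) u) r fresh | inj₂ od =
        two-coloured {E₁ = evens h (a ∷ as)} {E₃ = evens a (as ∷ʳ h)} (≈-trans r (≈-++ (even-cycle-split h a as od) ≈-refl))
          (λ p → deg-evens≤1 p h (a ∷ as) u) (λ p → deg-evens≤1 p a (as ∷ʳ h) u′)
          (λ p∉ → deg-evens-∉ h (a ∷ as) p∉ , deg-evens-∉ a (as ∷ʳ h) (p∉ ∘ ∈-resp-↭ (↭-sym turn)))
          fresh (rest-trails (cycle (h ∷ a ∷ as)) r (subst (1 ≤_) (sym (length-cycle (h ∷ a ∷ as))) (s≤s z≤n)))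
        where
        turn : h ∷ a ∷ as ↭ a ∷ as ∷ʳ h
        turn = ++-comm (h ∷ []) (a ∷ as)
        u′ : Unique (a ∷ as ∷ʳ h)
        u′ = unique-↭ turn u

  -- Windows of an odd cycle

  does-true : ∀ {A : Set} (d : Dec A) → does d ≡ true → A
  does-true (yes a) _ = a

  does-false : ∀ {A : Set} (d : Dec A) → does d ≡ false → ¬ A
  does-false (no ¬a) _ = ¬a

  -- At a vertex labelled `O` an arc may leave, at `I` one may enter, at `N` neither. An arc is a
  -- matched edge between `O` and `I`.
  data Label : Set where
    O I N : Label

  every : (Label → Bool) → Bool
  every f = f O ∧ f I ∧ f N

  every-sound : ∀ f → every f ≡ true → ∀ l → f l ≡ true
  every-sound f eq l with f O in eO | f I in eI | f N in eN
  every-sound f eq O | true | true | true = eO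
  every-sound f eq I | true | true | true = eI
  every-sound f eq N | true | true | true = eN

  clash : Label → Label → ℕ
  clash O I = 1
  clash I O = 1
  clash _ _ = 0

  clash-comm : ∀ a b → clash a b ≡ clash b a
  clash-comm O O = refl
  clash-comm O I = refl
  clash-comm O N = refl
  clash-comm I O = refl
  clash-comm I I = refl
  clash-comm I N = refl
  clash-comm N O = refl
  clash-comm N I = refl
  clash-comm N N = refl

  clash-N : ∀ a → clash a N ≡ 0
  clash-N O = refl
  clash-N I = refl
  clash-N N = refl

  first second : Bool → Label
  first  d = if d then O else I
  second d = if d then I else O

  -- Here `a`, `b`, `c`, `e` are the labels of the partners of the window vertices w, u, v, x, and
  -- `d` is the direction of the window; the cost is the number of arcs at it.
  window-cost : Bool → Label → Label → Label → Label → ℕ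
  window-cost d a b c e = clash (first d) a + (clash (first d) b + (clash (second d) c + clash (second d) e))

  _==_ : Label → Label → Bool
  O == O = true
  I == I = true
  N == N = true
  _ == _ = false

  neutral : Label → Bool
  neutral N = true
  neutral _ = false

  -- The costs of the two directions add up to the number of labels that are not neutral. With a
  -- neutral label the sum is at most three, so one direction costs at most one; the last two
  -- disjuncts name three labels at which one direction costs nothing.
  useful : Label → Label → Label → Label → Bool
  useful a b c e = neutral a ∨ neutral b ∨ neutral c ∨ neutral e ∨ (a == b ∧ not (b == c)) ∨ (not (b == c) ∧ c == e)

  useful⇒cheap : ∀ a b c e → useful a b c e ≡ true → ∃ λ d → window-cost d a b c e ≤ 1
  useful⇒cheap a b c e h = pick (imp (useful a b c e) h (every-sound (ok a b c) (every-sound (λ c → every (ok a b c))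
              (every-sound (λ b → every λ c → every (ok a b c)) (every-sound table refl a) b) c) e))
    where
    cheap : Bool → Label → Label → Label → Label → Bool
    cheap d a b c e = window-cost d a b c e ≤ᵇ 1
    ok : Label → Label → Label → Label → Bool
    ok a b c e = not (useful a b c e) ∨ cheap true a b c e ∨ cheap false a b c e
    table : Label → Bool
    table a = every λ b → every λ c → every (ok a b c)
    imp : ∀ x {y} → x ≡ true → not x ∨ y ≡ true → y ≡ true
    imp true refl h = h
    toT : ∀ {b} → b ≡ true → Bool.T b
    toT refl = _
    pick : cheap true a b c e ∨ cheap false a b c e ≡ true → ∃ λ d → window-cost d a b c e ≤ 1
    pick h with cheap true a b c e in et
    ... | true  = true , ≤ᵇ⇒≤ _ 1 (toT et)
    ... | false = false , ≤ᵇ⇒≤ _ 1 (toT h)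

  module _ {n : ℕ} where

    infix 4 _~_

    _~_ : List (Fin n) → List (Fin n) → Set
    c ~ c′ = c ↭ c′ × cycle c ≈ cycle c′

    ~-trans : ∀ {a b c} → a ~ b → b ~ c → a ~ c
    ~-trans (p , q) (p′ , q′) = ↭-tr p p′ , ≈-trans q q′

    ~-rotate : ∀ as bs → as ++ bs ~ bs ++ as
    ~-rotate as bs = ++-comm as bs , cycle-rotate as bs

    -- The edge u v of the odd cycle w u v x … is the exceptional one; `forward` tells from which of
    -- its ends arcs leave: from w and u if it is true, from v and x otherwise.
    record Placement : Set where
      constructor place
      field
        w u v x : Fin n
        rest    : List (Fin n)
        forward : Bool

      vertices : List (Fin n)
      vertices = w ∷ u ∷ v ∷ x ∷ rest

      label : Fin n → Label
      label p = if does (p ≟ w) ∨ does (p ≟ u) then first forward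
                else if does (p ≟ v) ∨ does (p ≟ x) then second forward else N
    open Placement

    to-front : ∀ {a} {c : List (Fin n)} → a ∈ c → ∃ λ t → c ~ a ∷ t
    to-front a∈ with ∈-∃++ a∈
    ... | as , bs , refl = bs ++ as , ~-rotate as (_ ∷ bs)

    module _ (Q : Fin n → Bool) where

      scan : ∀ b t {a} → Q b ≡ false → a ∈ t → Q a ≡ true →
             ∃₂ λ pre z → ∃₂ λ z′ post → b ∷ t ≡ pre ++ z ∷ z′ ∷ post × Q z ≡ false × Q z′ ≡ true
      scan b (x ∷ t) Qb a∈ Qa with Q x in Qx
      ... | true  = [] , b , x , t , refl , Qb , Qx
      scan b (x ∷ t) Qb (here refl) Qa | false with () ← trans (sym Qx) Qa
      scan b (x ∷ t) Qb (there a∈) Qa | false with scan x t Qx a∈ Qa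
      ... | pre , z , z′ , post , eq , h = b ∷ pre , z , z′ , post , cong (b ∷_) eq , h

      -- Going round from `b`, the predicate has to switch on before `a` is reached; the cycle is
      -- rotated to start at that edge.
      boundary : ∀ {c a b} → a ∈ c → Q a ≡ true → b ∈ c → Q b ≡ false →
                 ∃₂ λ z z′ → ∃ λ t → c ~ z ∷ z′ ∷ t × Q z ≡ false × Q z′ ≡ true
      boundary a∈ Qa b∈ Qb with to-front b∈
      ... | t , c~ with ∈-resp-↭ (proj₁ c~) a∈
      ...   | here refl with () ← trans (sym Qa) Qb
      boundary a∈ Qa b∈ Qb | t , c~ | there a∈t with scan _ t Qb a∈t Qa
      ... | pre , z , z′ , post , eq , Qz , Qz′ =
        z , z′ , post ++ pre , ~-trans c~ (subst (_~ z ∷ z′ ∷ post ++ pre) (sym eq) (~-rotate pre (z ∷ z′ ∷ post))) , Qz , Qz′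

    split-last-two : ∀ (b c : Fin n) s → ∃ λ r → ∃₂ λ y₀ y₁ → b ∷ c ∷ s ≡ r ++ y₀ ∷ y₁ ∷ []
    split-last-two b c []      = [] , b , c , refl
    split-last-two b c (d ∷ s) with split-last-two c d s
    ... | r , y₀ , y₁ , eq = b ∷ r , y₀ , y₁ , cong (b ∷_) eq

    last-two : ∀ (r : List (Fin n)) → 3 ≤ length r → ∃₂ λ a r′ → ∃₂ λ y₀ y₁ → r ≡ a ∷ r′ ++ y₀ ∷ y₁ ∷ []
    last-two (a ∷ b ∷ c ∷ s) _ with split-last-two b c s
    ... | r , y₀ , y₁ , eq = a , r , y₀ , y₁ , cong (a ∷_) eq
    last-two (_ ∷ _ ∷ []) (s≤s (s≤s ()))
    last-two (_ ∷ []) (s≤s ())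

    module Search (m : Fin n → Fin n) (m-invol : ∀ p → m (m p) ≡ p) where

      Separated : Placement → Set
      Separated P = m (w P) ≢ v P × m (w P) ≢ x P × m (u P) ≢ v P × m (u P) ≢ x P

      record Cheap (ℓ : Fin n → Label) (c : List (Fin n)) : Set where
        field
          P         : Placement
          moved     : c ~ vertices P
          separated : Separated P
          cheap     : window-cost (forward P) (ℓ (w P)) (ℓ (u P)) (ℓ (v P)) (ℓ (x P)) ≤ 1

      window : ∀ ℓ {c} w u v x rest → c ~ w ∷ u ∷ v ∷ x ∷ rest →
               m w ≢ v → m w ≢ x → m u ≢ v → m u ≢ x → useful (ℓ w) (ℓ u) (ℓ v) (ℓ x) ≡ true → Cheap ℓ c
      window ℓ w u v x rest c~ a b c d h with useful⇒cheap (ℓ w) (ℓ u) (ℓ v) (ℓ x) h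
      ... | f , le = record { P = place w u v x rest f ; moved = c~ ; separated = a , b , c , d ; cheap = le }

      Chord : List (Fin n) → Fin n → Set
      Chord c p = m p ∈ c × m p ≢ p

      chord? : ∀ c p → Dec (Chord c p)
      chord? c p = _∈?_ _≟_ (m p) c ×-dec ¬? (m p ≟ p)

      -- The five-cycle of H₂, with its two chords.
      NotHouse : List (Fin n) → Set
      NotHouse c = ∀ {x₀ x₁ x₂ x₃ x₄} → c ~ x₀ ∷ x₁ ∷ x₂ ∷ x₃ ∷ x₄ ∷ [] → m x₃ ≡ x₀ → m x₁ ≡ x₄ → ¬ Chord c x₂ → ⊥

      useful₂ : ∀ a {b} c e → b ≡ N → useful a b c e ≡ true
      useful₂ O _ _ refl = refl
      useful₂ I _ _ refl = refl
      useful₂ N _ _ refl = refl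
      useful₃ : ∀ a b {c} e → c ≡ N → useful a b c e ≡ true
      useful₃ O O _ refl = refl
      useful₃ O I _ refl = refl
      useful₃ O N _ refl = refl
      useful₃ I O _ refl = refl
      useful₃ I I _ refl = refl
      useful₃ I N _ refl = refl
      useful₃ N _ _ refl = refl
      useful₄ : ∀ a b c {e} → e ≡ N → useful a b c e ≡ true
      useful₄ a b c refl = every-sound (λ c → useful a b c N) (every-sound (λ b → every λ c → useful a b c N)
        (every-sound (λ a → every λ b → every λ c → useful a b c N) refl a) b) c

      -- Some edge `x₂ x₃` of the cycle leads from a vertex without a chord to one with a chord. The
      -- partner of `x₃` counts as neutral, so every window through `x₃` has a cheap direction, and
      -- only separation has to be arranged.
      with-chord : ∀ ℓ {c} → Unique c → 5 ≤ length c → NotHouse c → (∀ {p} → p ∈ c → Chord c p → ℓ p ≡ N) →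
                   ∀ {a b} → a ∈ c → Chord c a → b ∈ c → ¬ Chord c b → Cheap ℓ c
      with-chord ℓ {c} uc 5≤ house ℓN {a} {b} a∈ ch b∈ nch with boundary (λ p → does (chord? c p)) a∈ Qa b∈ Qb
        where
        Qa : does (chord? c a) ≡ true
        Qa = dec-true (chord? c a) ch
        Qb : does (chord? c b) ≡ false
        Qb = dec-false (chord? c b) nch
      ... | z , z′ , t , c~t , Qz , Qz′ with last-two t (≤-pred (≤-pred (subst (5 ≤_) (↭-length (proj₁ c~t)) 5≤)))
      ...   | x₄ , rest , x₀ , x₁ , refl = around rest c~ (unique-↭ (proj₁ c~) uc)
        where
        x₂ x₃ : Fin n
        x₂ = z
        x₃ = z′
        c~ : c ~ x₀ ∷ x₁ ∷ x₂ ∷ x₃ ∷ x₄ ∷ rest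
        c~ = ~-trans c~t (~-rotate (x₂ ∷ x₃ ∷ x₄ ∷ rest) (x₀ ∷ x₁ ∷ []))
        chord₃ : Chord c x₃
        chord₃ = does-true (chord? c x₃) Qz′
        no-chord₂ : ¬ Chord c x₂
        no-chord₂ = does-false (chord? c x₂) Qz
        ℓ₃ : ∀ {r} → c ~ r → x₃ ∈ r → ℓ x₃ ≡ N
        ℓ₃ c~r x₃∈ = ℓN (∈-resp-↭ (↭-sym (proj₁ c~r)) x₃∈) chord₃
        free₂ : ∀ {r} → c ~ r → ∀ {q} → q ∈ r → q ≢ x₂ → m x₂ ≢ q
        free₂ c~r q∈ q≢ refl = no-chord₂ (∈-resp-↭ (↭-sym (proj₁ c~r)) q∈ , q≢)
        flipped : ∀ {p q} → m p ≡ q → m q ≡ p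
        flipped refl = m-invol _
        0∈ : ∀ {a} {r : List (Fin n)} → a ∈ a ∷ r
        0∈ = here refl
        1∈ : ∀ {a b} {r : List (Fin n)} → a ∈ b ∷ a ∷ r
        1∈ = there 0∈
        2∈ : ∀ {a b c} {r : List (Fin n)} → a ∈ b ∷ c ∷ a ∷ r
        2∈ = there 1∈
        3∈ : ∀ {a b c d} {r : List (Fin n)} → a ∈ b ∷ c ∷ d ∷ a ∷ r
        3∈ = there 2∈
        -- If the window x₀x₁x₂x₃ is not separated, then the partner of x₃ is x₀ or x₁, which leaves
        -- x₂x₃x₄x₅ separated unless the cycle has length five; there x₁x₂x₃x₄ may remain.
        around : ∀ rest → c ~ x₀ ∷ x₁ ∷ x₂ ∷ x₃ ∷ x₄ ∷ rest → Unique (x₀ ∷ x₁ ∷ x₂ ∷ x₃ ∷ x₄ ∷ rest) → Cheap ℓ c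
        around rest c~ ((n01 ∷ n02 ∷ n03 ∷ n04 ∷ n0r) ∷ (n12 ∷ n13 ∷ n14 ∷ n1r) ∷ (n23 ∷ n24 ∷ n2r) ∷ (n34 ∷ n3r) ∷ n4r ∷ _)
          with m x₃ ≟ x₀ | m x₃ ≟ x₁
        ... | no ≢0 | no ≢1 = window ℓ x₀ x₁ x₂ x₃ (x₄ ∷ rest) c~
              (λ e → free₂ c~ 0∈ n02 (flipped e)) (λ e → ≢0 (flipped e)) (λ e → free₂ c~ 1∈ n12 (flipped e)) (λ e → ≢1 (flipped e))
              (useful₄ (ℓ x₀) (ℓ x₁) (ℓ x₂) (ℓ₃ c~ 3∈))
        around (x₅ ∷ rest) c~ ((n01 ∷ n02 ∷ n03 ∷ n04 ∷ n05 ∷ _) ∷ (n12 ∷ n13 ∷ n14 ∷ n15 ∷ _) ∷ (n23 ∷ n24 ∷ n25 ∷ _) ∷ (n34 ∷ n3r) ∷ n4r ∷ _)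
            | yes e₀ | _ = window ℓ x₂ x₃ x₄ x₅ (rest ++ x₀ ∷ x₁ ∷ []) c~₂
              (free₂ c~₂ 2∈ (≢-sym n24)) (free₂ c~₂ 3∈ (≢-sym n25)) (λ e → n04 (trans (sym e₀) e)) (λ e → n05 (trans (sym e₀) e))
              (useful₂ (ℓ x₂) (ℓ x₄) (ℓ x₅) (ℓ₃ c~ 3∈))
          where
          c~₂ : c ~ x₂ ∷ x₃ ∷ x₄ ∷ x₅ ∷ rest ++ x₀ ∷ x₁ ∷ []
          c~₂ = ~-trans c~ (~-rotate (x₀ ∷ x₁ ∷ []) (x₂ ∷ x₃ ∷ x₄ ∷ x₅ ∷ rest))
        around (x₅ ∷ rest) c~ ((n01 ∷ n02 ∷ n03 ∷ n04 ∷ n05 ∷ _) ∷ (n12 ∷ n13 ∷ n14 ∷ n15 ∷ _) ∷ (n23 ∷ n24 ∷ n25 ∷ _) ∷ (n34 ∷ n3r) ∷ n4r ∷ _)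
            | no _ | yes e₁ = window ℓ x₂ x₃ x₄ x₅ (rest ++ x₀ ∷ x₁ ∷ []) c~₂
              (free₂ c~₂ 2∈ (≢-sym n24)) (free₂ c~₂ 3∈ (≢-sym n25)) (λ e → n14 (trans (sym e₁) e)) (λ e → n15 (trans (sym e₁) e))
              (useful₂ (ℓ x₂) (ℓ x₄) (ℓ x₅) (ℓ₃ c~ 3∈))
          where
          c~₂ : c ~ x₂ ∷ x₃ ∷ x₄ ∷ x₅ ∷ rest ++ x₀ ∷ x₁ ∷ []
          c~₂ = ~-trans c~ (~-rotate (x₀ ∷ x₁ ∷ []) (x₂ ∷ x₃ ∷ x₄ ∷ x₅ ∷ rest))
        around [] c~ ((n01 ∷ n02 ∷ n03 ∷ n04 ∷ n0r) ∷ (n12 ∷ n13 ∷ n14 ∷ n1r) ∷ (n23 ∷ n24 ∷ n2r) ∷ (n34 ∷ n3r) ∷ n4r ∷ _)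
            | no _ | yes e₁ = window ℓ x₂ x₃ x₄ x₀ (x₁ ∷ []) c~₂
              (free₂ c~₂ 2∈ (≢-sym n24)) (free₂ c~₂ 3∈ n02) (λ e → n14 (trans (sym e₁) e)) (λ e → n01 (sym (trans (sym e₁) e)))
              (useful₂ (ℓ x₂) (ℓ x₄) (ℓ x₀) (ℓ₃ c~ 3∈))
          where
          c~₂ : c ~ x₂ ∷ x₃ ∷ x₄ ∷ x₀ ∷ x₁ ∷ []
          c~₂ = ~-trans c~ (~-rotate (x₀ ∷ x₁ ∷ []) (x₂ ∷ x₃ ∷ x₄ ∷ []))
        around [] c~ ((n01 ∷ n02 ∷ n03 ∷ n04 ∷ n0r) ∷ (n12 ∷ n13 ∷ n14 ∷ n1r) ∷ (n23 ∷ n24 ∷ n2r) ∷ (n34 ∷ n3r) ∷ n4r ∷ _)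
            | yes e₀ | _ with m x₁ ≟ x₄
        ...   | yes e₄ = ⊥-elim (house c~ e₀ e₄ no-chord₂)
        ...   | no ≢4 = window ℓ x₁ x₂ x₃ x₄ (x₀ ∷ []) c~₂
              (λ e → n01 (trans (sym e₀) (flipped e))) ≢4 (free₂ c~₂ 2∈ (≢-sym n23)) (free₂ c~₂ 3∈ (≢-sym n24))
              (useful₃ (ℓ x₁) (ℓ x₂) (ℓ x₄) (ℓ₃ c~ 3∈))
          where
          c~₂ : c ~ x₁ ∷ x₂ ∷ x₃ ∷ x₄ ∷ x₀ ∷ []
          c~₂ = ~-trans c~ (~-rotate (x₀ ∷ []) (x₁ ∷ x₂ ∷ x₃ ∷ x₄ ∷ []))

      -- Three consecutive labels that make a window useful, wherever they occur in it.
      decisive : Label → Label → Label → Bool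
      decisive a b c = neutral a ∨ neutral b ∨ neutral c ∨ (a == b ∧ not (b == c)) ∨ (not (a == b) ∧ b == c)

      Infix : (Fin n → Label) → List (Fin n) → Set
      Infix ℓ xs = ∃₂ λ pre p → ∃₂ λ q r → ∃ λ post → xs ≡ pre ++ p ∷ q ∷ r ∷ post × decisive (ℓ p) (ℓ q) (ℓ r) ≡ true

      infix-there : ∀ ℓ {x xs} → Infix ℓ xs → Infix ℓ (x ∷ xs)
      infix-there ℓ {x} (pre , p , q , r , post , eq , d) = x ∷ pre , p , q , r , post , cong (x ∷_) eq , d

      -- After repeated labels `I`, the first different one completes a decisive triple; the final
      -- `O` ensures that it exists.
      two-in : ∀ ℓ a b t z → ℓ a ≡ I → ℓ b ≡ I → ℓ z ≡ O → Infix ℓ (a ∷ b ∷ t ∷ʳ z)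
      two-in ℓ a b [] z ea eb ez = [] , a , b , z , [] , refl , d
        where
        d : decisive (ℓ a) (ℓ b) (ℓ z) ≡ true
        d rewrite ea | eb | ez = refl
      two-in ℓ a b (c ∷ t) z ea eb ez with ℓ c in ec
      ... | I = infix-there ℓ (two-in ℓ b c t z eb ec ez)
      ... | O = [] , a , b , c , t ∷ʳ z , refl , d
        where
        d : decisive (ℓ a) (ℓ b) (ℓ c) ≡ true
        d rewrite ea | eb | ec = refl
      ... | N = [] , a , b , c , t ∷ʳ z , refl , d
        where
        d : decisive (ℓ a) (ℓ b) (ℓ c) ≡ true
        d rewrite ea | eb | ec = refl

      -- Labels that alternate from I to O have even length.
      find-infix : ∀ ℓ a t z → ℓ a ≡ I → ℓ z ≡ O → Odd (length t) → Infix ℓ (a ∷ t ∷ʳ z)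
      find-infix ℓ a (b ∷ []) z ea ez o = [] , a , b , z , [] , refl , d
        where
        d : decisive (ℓ a) (ℓ b) (ℓ z) ≡ true
        d rewrite ea | ez with ℓ b
        ... | O = refl
        ... | I = refl
        ... | N = refl
      find-infix ℓ a (b ∷ c ∷ t) z ea ez (odd-s (even-s o)) with ℓ b in eb | ℓ c in ec
      ... | I | _ = two-in ℓ a b (c ∷ t) z ea eb ez
      ... | O | I = infix-there ℓ (infix-there ℓ (find-infix ℓ c t z ec ez o))
      ... | O | O = [] , a , b , c , t ∷ʳ z , refl , d
        where
        d : decisive (ℓ a) (ℓ b) (ℓ c) ≡ true
        d rewrite ea | eb | ec = refl
      ... | O | N = [] , a , b , c , t ∷ʳ z , refl , d
        where
        d : decisive (ℓ a) (ℓ b) (ℓ c) ≡ true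
        d rewrite ea | eb | ec = refl
      ... | N | _ = [] , a , b , c , t ∷ʳ z , refl , d
        where
        d : decisive (ℓ a) (ℓ b) (ℓ c) ≡ true
        d rewrite ea | eb = refl

      decisive⇒useful : ∀ a b c e f → decisive a b c ≡ true → useful a b c e ≡ true ⊎ useful f a b c ≡ true
      decisive⇒useful a b c e f h = pick (imp (decisive a b c) h
        (every-sound (ok a b c e) (every-sound (λ e → every (ok a b c e)) (every-sound (λ c → every λ e → every (ok a b c e))
          (every-sound (λ b → every λ c → every λ e → every (ok a b c e)) (every-sound table refl a) b) c) e) f))
        where
        ok : Label → Label → Label → Label → Label → Bool
        ok a b c e f = not (decisive a b c) ∨ useful a b c e ∨ useful f a b c
        table : Label → Bool
        table a = every λ b → every λ c → every λ e → every (ok a b c e)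
        imp : ∀ x {y} → x ≡ true → not x ∨ y ≡ true → y ≡ true
        imp true refl h = h
        pick : useful a b c e ∨ useful f a b c ≡ true → useful a b c e ≡ true ⊎ useful f a b c ≡ true
        pick h with useful a b c e
        ... | true  = inj₁ refl
        ... | false = inj₂ h

      -- Without chords every window is separated. Labels `O` and `I` cannot alternate all the way
      -- round an odd cycle, and as both occur, the failure shows up as three consecutive decisive
      -- labels.
      without-chord : ∀ ℓ {c} → Unique c → 5 ≤ length c → Odd (length c) → (∀ {p} → p ∈ c → ¬ Chord c p) →
                      ∀ {a b} → a ∈ c → ℓ a ≡ I → b ∈ c → ℓ b ≡ O → Cheap ℓ c
      without-chord ℓ {c} uc 5≤ od none {a} {b} a∈ ℓa b∈ ℓb = answer
        where
        is-I : Label → Bool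
        is-I I = true
        is-I _ = false
        sep : ∀ {w u v x rest} → c ~ w ∷ u ∷ v ∷ x ∷ rest → useful (ℓ w) (ℓ u) (ℓ v) (ℓ x) ≡ true → Cheap ℓ c
        sep {w} {u} {v} {x} {rest} c~ h with unique-↭ (proj₁ c~) uc
        ... | (wu ∷ wv ∷ wx ∷ _) ∷ (uv ∷ ux ∷ _) ∷ _ =
          window ℓ w u v x rest c~ (away 0∈ 2∈ wv) (away 0∈ 3∈ wx) (away 1∈ 2∈ uv) (away 1∈ 3∈ ux) h
          where
          0∈ : w ∈ w ∷ u ∷ v ∷ x ∷ rest
          0∈ = here refl
          1∈ : u ∈ w ∷ u ∷ v ∷ x ∷ rest
          1∈ = there (here refl)
          2∈ : v ∈ w ∷ u ∷ v ∷ x ∷ rest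
          2∈ = there (there (here refl))
          3∈ : x ∈ w ∷ u ∷ v ∷ x ∷ rest
          3∈ = there (there (there (here refl)))
          away : ∀ {p q} → p ∈ w ∷ u ∷ v ∷ x ∷ rest → q ∈ w ∷ u ∷ v ∷ x ∷ rest → p ≢ q → m p ≢ q
          away p∈ q∈ p≢q refl = none (∈-resp-↭ (↭-sym (proj₁ c~)) p∈) (∈-resp-↭ (↭-sym (proj₁ c~)) q∈ , ≢-sym p≢q)
        decided : ∀ p q r t → c ~ p ∷ q ∷ r ∷ t → decisive (ℓ p) (ℓ q) (ℓ r) ≡ true → Cheap ℓ c
        decided p q r [] c~ d with subst (5 ≤_) (↭-length (proj₁ c~)) 5≤
        ... | s≤s (s≤s (s≤s ()))
        decided p q r (_ ∷ []) c~ d with subst (5 ≤_) (↭-length (proj₁ c~)) 5≤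
        ... | s≤s (s≤s (s≤s (s≤s ())))
        decided p q r (e ∷ e′ ∷ t) c~ d with split-last-two e e′ t
        ... | r′ , y , f , eq with decisive⇒useful (ℓ p) (ℓ q) (ℓ r) (ℓ e) (ℓ f) d
        ...   | inj₁ h = sep c~ h
        -- The triple fills the last three places of the window that starts one vertex earlier.
        ...   | inj₂ h = sep (~-trans c~ back) h
          where
          back : p ∷ q ∷ r ∷ e ∷ e′ ∷ t ~ f ∷ p ∷ q ∷ r ∷ (r′ ∷ʳ y)
          back = subst (λ s → p ∷ q ∷ r ∷ s ~ f ∷ p ∷ q ∷ r ∷ (r′ ∷ʳ y)) (trans (++-assoc r′ (y ∷ []) (f ∷ [])) (sym eq))
                   (~-rotate (p ∷ q ∷ r ∷ (r′ ∷ʳ y)) (f ∷ []))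
        not-I : ∀ l → is-I l ≡ true → l ≡ I
        not-I I _ = refl
        answer : Cheap ℓ c
        answer with boundary (λ p → is-I (ℓ p)) a∈ (cong is-I ℓa) b∈ (cong is-I ℓb)
        ... | z , z′ , t , c~ , Qz , Qz′ with ℓ z in ez
        ...   | I with () ← Qz
        answer | z , z′ , t , c~ , Qz , Qz′ | N = finish t c~ ez
          where
          finish : ∀ t → c ~ z ∷ z′ ∷ t → ℓ z ≡ N → Cheap ℓ c
          finish [] c~ _ with subst (5 ≤_) (↭-length (proj₁ c~)) 5≤
          ... | s≤s (s≤s ())
          finish (r ∷ t) c~ ez = decided z z′ r t c~ d
            where
            d : decisive (ℓ z) (ℓ z′) (ℓ r) ≡ true
            d rewrite ez = refl
        -- Rotated so as to run from `z′` to `z`, the cycle has labels that begin with `I` and end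
        -- with `O`, with an odd number of vertices in between.
        answer | z , z′ , t , c~ , Qz , Qz′ | O with find-infix ℓ z′ t z (not-I (ℓ z′) Qz′) ez (shorten (subst Odd (↭-length (proj₁ c~)) od))
          where
          shorten : ∀ {k} → Odd (suc (suc k)) → Odd k
          shorten (odd-s (even-s o)) = o
        ...     | pre , p , q , r , post , eq , d = decided p q r (post ++ pre) turned d
          where
          turned : c ~ p ∷ q ∷ r ∷ post ++ pre
          turned = ~-trans c~ (~-trans (~-rotate (z ∷ []) (z′ ∷ t))
                     (subst (_~ p ∷ q ∷ r ∷ post ++ pre) (sym eq) (~-rotate pre (p ∷ q ∷ r ∷ post))))

  -- Minimising the number of arcs

  sum-zero : ∀ {n} (f : Fin n → ℕ) → (∀ p → f p ≡ 0) → sum f ≡ 0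
  sum-zero {n} f f≗0 = trans (sum-cong-≗ f≗0) (sum-replicate-zero n)

  sum-single : ∀ {n} (g : Fin n → ℕ) x → sum (λ p → if does (p ≟ x) then g p else 0) ≡ g x
  sum-single g zero    = trans (cong (g zero +_) (sum-zero (λ p → if does (suc p ≟ zero) then g (suc p) else 0) λ _ → refl)) (+-identityʳ (g zero))
  sum-single g (suc x) = sum-single (g ∘ suc) x

  label≟ : (a b : Label) → Dec (a ≡ b)
  label≟ O O = yes refl
  label≟ O I = no λ ()
  label≟ O N = no λ ()
  label≟ I O = no λ ()
  label≟ I I = yes refl
  label≟ I N = no λ ()
  label≟ N O = no λ ()
  label≟ N I = no λ ()
  label≟ N N = yes refl

  clash-self : ∀ a → clash a a ≡ 0
  clash-self O = refl
  clash-self I = refl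
  clash-self N = refl

  odd-double : ∀ a → ¬ Odd (a + a)
  odd-double zero    ()
  odd-double (suc a) o rewrite +-suc a a with o
  ... | odd-s (even-s o′) = odd-double a o′

  module _ {n : ℕ} where

    open Placement

    listSum : (Fin n → ℕ) → List (Fin n) → ℕ
    listSum g []       = 0
    listSum g (x ∷ xs) = g x + listSum g xs

    listSum-↭ : ∀ g {xs ys} → xs ↭ ys → listSum g xs ≡ listSum g ys
    listSum-↭ g ↭-refl       = refl
    listSum-↭ g (prep x p)   = cong (g x +_) (listSum-↭ g p)
    listSum-↭ g (swap {ys = ys} x y p) rewrite listSum-↭ g p = lemma (g x) (g y) (listSum g ys)
      where
      lemma : ∀ a b c → a + (b + c) ≡ b + (a + c)
      lemma = solve-∀
    listSum-↭ g (↭-tr p q)   = trans (listSum-↭ g p) (listSum-↭ g q)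

    listSum-cong : ∀ {f g : Fin n → ℕ} {xs} → (∀ {p} → p ∈ xs → f p ≡ g p) → listSum f xs ≡ listSum g xs
    listSum-cong {xs = []}     h = refl
    listSum-cong {xs = x ∷ xs} h = cong₂ _+_ (h (here refl)) (listSum-cong (λ p∈ → h (there p∈)))

    listSum-zero : ∀ {g : Fin n → ℕ} {xs} → (∀ {p} → p ∈ xs → g p ≡ 0) → listSum g xs ≡ 0
    listSum-zero {xs = []}     h = refl
    listSum-zero {xs = x ∷ xs} h = cong₂ _+_ (h (here refl)) (listSum-zero (λ p∈ → h (there p∈)))

    listSum-one : ∀ (xs : List (Fin n)) → listSum (λ _ → 1) xs ≡ length xs
    listSum-one []       = refl
    listSum-one (x ∷ xs) = cong suc (listSum-one xs)

    ≤-listSum : ∀ g {xs p} → p ∈ xs → g p ≤ listSum g xs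
    ≤-listSum g {x ∷ xs} (here refl) = m≤m+n (g x) _
    ≤-listSum g {x ∷ xs} (there p∈)  = ≤-trans (≤-listSum g p∈) (m≤n+m _ (g x))

    two≤listSum : ∀ g {xs p q} → p ∈ xs → q ∈ xs → p ≢ q → 1 ≤ g p → 1 ≤ g q → 2 ≤ listSum g xs
    two≤listSum g (here refl) (here refl) p≢q _ _ = ⊥-elim (p≢q refl)
    two≤listSum g (here refl) (there q∈) _ a b = +-mono-≤ a (≤-trans b (≤-listSum g q∈))
    two≤listSum g (there p∈) (here refl) _ a b = +-mono-≤ b (≤-trans a (≤-listSum g p∈))
    two≤listSum g {x ∷ xs} (there p∈) (there q∈) p≢q a b = ≤-trans (two≤listSum g p∈ q∈ p≢q a b) (m≤n+m _ (g x))

    sum-member : ∀ g c → Unique c → sum (λ p → if member c p then g p else 0) ≡ listSum g c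
    sum-member g []       _ = sum-zero {n} (λ _ → 0) λ _ → refl
    sum-member g (x ∷ xs) u@(_ ∷ u′) =
      trans (sum-cong-≗ pointwise)
        (trans (∑-distrib-+ (λ p → if does (p ≟ x) then g p else 0) (λ p → if member xs p then g p else 0))
          (cong₂ _+_ (sum-single g x) (sum-member g xs u′)))
      where
      pointwise : ∀ p → (if does (p ≟ x) ∨ member xs p then g p else 0) ≡
                        (if does (p ≟ x) then g p else 0) + (if member xs p then g p else 0)
      pointwise p with p ≟ x
      ... | no _     = refl
      ... | yes refl rewrite member⁻ᶠ xs x (Unique[x∷xs]⇒x∉xs u) = sym (+-identityʳ (g x))

    data LabelView (P : Placement {n}) (p : Fin n) : Label → Set where
      front : p ≡ w P ⊎ p ≡ u P → LabelView P p (first (forward P))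
      back  : p ≡ v P ⊎ p ≡ x P → LabelView P p (second (forward P))
      off   : p ≢ w P → p ≢ u P → p ≢ v P → p ≢ x P → LabelView P p N

    labelView : ∀ P p → LabelView P p (label P p)
    labelView P p with p ≟ w P | p ≟ u P | p ≟ v P | p ≟ x P
    ... | yes e | _     | _     | _     = front (inj₁ e)
    ... | no _  | yes e | _     | _     = front (inj₂ e)
    ... | no _  | no _  | yes e | _     = back (inj₁ e)
    ... | no _  | no _  | no _  | yes e = back (inj₂ e)
    ... | no a  | no b  | no c  | no d  = off a b c d

    module Energy (m : Fin n → Fin n) (m-invol : ∀ p → m (m p) ≡ p)
                  {K : ℕ} (D : Fin K → List (Fin n))
                  (unique   : ∀ k → Unique (D k))
                  (odd      : ∀ k → Odd (length (D k)))
                  (long     : ∀ k → 5 ≤ length (D k))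
                  (disjoint : ∀ {j k p} → p ∈ D j → p ∈ D k → j ≡ k) where

      open Search m m-invol

      π : Permutation n n
      π = permutation m m m-invol m-invol

      separated⇒no-clash : ∀ P → Separated P → ∀ p → clash (label P p) (label P (m p)) ≡ 0
      separated⇒no-clash P (wv , wx , uv , ux) p with label P p | label P (m p) | labelView P p | labelView P (m p)
      ... | _ | _ | front _           | front _          = clash-self (first (forward P))
      ... | _ | _ | back _            | back _           = clash-self (second (forward P))
      ... | _ | _ | off _ _ _ _       | _                = refl
      ... | a | _ | front _           | off _ _ _ _      = clash-N a
      ... | a | _ | back _            | off _ _ _ _      = clash-N a
      ... | _ | _ | front (inj₁ refl) | back (inj₁ e)    = ⊥-elim (wv e)
      ... | _ | _ | front (inj₁ refl) | back (inj₂ e)    = ⊥-elim (wx e)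
      ... | _ | _ | front (inj₂ refl) | back (inj₁ e)    = ⊥-elim (uv e)
      ... | _ | _ | front (inj₂ refl) | back (inj₂ e)    = ⊥-elim (ux e)
      ... | _ | _ | back (inj₁ refl)  | front (inj₁ e)   = ⊥-elim (wv (trans (cong m (sym e)) (m-invol _)))
      ... | _ | _ | back (inj₁ refl)  | front (inj₂ e)   = ⊥-elim (uv (trans (cong m (sym e)) (m-invol _)))
      ... | _ | _ | back (inj₂ refl)  | front (inj₁ e)   = ⊥-elim (wx (trans (cong m (sym e)) (m-invol _)))
      ... | _ | _ | back (inj₂ refl)  | front (inj₂ e)   = ⊥-elim (ux (trans (cong m (sym e)) (m-invol _)))

      record Placed (k : Fin K) : Set where
        field
          P         : Placement {n}
          moved     : D k ~ vertices P
          separated : Separated P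
      open Placed

      State : Set
      State = ∀ k → Placed k

      at? : ∀ p → Dec (∃ λ k → p ∈ D k)
      at? p = any? λ k → _∈?_ _≟_ p (D k)

      cycle-of : Fin n → Maybe (Fin K)
      cycle-of p with at? p
      ... | yes (k , _) = just k
      ... | no _        = nothing

      cycle-of-∈ : ∀ {p k} → p ∈ D k → cycle-of p ≡ just k
      cycle-of-∈ {p} p∈ with at? p
      ... | yes (j , p∈j) = cong just (disjoint p∈j p∈)
      ... | no none       = ⊥-elim (none (_ , p∈))

      cycle-of-just : ∀ {p k} → cycle-of p ≡ just k → p ∈ D k
      cycle-of-just {p} eq with at? p
      cycle-of-just {p} refl | yes (_ , p∈) = p∈

      lab : State → Fin n → Label
      lab S p = maybe′ (λ k → label (P (S k)) p) N (cycle-of p)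

      lab-∈ : ∀ S {p k} → p ∈ D k → lab S p ≡ label (P (S k)) p
      lab-∈ S {p} p∈ = cong (maybe′ (λ k → label (P (S k)) p) N) (cycle-of-∈ p∈)

      replace : State → ∀ k → Placed k → State
      replace S k c j with j ≟ k
      ... | yes refl = c
      ... | no _     = S j

      replace-same : ∀ S k c → replace S k c k ≡ c
      replace-same S k c with k ≟ k
      ... | yes refl = refl
      ... | no k≢k  = ⊥-elim (k≢k refl)

      lab-replace-∉ : ∀ S k c {p} → p ∉ D k → lab (replace S k c) p ≡ lab S p
      lab-replace-∉ S k c {p} p∉ with cycle-of p in eq
      ... | nothing = refl
      ... | just j with j ≟ k
      ...   | yes refl = ⊥-elim (p∉ (cycle-of-just eq))
      ...   | no _     = refl

      arc : State → Fin n → ℕ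
      arc S p = clash (lab S p) (lab S (m p))

      arc-m : ∀ S p → arc S (m p) ≡ arc S p
      arc-m S p rewrite m-invol p = clash-comm (lab S (m p)) (lab S p)

      energy : State → ℕ
      energy S = sum (arc S)

      inner : ∀ S k {p} → p ∈ D k → m p ∈ D k → arc S p ≡ 0
      inner S k p∈ mp∈ rewrite lab-∈ S p∈ | lab-∈ S mp∈ = separated⇒no-clash (P (S k)) (separated (S k)) _

      -- Arcs are counted from both ends, so those at cycle k are counted twice.
      module _ (k : Fin K) where
        private
          c = D k

        untouched : State → Fin n → ℕ
        untouched S p = if member c p ∨ member c (m p) then 0 else arc S p

        -- The involution `m` carries the arcs counted at their end outside the cycle to the same
        -- arcs counted on the cycle; no arc has both ends there, by `inner`.
        energy-split : ∀ S → energy S ≡ listSum (arc S) c + (listSum (arc S) c + sum (untouched S))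
        energy-split S =
          trans (sum-cong-≗ pointwise)
            (trans (∑-distrib-+ A (λ p → B p + untouched S p))
              (cong₂ _+_ (sum-member (arc S) c (unique k))
                (trans (∑-distrib-+ B (untouched S))
                  (cong (_+ sum (untouched S)) (trans (sum-permute B π) (trans (sum-cong-≗ B-m) (sum-member (arc S) c (unique k))))))))
          where
          A B : Fin n → ℕ
          A p = if member c p then arc S p else 0
          B p = if member c p then 0 else (if member c (m p) then arc S p else 0)
          pointwise : ∀ p → arc S p ≡ A p + (B p + untouched S p)
          pointwise p with member c p | member c (m p)
          ... | true  | true  = sym (+-identityʳ _)
          ... | true  | false = sym (+-identityʳ _)
          ... | false | true  = sym (+-identityʳ _)
          ... | false | false = refl
          B-m : ∀ p → B (m p) ≡ A p
          B-m p = trans (cong₂ (λ q a → if member c (m p) then 0 else (if member c q then a else 0)) (m-invol p) (arc-m S p)) flat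
            where
            flat : (if member c (m p) then 0 else (if member c p then arc S p else 0)) ≡ A p
            flat with member c (m p) in e₁ | member c p in e₂
            ... | true  | true  = sym (inner S k (member⁻ c e₂) (member⁻ c e₁))
            ... | true  | false = refl
            ... | false | true  = refl
            ... | false | false = refl

        untouched-replace : ∀ S c′ p → untouched (replace S k c′) p ≡ untouched S p
        untouched-replace S c′ p with member c p in e₁ | member c (m p) in e₂
        ... | true  | _     = refl
        ... | false | true  = refl
        ... | false | false = cong₂ clash (lab-replace-∉ S k c′ (out e₁)) (lab-replace-∉ S k c′ (out e₂))
          where
          out : ∀ {q} → member c q ≡ false → q ∉ c
          out e q∈ with () ← trans (sym e) (member⁺ q∈)

        improves : ∀ S c′ → listSum (arc (replace S k c′)) c < listSum (arc S) c → energy (replace S k c′) < energy S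
        improves S c′ lt rewrite energy-split S | energy-split (replace S k c′) | sum-cong-≗ (untouched-replace S c′) =
          +-mono-<-≤ lt (+-monoˡ-≤ _ (≤-trans (n≤1+n _) lt))

      -- A partner on the cycle itself counts as neutral, because separated windows have no arcs
      -- within a cycle. The labels of all other partners do not change when the window of cycle `k`
      -- is moved.
      outer : State → Fin K → Fin n → Label
      outer S k p = if member (D k) (m p) then N else lab S (m p)

      placed-cost : ∀ S k (C : Cheap (outer S k) (D k)) →
                    listSum (arc (replace S k (record { P = Cheap.P C ; moved = Cheap.moved C ; separated = Cheap.separated C }))) (D k) ≤ 1
      placed-cost S k C = subst (_≤ 1) (sym total-cost) (Cheap.cheap C)
        where
        Q : Placement
        Q = Cheap.P C
        new : Placed k
        new = record { P = Q ; moved = Cheap.moved C ; separated = Cheap.separated C }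
        S′ : State
        S′ = replace S k new
        label-new : ∀ {p} → p ∈ D k → lab S′ p ≡ label Q p
        label-new {p} p∈ = trans (lab-∈ S′ p∈) (cong (λ (c : Placed k) → label (P c) p) (replace-same S k new))
        arc-new : ∀ {p} → p ∈ D k → arc S′ p ≡ clash (label Q p) (outer S k p)
        arc-new {p} p∈ with member (D k) (m p) in e
        ... | true  = trans (inner S′ k p∈ (member⁻ (D k) e)) (sym (clash-N (label Q p)))
        ... | false = cong₂ clash (label-new p∈) (lab-replace-∉ S k new λ mp∈ → contra (trans (sym e) (member⁺ mp∈)))
          where
          contra : false ≢ true
          contra ()
        uq : Unique (vertices Q)
        uq = unique-↭ (proj₁ (Cheap.moved C)) (unique k)
        ℓ : Fin n → Label
        ℓ = outer S k
        total-cost : listSum (arc S′) (D k) ≡ window-cost (forward Q) (ℓ (w Q)) (ℓ (u Q)) (ℓ (v Q)) (ℓ (x Q))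
        total-cost = trans (listSum-cong arc-new) (trans (listSum-↭ _ (proj₁ (Cheap.moved C))) window-total)
          where
          g : Fin n → ℕ
          g p = clash (label Q p) (ℓ p)
          window-total : listSum g (vertices Q) ≡ window-cost (forward Q) (ℓ (w Q)) (ℓ (u Q)) (ℓ (v Q)) (ℓ (x Q))
          window-total with uq
          ... | (wu ∷ wv ∷ wx ∷ wr) ∷ (uv ∷ ux ∷ ur) ∷ (vx ∷ vr) ∷ xr ∷ _ =
            cong₂ _+_ (cong (λ l → clash l (ℓ (w Q))) lw)
              (cong₂ _+_ (cong (λ l → clash l (ℓ (u Q))) lu)
                (cong₂ _+_ (cong (λ l → clash l (ℓ (v Q))) lv)
                  (trans (cong₂ _+_ (cong (λ l → clash l (ℓ (x Q))) lx) (listSum-zero rest-zero)) (+-identityʳ _))))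
            where
            lw : label Q (w Q) ≡ first (forward Q)
            lw with label Q (w Q) | labelView Q (w Q)
            ... | _ | front _ = refl
            ... | _ | back (inj₁ e) = ⊥-elim (wv e)
            ... | _ | back (inj₂ e) = ⊥-elim (wx e)
            ... | _ | off a _ _ _ = ⊥-elim (a refl)
            lu : label Q (u Q) ≡ first (forward Q)
            lu with label Q (u Q) | labelView Q (u Q)
            ... | _ | front _ = refl
            ... | _ | back (inj₁ e) = ⊥-elim (uv e)
            ... | _ | back (inj₂ e) = ⊥-elim (ux e)
            ... | _ | off _ a _ _ = ⊥-elim (a refl)
            lv : label Q (v Q) ≡ second (forward Q)
            lv with label Q (v Q) | labelView Q (v Q)
            ... | _ | front (inj₁ e) = ⊥-elim (wv (sym e))
            ... | _ | front (inj₂ e) = ⊥-elim (uv (sym e))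
            ... | _ | back _ = refl
            ... | _ | off _ _ a _ = ⊥-elim (a refl)
            lx : label Q (x Q) ≡ second (forward Q)
            lx with label Q (x Q) | labelView Q (x Q)
            ... | _ | front (inj₁ e) = ⊥-elim (wx (sym e))
            ... | _ | front (inj₂ e) = ⊥-elim (ux (sym e))
            ... | _ | back _ = refl
            ... | _ | off _ _ _ a = ⊥-elim (a refl)
            at : ∀ {p q ys} → All (q ≢_) ys → p ∈ ys → p ≢ q
            at (h ∷ _) (here refl) refl = h refl
            at (_ ∷ a) (there p∈)  e = at a p∈ e
            rest-zero : ∀ {p} → p ∈ rest Q → g p ≡ 0
            rest-zero {p} p∈ with label Q p | labelView Q p
            ... | _ | front (inj₁ e) = ⊥-elim (at wr p∈ e)
            ... | _ | front (inj₂ e) = ⊥-elim (at ur p∈ e)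
            ... | _ | back (inj₁ e) = ⊥-elim (at vr p∈ e)
            ... | _ | back (inj₂ e) = ⊥-elim (at xr p∈ e)
            ... | _ | off _ _ _ _ = refl

      Out In : State → Fin K → Fin n → Set
      Out S k p = p ∈ D k × lab S p ≡ O × lab S (m p) ≡ I
      In  S k p = p ∈ D k × lab S p ≡ I × lab S (m p) ≡ O

      Pure : State → Set
      Pure S = ∀ {k p q} → Out S k p → ¬ In S k q

      module _ (house : ∀ k → NotHouse (D k)) where

        chord-in? : ∀ k → Dec (∃ λ a → a ∈ D k × Chord (D k) a)
        chord-in? k = any? λ a → _∈?_ _≟_ a (D k) ×-dec chord? (D k) a

        re-place : ∀ S {k p q} → Out S k p → In S k q → Cheap (outer S k) (D k)
        re-place S {k} {p} {q} (p∈ , lp , lmp) (q∈ , lq , lmq) = search (chord-in? k)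
          where
          leaves : ∀ {r a b} → r ∈ D k → lab S r ≡ a → lab S (m r) ≡ b → clash a b ≡ 1 → m r ∉ D k
          leaves r∈ refl refl one mr∈ with () ← trans (sym one) (inner S k r∈ mr∈)
          outside : ∀ {r} → m r ∉ D k → outer S k r ≡ lab S (m r)
          outside {r} mr∉ rewrite member⁻ᶠ (D k) (m r) mr∉ = refl
          mp∉ : m p ∉ D k
          mp∉ = leaves p∈ lp lmp refl
          mq∉ : m q ∉ D k
          mq∉ = leaves q∈ lq lmq refl
          chord-neutral : ∀ {r} → r ∈ D k → Chord (D k) r → outer S k r ≡ N
          chord-neutral {r} _ (mr∈ , _) rewrite member⁺ mr∈ = refl
          search : Dec (∃ λ a → a ∈ D k × Chord (D k) a) → Cheap (outer S k) (D k)
          search (yes (a , a∈ , ch)) = with-chord (outer S k) (unique k) (long k) (house k) chord-neutral a∈ ch p∈ (mp∉ ∘ proj₁)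
          search (no none) = without-chord (outer S k) (unique k) (long k) (odd k) (λ r∈ ch → none (_ , r∈ , ch))
                               p∈ (trans (outside mp∉) lmp) q∈ (trans (outside mq∉) lmq)

        impure? : ∀ S → Dec (∃ λ k → ∃₂ λ p q → Out S k p × In S k q)
        impure? S = any? λ k → any? λ p → any? λ q →
          (_∈?_ _≟_ p (D k) ×-dec label≟ (lab S p) O ×-dec label≟ (lab S (m p)) I) ×-dec
          (_∈?_ _≟_ q (D k) ×-dec label≟ (lab S q) I ×-dec label≟ (lab S (m q)) O)

        purify : ∀ b S → energy S ≤ b → Σ State Pure
        purify b S le with impure? S
        ... | no none = S , λ o i → none (_ , _ , _ , o , i)
        ... | yes (k , p , q , o , i) = descend b le
          where
          C : Cheap (outer S k) (D k)
          C = re-place S o i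
          new : Placed k
          new = record { P = Cheap.P C ; moved = Cheap.moved C ; separated = Cheap.separated C }
          p≢q : p ≢ q
          p≢q refl with () ← trans (sym (proj₁ (proj₂ o))) (proj₁ (proj₂ i))
          before : 2 ≤ listSum (arc S) (D k)
          before = two≤listSum (arc S) (proj₁ o) (proj₁ i) p≢q
            (≤-reflexive (sym (cong₂ clash (proj₁ (proj₂ o)) (proj₂ (proj₂ o)))))
            (≤-reflexive (sym (cong₂ clash (proj₁ (proj₂ i)) (proj₂ (proj₂ i)))))
          lower : energy (replace S k new) < energy S
          lower = improves k S new (≤-trans (s≤s (placed-cost S k C)) before)
          descend : ∀ b → energy S ≤ b → Σ State Pure
          descend zero    le with () ← ≤-trans lower le
          descend (suc b) le = purify b (replace S k new) (≤-pred (≤-trans lower le))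

        -- Otherwise `m` would pair up the vertices of an odd cycle.
        not-all-chords : ∀ k → ¬ (∀ {p} → p ∈ D k → Chord (D k) p)
        not-all-chords k all = odd-double (sum half) (subst Odd count (odd k))
          where
          c : List (Fin n)
          c = D k
          up half : Fin n → ℕ
          up   p = if toℕ p <ᵇ toℕ (m p) then 1 else 0
          -- Each pair is counted at its smaller end.
          half p = if member c p then up p else 0
          member-m : ∀ p → member c (m p) ≡ member c p
          member-m p with member c p in e₁ | member c (m p) in e₂
          ... | true  | true  = refl
          ... | false | false = refl
          ... | true  | false with () ← trans (sym e₂) (member⁺ (proj₁ (all (member⁻ c e₁))))
          ... | false | true  with () ← trans (sym e₁) (member⁺ (subst (_∈ c) (m-invol p) (proj₁ (all (member⁻ c e₂)))))
          either : ∀ p → (if member c p then 1 else 0) ≡ half p + half (m p)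
          either p rewrite member-m p | m-invol p with member c p in e
          ... | false = refl
          ... | true  = sym (trichotomy (toℕ p) (toℕ (m p)) λ eq → proj₂ (all (member⁻ c e)) (sym (toℕ-injective eq)))
            where
            trichotomy : ∀ a b → a ≢ b → (if a <ᵇ b then 1 else 0) + (if b <ᵇ a then 1 else 0) ≡ 1
            trichotomy zero    zero    h = ⊥-elim (h refl)
            trichotomy zero    (suc b) h = refl
            trichotomy (suc a) zero    h = refl
            trichotomy (suc a) (suc b) h = trichotomy a b (h ∘ cong suc)
          count : length c ≡ sum half + sum half
          count = trans (sym (listSum-one c)) (trans (sym (sum-member (λ _ → 1) c (unique k)))
            (trans (sum-cong-≗ either) (trans (∑-distrib-+ half (half ∘ m)) (cong (sum half +_) (sym (sum-permute half π))))))

        initial : State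
        initial k with chord-in? k
        ... | no none = first-window (D k) refl
          where
          first-window : ∀ c → D k ≡ c → Placed k
          first-window (w ∷ u ∷ v ∷ x ∷ rest) eq with subst Unique eq (unique k)
          ... | (wu ∷ wv ∷ wx ∷ _) ∷ (uv ∷ ux ∷ _) ∷ _ = record
            { P = place w u v x rest true
            ; moved = subst (_~ w ∷ u ∷ v ∷ x ∷ rest) (sym eq) (↭-refl , ≈-refl)
            ; separated = away 0∈ 2∈ wv , away 0∈ 3∈ wx , away 1∈ 2∈ uv , away 1∈ 3∈ ux }
            where
            c : List (Fin n)
            c = w ∷ u ∷ v ∷ x ∷ rest
            0∈ : w ∈ c
            0∈ = here refl
            1∈ : u ∈ c
            1∈ = there (here refl)
            2∈ : v ∈ c
            2∈ = there (there (here refl))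
            3∈ : x ∈ c
            3∈ = there (there (there (here refl)))
            away : ∀ {p q} → p ∈ c → q ∈ c → p ≢ q → m p ≢ q
            away p∈ q∈ p≢q refl = none (_ , subst (_ ∈_) (sym eq) p∈ , subst (_ ∈_) (sym eq) q∈ , ≢-sym p≢q)
          first-window [] eq with () ← subst (λ c → 5 ≤ length c) eq (long k)
          first-window (_ ∷ []) eq with subst (λ c → 5 ≤ length c) eq (long k)
          ... | s≤s ()
          first-window (_ ∷ _ ∷ []) eq with subst (λ c → 5 ≤ length c) eq (long k)
          ... | s≤s (s≤s ())
          first-window (_ ∷ _ ∷ _ ∷ []) eq with subst (λ c → 5 ≤ length c) eq (long k)
          ... | s≤s (s≤s (s≤s ()))
        ... | yes (a , a∈ , ch) with any? (λ b → _∈?_ _≟_ b (D k) ×-dec ¬? (chord? (D k) b))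
        ...   | no none = ⊥-elim (not-all-chords k λ {p} p∈ → decidable-stable (chord? (D k) p) λ ¬ch → none (p , p∈ , ¬ch))
        ...   | yes (b , b∈ , ¬ch) = record { P = Cheap.P C ; moved = Cheap.moved C ; separated = Cheap.separated C }
          where
          -- With all labels neutral the cost is no restriction; only separation is wanted.
          C : Cheap (λ _ → N) (D k)
          C = with-chord (λ _ → N) (unique k) (long k) (house k) (λ _ _ → refl) a∈ ch b∈ ¬ch

        pure-state : Σ State Pure
        pure-state = purify (energy initial) initial ≤-refl

  -- The colouring

  data Class : Set where
    matched one three zero′ : Class

  Level : Set
  Level = Fin 3

  _⊔_ _⊓_ : Level → Level → Level
  zero     ⊔ b        = b
  suc a    ⊔ zero     = suc a
  suc zero ⊔ suc b    = suc b
  suc (suc a) ⊔ suc b = suc (suc a)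
  zero     ⊓ b        = zero
  suc a    ⊓ zero     = zero
  suc zero ⊓ suc b    = suc zero
  suc (suc a) ⊓ suc b = suc b

  ⊔-comm : ∀ a b → a ⊔ b ≡ b ⊔ a
  ⊔-comm zero zero = refl
  ⊔-comm zero (suc b) = refl
  ⊔-comm (suc a) zero = refl
  ⊔-comm (suc zero) (suc zero) = refl
  ⊔-comm (suc zero) (suc (suc b)) = refl
  ⊔-comm (suc (suc a)) (suc zero) = refl
  ⊔-comm (suc (suc zero)) (suc (suc zero)) = refl

  ⊓-comm : ∀ a b → a ⊓ b ≡ b ⊓ a
  ⊓-comm zero zero = refl
  ⊓-comm zero (suc b) = refl
  ⊓-comm (suc a) zero = refl
  ⊓-comm (suc zero) (suc zero) = refl
  ⊓-comm (suc zero) (suc (suc b)) = refl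
  ⊓-comm (suc (suc a)) (suc zero) = refl
  ⊓-comm (suc (suc zero)) (suc (suc zero)) = refl

  record Compatible (c d : Fin 11) : Set where
    constructor compatible
    field
      bounds : 3 ≤ ∣ toℕ c - toℕ d ∣ × ∣ toℕ c - toℕ d ∣ ≤ 8
  open Compatible

  compatible? : ∀ c d → Dec (Compatible c d)
  compatible? c d = map′ compatible bounds (3 ≤? ∣ toℕ c - toℕ d ∣ ×-dec ∣ toℕ c - toℕ d ∣ ≤? 8)

  compatible-sym : ∀ {c d} → Compatible c d → Compatible d c
  compatible-sym {c} {d} (compatible b) = compatible (subst (λ k → 3 ≤ k × k ≤ 8) (∣-∣-comm (toℕ c) (toℕ d)) b)

  -- The residue 3c + s modulo 11, where c = 0, 1, 2, 3 for zero′, one, matched, three and s is the level.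
  tint : Class → Level → Fin 11
  tint zero′   zero             = # 0
  tint zero′   (suc zero)       = # 1
  tint zero′   (suc (suc zero)) = # 2
  tint one     zero             = # 3
  tint one     (suc zero)       = # 4
  tint one     (suc (suc zero)) = # 5
  tint matched zero             = # 6
  tint matched (suc zero)       = # 7
  tint matched (suc (suc zero)) = # 8
  tint three   zero             = # 9
  tint three   (suc zero)       = # 10
  tint three   (suc (suc zero)) = # 0

  -- The level of an edge comes from levels at its ends. In class 1 it is the minimum, so that it
  -- does not exceed the level of an adjacent matched edge; elsewhere it is the maximum, which for
  -- class 2 bounds the levels at both ends and for class 0 picks the one end with a positive level.
  shade : Class → Level → Level → Fin 11
  shade one a b = tint one (a ⊓ b)
  shade τ   a b = tint τ (a ⊔ b)

  shade-comm : ∀ τ a b → shade τ a b ≡ shade τ b a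
  shade-comm matched a b = cong (tint matched) (⊔-comm a b)
  shade-comm one     a b = cong (tint one) (⊓-comm a b)
  shade-comm three   a b = cong (tint three) (⊔-comm a b)
  shade-comm zero′   a b = cong (tint zero′) (⊔-comm a b)

  matched-one : ∀ a b c → Compatible (shade matched a b) (shade one a c)
  matched-one = toWitness {a? = all? λ a → all? λ b → all? λ c → compatible? (shade matched a b) (shade one a c)} _

  matched-three : ∀ a b c → Compatible (shade matched a b) (shade three (a ⊔ b) c)
  matched-three = toWitness {a? = all? λ a → all? λ b → all? λ c → compatible? (shade matched a b) (shade three (a ⊔ b) c)} _

  matched-zero : ∀ a b c → Compatible (shade matched a b) (shade zero′ a c)
  matched-zero = toWitness {a? = all? λ a → all? λ b → all? λ c → compatible? (shade matched a b) (shade zero′ a c)} _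

  one-three : ∀ a b c d → Compatible (shade one a b) (shade three c d)
  one-three = toWitness {a? = all? λ a → all? λ b → all? λ c → all? λ d → compatible? (shade one a b) (shade three c d)} _

  one-zero : ∀ a → Compatible (shade one a a) (shade zero′ a zero)
  one-zero = toWitness {a? = all? λ a → compatible? (shade one a a) (shade zero′ a zero)} _

  three-zero : ∀ a b c → toℕ a < toℕ c → toℕ b < toℕ c → Compatible (shade three a b) (shade zero′ c zero)
  three-zero = toWitness {a? = all? λ a → all? λ b → all? λ c → (toℕ a <? toℕ c) →-dec (toℕ b <? toℕ c) →-dec
                                   compatible? (shade three a b) (shade zero′ c zero)} _

  -- Unions over the odd cycles, partners and classes on one odd cycle

  module _ {n : ℕ} where

    open Placement

    ⋃ : ∀ K → (Fin K → List (Edge n)) → List (Edge n)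
    ⋃ zero    f = []
    ⋃ (suc K) f = f zero ++ ⋃ K (f ∘ suc)

    concatMap-⋃ : ∀ (f : List (Fin n) → List (Edge n)) D → concatMap f D ≡ ⋃ (length D) (f ∘ lookup D)
    concatMap-⋃ f []      = refl
    concatMap-⋃ f (c ∷ D) = cong (f c ++_) (concatMap-⋃ f D)

    ⋃-≈ : ∀ K {f g : Fin K → List (Edge n)} → (∀ k → f k ≈ g k) → ⋃ K f ≈ ⋃ K g
    ⋃-≈ zero    h = ≈-refl
    ⋃-≈ (suc K) h = ≈-++ (h zero) (⋃-≈ K (h ∘ suc))

    ⋃-++ : ∀ K (f g : Fin K → List (Edge n)) → ⋃ K (λ k → f k ++ g k) ≈ ⋃ K f ++ ⋃ K g
    ⋃-++ zero    f g = ≈-refl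
    ⋃-++ (suc K) f g = ≈-trans (≈-++ˡ (f zero ++ g zero) (⋃-++ K (f ∘ suc) (g ∘ suc)))
                               (≈-interchange (f zero) (g zero) _ _)

    Adj-⋃⁻ : ∀ K {f : Fin K → List (Edge n)} {x y} → Adj x y (⋃ K f) → ∃ λ k → Adj x y (f k)
    Adj-⋃⁻ (suc K) {f} a with Adj-++⁻ (f zero) a
    ... | inj₁ b = zero , b
    ... | inj₂ b with Adj-⋃⁻ K b
    ...   | k , d = suc k , d

    Adj-⋃⁺ : ∀ K {f : Fin K → List (Edge n)} {x y} k → Adj x y (f k) → Adj x y (⋃ K f)
    Adj-⋃⁺ (suc K)     zero    a = Adj-++ˡ a
    Adj-⋃⁺ (suc K) {f} (suc k) a = Adj-++ʳ (f zero) (Adj-⋃⁺ K k a)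

    deg-⋃-none : ∀ K {f : Fin K → List (Edge n)} {p} → (∀ k → deg p (f k) ≡ 0) → deg p (⋃ K f) ≡ 0
    deg-⋃-none zero    h = refl
    deg-⋃-none (suc K) {f} {p} h = trans (deg-++ p (f zero) _) (cong₂ _+_ (h zero) (deg-⋃-none K (h ∘ suc)))

    deg-⋃-one : ∀ K {f : Fin K → List (Edge n)} {p} k → (∀ j → j ≢ k → deg p (f j) ≡ 0) → deg p (⋃ K f) ≡ deg p (f k)
    deg-⋃-one (suc K) {f} {p} zero h =
      trans (deg-++ p (f zero) _) (trans (cong (deg p (f zero) +_) (deg-⋃-none K λ k → h (suc k) λ ())) (+-identityʳ _))
    deg-⋃-one (suc K) {f} {p} (suc k) h =
      trans (deg-++ p (f zero) _) (cong₂ _+_ (h zero λ ()) (deg-⋃-one K k λ j j≢k → h (suc j) λ { refl → j≢k refl }))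

    deg-⋃-≤ : ∀ K {f : Fin K → List (Edge n)} p k → deg p (f k) ≤ deg p (⋃ K f)
    deg-⋃-≤ (suc K) {f} p zero    = subst (deg p (f zero) ≤_) (sym (deg-++ p (f zero) _)) (m≤m+n _ _)
    deg-⋃-≤ (suc K) {f} p (suc k) =
      ≤-trans (deg-⋃-≤ K p k) (subst (deg p (⋃ K (f ∘ suc)) ≤_) (sym (deg-++ p (f zero) _)) (m≤n+m _ _))

    two-in-⋃ : ∀ K {f : Fin K → List (Edge n)} p {j k} → j ≢ k → 2 ≤ deg p (f j) → 2 ≤ deg p (f k) → 4 ≤ deg p (⋃ K f)
    two-in-⋃ (suc K) p {zero} {zero} j≢k _ _ = ⊥-elim (j≢k refl)
    two-in-⋃ (suc K) {f} p {zero} {suc k} _ a b rewrite deg-++ p (f zero) (⋃ K (f ∘ suc)) = +-mono-≤ a (≤-trans b (deg-⋃-≤ K p k))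
    two-in-⋃ (suc K) {f} p {suc j} {zero} _ a b rewrite deg-++ p (f zero) (⋃ K (f ∘ suc)) = +-mono-≤ b (≤-trans a (deg-⋃-≤ K p j))
    two-in-⋃ (suc K) {f} p {suc j} {suc k} j≢k a b rewrite deg-++ p (f zero) (⋃ K (f ∘ suc)) =
      ≤-trans (two-in-⋃ K p (λ { refl → j≢k refl }) a b) (m≤n+m _ _)

    -- An unmatched vertex is its own partner. This makes the map an involution and yields neither a
    -- chord nor an arc.
    partner : List (Edge n) → Fin n → Fin n
    partner []            p = p
    partner ((x , y) ∷ M) p = if does (p ≟ x) then y else if does (p ≟ y) then x else partner M p

    partner-fresh : ∀ M {p} → deg p M ≡ 0 → partner M p ≡ p
    partner-fresh []            eq = refl
    partner-fresh ((x , y) ∷ M) {p} eq with fresh-∷ {L = M} eq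
    ... | p≢x , p≢y , eq′ with p ≟ x | p ≟ y
    ...   | yes e | _     = ⊥-elim (p≢x e)
    ...   | no _  | yes e = ⊥-elim (p≢y e)
    ...   | no _  | no _  = partner-fresh M eq′

    Adj-partner : ∀ {M p q} → Loopless M → (∀ r → deg r M ≤ 1) → Adj p q M → partner M p ≡ q
    Adj-partner {(x , y) ∷ M} {p} {q} (x≢y ∷ ll) d a with p ≟ x | p ≟ y | Adj-∷⁻ a
    ... | yes refl | yes refl | _ = ⊥-elim (x≢y refl)
    ... | yes refl | no _     | inj₁ (_ , e) = sym e
    ... | yes refl | no p≢y   | inj₂ (inj₁ (e , _)) = ⊥-elim (p≢y e)
    ... | yes refl | no _     | inj₂ (inj₂ b) = ⊥-elim (Adj⇒deg b (n≤0⇒n≡0 (≤-pred (≤-trans (+-mono-≤ (1≤inc-fst x y) ≤-refl) (d x)))))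
    ... | no p≢x   | yes refl | inj₁ (e , _) = ⊥-elim (p≢x e)
    ... | no _     | yes refl | inj₂ (inj₁ (_ , e)) = sym e
    ... | no _     | yes refl | inj₂ (inj₂ b) = ⊥-elim (Adj⇒deg b (n≤0⇒n≡0 (≤-pred (≤-trans (+-mono-≤ (1≤inc-snd y x) ≤-refl) (d y)))))
    ... | no p≢x   | no _     | inj₁ (e , _) = ⊥-elim (p≢x e)
    ... | no _     | no p≢y   | inj₂ (inj₁ (e , _)) = ⊥-elim (p≢y e)
    ... | no _     | no _     | inj₂ (inj₂ b) = Adj-partner ll (λ r → ≤-trans (m≤n+m _ (inc r (x , y))) (d r)) b

    partner-Adj : ∀ M p → partner M p ≡ p ⊎ Adj p (partner M p) M
    partner-Adj []            p = inj₁ refl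
    partner-Adj ((x , y) ∷ M) p with p ≟ x | p ≟ y
    ... | yes refl | _        = inj₂ here
    ... | no _     | yes refl = inj₂ here˘
    ... | no _     | no _     with partner-Adj M p
    ...   | inj₁ e = inj₁ e
    ...   | inj₂ a = inj₂ (there a)

    partner-invol : ∀ {M} → Loopless M → (∀ r → deg r M ≤ 1) → ∀ p → partner M (partner M p) ≡ p
    partner-invol {M} ll d p with partner-Adj M p
    ... | inj₁ e = trans (cong (partner M) e) e
    ... | inj₂ a = Adj-partner ll d (Adj-sym a)

    -- Removing the edge u v from a placed odd cycle leaves a path from v to u with edges alternating between two classes.
    module _ (P : Placement {n}) where
      spine : List (Fin n)
      spine = x P ∷ rest P ++ w P ∷ u P ∷ []

      -- On an odd cycle the path has an even number of edges, so `v x` lies in the even and `w u`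
      -- in the odd part; `forward` decides which part becomes class 1.
      evenPart oddPart cls₀ cls₁ cls₃ : List (Edge n)
      evenPart = evens (v P) spine
      oddPart  = odds (v P) spine
      cls₀     = (u P , v P) ∷ []
      cls₁     = if forward P then oddPart else evenPart
      cls₃     = if forward P then evenPart else oddPart

      spine-turn : vertices P ↭ v P ∷ spine
      spine-turn = ++-comm (w P ∷ u P ∷ []) (v P ∷ x P ∷ rest P)

      placed-split : cycle (vertices P) ≈ cls₁ ++ cls₃ ++ cls₀
      placed-split = ≈-trans (cycle-rotate (w P ∷ u P ∷ []) (v P ∷ x P ∷ rest P)) (subst (_≈ cls₁ ++ cls₃ ++ cls₀) (sym unroll) parts)
        where
        unroll : cycle (v P ∷ spine) ≡ path (v P) spine ++ cls₀
        unroll = trans (cong (path (v P)) (trans (++-assoc (x P ∷ rest P) (w P ∷ u P ∷ []) (v P ∷ [])) (sym (++-assoc (x P ∷ rest P) (w P ∷ []) (u P ∷ v P ∷ [])))))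
          (trans (path-++ (v P) (x P ∷ rest P ++ w P ∷ []) (u P) (v P ∷ []))
            (cong (λ t → path (v P) t ++ cls₀) (++-assoc (x P ∷ rest P) (w P ∷ []) (u P ∷ []))))
        parts : path (v P) spine ++ cls₀ ≈ cls₁ ++ cls₃ ++ cls₀
        parts with forward P
        ... | true  = subst (path (v P) spine ++ cls₀ ≈_) (++-assoc oddPart evenPart cls₀)
                        (≈-++ (≈-trans (path-split (v P) spine) (≈-++-comm evenPart oddPart)) ≈-refl)
        ... | false = subst (path (v P) spine ++ cls₀ ≈_) (++-assoc evenPart oddPart cls₀) (≈-++ (path-split (v P) spine) ≈-refl)

      module _ (uq : Unique (vertices P)) where
        private
          uq′ : Unique (v P ∷ spine)
          uq′ = unique-↭ spine-turn uq

        deg-cls₁ : ∀ p → deg p cls₁ ≤ 1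
        deg-cls₁ p with forward P
        ... | true  = deg-odds≤1 p (v P) spine uq′
        ... | false = deg-evens≤1 p (v P) spine uq′

        deg-cls₃ : ∀ p → deg p cls₃ ≤ 1
        deg-cls₃ p with forward P
        ... | true  = deg-evens≤1 p (v P) spine uq′
        ... | false = deg-odds≤1 p (v P) spine uq′

      deg-cls₁-∉ : ∀ {p} → p ∉ vertices P → deg p cls₁ ≡ 0
      deg-cls₁-∉ p∉ with forward P
      ... | true  = deg-odds-∉ (v P) spine (p∉ ∘ ∈-resp-↭ (↭-sym spine-turn))
      ... | false = deg-evens-∉ (v P) spine (p∉ ∘ ∈-resp-↭ (↭-sym spine-turn))

      deg-cls₃-∉ : ∀ {p} → p ∉ vertices P → deg p cls₃ ≡ 0
      deg-cls₃-∉ p∉ with forward P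
      ... | true  = deg-evens-∉ (v P) spine (p∉ ∘ ∈-resp-↭ (↭-sym spine-turn))
      ... | false = deg-odds-∉ (v P) spine (p∉ ∘ ∈-resp-↭ (↭-sym spine-turn))

      deg-cls₀-∉ : ∀ {p} → p ∉ vertices P → deg p cls₀ ≡ 0
      deg-cls₀-∉ {p} p∉ rewrite δ-≢ {p = p} {u P} (λ e → p∉ (there (here e))) | δ-≢ {p = p} {v P} (λ e → p∉ (there (there (here e)))) = refl

      last-odd : ∀ y zs → Odd (length zs) → Adj (w P) (u P) (evens y (zs ++ w P ∷ u P ∷ []))
      last-odd y (z ∷ []) o                      = there here
      last-odd y (z ∷ z′ ∷ zs) (odd-s (even-s o)) = there (last-odd z′ zs o)

      -- The exceptional edge meets class 1 at `outer-end` and class 3 at `inner-end`; arcs leave on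
      -- the outer side and enter on the inner one.
      outer-end inner-end : Fin n
      outer-end = if forward P then u P else v P
      inner-end = if forward P then v P else u P
      outer-next inner-next : Fin n
      outer-next = if forward P then w P else x P
      inner-next = if forward P then x P else w P

      outer-edge : Odd (length (rest P)) → Adj outer-end outer-next cls₁
      outer-edge o with forward P
      ... | true  = Adj-sym (last-odd (x P) (rest P) o)
      ... | false = here

      inner-edge : Odd (length (rest P)) → Adj inner-end inner-next cls₃
      inner-edge o with forward P
      ... | true  = here
      ... | false = Adj-sym (last-odd (x P) (rest P) o)

      zero-ends : ∀ {p q} → Adj p q cls₀ → (p ≡ outer-end × q ≡ inner-end) ⊎ (p ≡ inner-end × q ≡ outer-end)
      zero-ends a with forward P | Adj-∷⁻ a
      ... | true  | inj₁ e        = inj₁ e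
      ... | true  | inj₂ (inj₁ e) = inj₂ e
      ... | false | inj₁ e        = inj₂ e
      ... | false | inj₂ (inj₁ e) = inj₁ e

      label-front : ∀ {p} → p ≡ w P ⊎ p ≡ u P → label P p ≡ first (forward P)
      label-front {p} e with p ≟ w P | p ≟ u P
      ... | yes _ | _     = refl
      ... | no _  | yes _ = refl
      ... | no a  | no b  = ⊥-elim ([ a , b ] e)

      label-back : Unique (vertices P) → ∀ {p} → p ≡ v P ⊎ p ≡ x P → label P p ≡ second (forward P)
      label-back ((wu ∷ wv ∷ wx ∷ _) ∷ (uv ∷ ux ∷ _) ∷ _) {p} e with p ≟ w P | p ≟ u P
      ... | yes refl | _        = ⊥-elim ([ wv , wx ] e)
      ... | no _     | yes refl = ⊥-elim ([ uv , ux ] e)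
      ... | no _     | no _ with p ≟ v P | p ≟ x P
      ...   | yes _ | _     = refl
      ...   | no _  | yes _ = refl
      ...   | no a  | no b  = ⊥-elim ([ a , b ] e)

      module _ (uq : Unique (vertices P)) where
        label-outer-end : label P outer-end ≡ O
        label-outer-end = go (forward P) refl
          where
          go : ∀ d → forward P ≡ d → label P (if d then u P else v P) ≡ O
          go true  e = trans (label-front (inj₂ refl)) (cong first e)
          go false e = trans (label-back uq (inj₁ refl)) (cong second e)
        label-outer-next : label P outer-next ≡ O
        label-outer-next = go (forward P) refl
          where
          go : ∀ d → forward P ≡ d → label P (if d then w P else x P) ≡ O
          go true  e = trans (label-front (inj₁ refl)) (cong first e)
          go false e = trans (label-back uq (inj₂ refl)) (cong second e)
        label-inner-end : label P inner-end ≡ I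
        label-inner-end = go (forward P) refl
          where
          go : ∀ d → forward P ≡ d → label P (if d then v P else u P) ≡ I
          go true  e = trans (label-back uq (inj₁ refl)) (cong second e)
          go false e = trans (label-front (inj₂ refl)) (cong first e)
        label-inner-next : label P inner-next ≡ I
        label-inner-next = go (forward P) refl
          where
          go : ∀ d → forward P ≡ d → label P (if d then x P else w P) ≡ I
          go true  e = trans (label-back uq (inj₂ refl)) (cong second e)
          go false e = trans (label-front (inj₁ refl)) (cong first e)

      ends-∈ : (outer-end ∈ vertices P × outer-next ∈ vertices P) × (inner-end ∈ vertices P × inner-next ∈ vertices P)
      ends-∈ with forward P
      ... | true  = (there (here refl) , here refl) , (there (there (here refl)) , there (there (there (here refl))))
      ... | false = (there (there (here refl)) , there (there (there (here refl)))) , (there (here refl) , here refl)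

  module _ {n : ℕ} where

    open Placement

    -- Levels are attached to vertices, separately for each class, because the class 3 edges at a
    -- vertex take over the level of the matched edge there.
    record Scheme (L : List (Edge n)) : Set where
      field
        T      : Class → List (Edge n)
        splits : L ≈ T matched ++ T one ++ T three ++ T zero′
        deg≤1  : ∀ τ p → deg p (T τ) ≤ 1
        hue    : Class → Fin n → Level

      colour : Class → Fin n → Fin n → Fin 11
      colour τ p q = shade τ (hue τ p) (hue τ q)

      field
        proper : ∀ {τ σ p q r} → τ ≢ σ → Adj p q (T τ) → Adj p r (T σ) → Compatible (colour τ p q) (colour σ p r)

    unique-neighbour : ∀ {T : List (Edge n)} {p q r} → deg p T ≤ 1 → p ≢ q → p ≢ r → Adj p q T → Adj p r T → q ≡ r
    unique-neighbour {T} {p} {q} {r} d p≢q p≢r a b with q ≟ r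
    ... | yes e = e
    ... | no q≢r with deg p T | d | two-neighbours a b q≢r p≢q p≢r
    ...   | 0 | _ | z , _ = ⊥-elim (z refl)
    ...   | 1 | _ | _ , o = ⊥-elim (o refl)
    ...   | suc (suc _) | s≤s () | _

    module Assemble {L M F : List (Edge n)} (r : L ≈ M ++ F) (ll : Loopless L) (dM : ∀ p → deg p M ≤ 1)
                    (dN : DegreeTwo F) (trail : Trails F) where

      open Trails trail using (T₁; T₃; deg₁; deg₃) renaming (D to Ds; splits to split-N; unique to uniques; odd to odds′)

      K : ℕ
      K = length Ds

      D : Fin K → List (Fin n)
      D = lookup Ds

      llM : Loopless M
      llM = go M (loopless-≈ r ll)
        where
        go : ∀ M → Loopless (M ++ F) → Loopless M
        go []      _        = []
        go (e ∷ M) (a ∷ ll) = a ∷ go M ll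

      m : Fin n → Fin n
      m = partner M

      m-invol : ∀ p → m (m p) ≡ p
      m-invol = partner-invol llM dM

      unique : ∀ k → Unique (D k)
      unique k = All.lookup uniques (∈-lookup k)

      odd : ∀ k → Odd (length (D k))
      odd k = All.lookup odds′ (∈-lookup k)

      split′ : F ≈ T₁ ++ T₃ ++ ⋃ K (cycle ∘ D)
      split′ = subst (λ C → F ≈ T₁ ++ T₃ ++ C) (concatMap-⋃ cycle Ds) split-N

      degree-sum : ∀ p → deg p T₁ + (deg p T₃ + deg p (⋃ K (cycle ∘ D))) ≤ 2
      degree-sum p = subst (_≤ 2) (trans (deg-≈ p split′) (trans (deg-++ p T₁ _) (cong (deg p T₁ +_) (deg-++ p T₃ _)))) (dN p)

      -- A vertex on two cycles would have degree four in `F`.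
      disjoint : ∀ {j k p} → p ∈ D j → p ∈ D k → j ≡ k
      disjoint {j} {k} {p} p∈j p∈k with j ≟ k
      ... | yes e = e
      ... | no j≢k with ≤-trans (two-in-⋃ K p j≢k (two j p∈j) (two k p∈k)) (≤-trans (m≤n+m _ (deg p T₃)) (≤-trans (m≤n+m _ (deg p T₁)) (degree-sum p)))
        where
        two : ∀ k → p ∈ D k → 2 ≤ deg p (cycle (D k))
        two k p∈ = ≤-reflexive (sym (deg-cycle-∈ (D k) (unique k) p∈))
      ...   | s≤s (s≤s ())

      module _ (long : ∀ k → 5 ≤ length (D k)) where

        open Energy m m-invol D unique odd long disjoint

        module _ (S : State) (pure : Pure S) where

          Q : Fin K → Placement {n}
          Q k = Placed.P (S k)

          moved : ∀ k → D k ~ vertices (Q k)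
          moved k = Placed.moved (S k)

          uq : ∀ k → Unique (vertices (Q k))
          uq k = unique-↭ (proj₁ (moved k)) (unique k)

          from-Q : ∀ {k p} → p ∈ vertices (Q k) → p ∈ D k
          from-Q {k} = ∈-resp-↭ (↭-sym (proj₁ (moved k)))

          rest-odd : ∀ k → Odd (length (rest (Q k)))
          rest-odd k with subst Odd (↭-length (proj₁ (moved k))) (odd k)
          ... | odd-s (even-s (odd-s (even-s o))) = o

          C₁ C₃ C₀ : Fin K → List (Edge n)
          C₁ k = cls₁ (Q k)
          C₃ k = cls₃ (Q k)
          C₀ k = cls₀ (Q k)

          T : Class → List (Edge n)
          T matched = M
          T one     = T₁ ++ ⋃ K C₁
          T three   = T₃ ++ ⋃ K C₃
          T zero′   = ⋃ K C₀

          splits-T : L ≈ T matched ++ T one ++ T three ++ T zero′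
          splits-T = ≈-trans r (≈-++ˡ M (≈-trans split′ (≈-trans (≈-++ˡ T₁ (≈-++ˡ T₃ cycles)) regroup)))
            where
            cycles : ⋃ K (cycle ∘ D) ≈ ⋃ K C₁ ++ ⋃ K C₃ ++ ⋃ K C₀
            cycles = ≈-trans (⋃-≈ K λ k → ≈-trans (proj₂ (moved k)) (placed-split (Q k)))
              (≈-trans (⋃-++ K C₁ (λ k → C₃ k ++ C₀ k)) (≈-++ˡ (⋃ K C₁) (⋃-++ K C₃ C₀)))
            regroup : T₁ ++ T₃ ++ ⋃ K C₁ ++ ⋃ K C₃ ++ ⋃ K C₀ ≈ (T₁ ++ ⋃ K C₁) ++ (T₃ ++ ⋃ K C₃) ++ ⋃ K C₀
            regroup rewrite ++-assoc T₃ (⋃ K C₃) (⋃ K C₀) =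
              subst (_≈ (T₁ ++ ⋃ K C₁) ++ T₃ ++ ⋃ K C₃ ++ ⋃ K C₀) (++-assoc T₁ T₃ _)
                (≈-interchange T₁ T₃ (⋃ K C₁) (⋃ K C₃ ++ ⋃ K C₀))

          module OnCycle {k : Fin K} {p : Fin n} (p∈ : p ∈ D k) where
            elsewhere : ∀ j → j ≢ k → p ∉ vertices (Q j)
            elsewhere j j≢k p∈j = j≢k (disjoint (from-Q p∈j) p∈)

            -- The two cycle edges at `p` already account for its degree in `F`.
            loose : deg p T₁ ≡ 0 × deg p T₃ ≡ 0
            loose = bound (deg p T₁) (deg p T₃) (≤-trans (≤-reflexive (sym (deg-cycle-∈ (D k) (unique k) p∈))) (deg-⋃-≤ K p k)) (degree-sum p)
              where
              bound : ∀ a b {c} → 2 ≤ c → a + (b + c) ≤ 2 → a ≡ 0 × b ≡ 0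
              bound zero    zero    _ _ = refl , refl
              bound zero    (suc b) {suc (suc c)} (s≤s (s≤s _)) (s≤s le) rewrite +-suc b (suc c) | +-suc b c with s≤s () ← le
              bound (suc a) b {suc (suc c)} (s≤s (s≤s _)) (s≤s le) rewrite +-suc b (suc c) | +-suc b c | +-suc a (suc (b + c)) | +-suc a (b + c) with s≤s () ← le

            deg-one : deg p (T one) ≡ deg p (C₁ k)
            deg-one = trans (deg-++ p T₁ _) (cong₂ _+_ (proj₁ loose) (deg-⋃-one K k λ j j≢k → deg-cls₁-∉ (Q j) (elsewhere j j≢k)))

            deg-three : deg p (T three) ≡ deg p (C₃ k)
            deg-three = trans (deg-++ p T₃ _) (cong₂ _+_ (proj₂ loose) (deg-⋃-one K k λ j j≢k → deg-cls₃-∉ (Q j) (elsewhere j j≢k)))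

            deg-zero : deg p (T zero′) ≡ deg p (C₀ k)
            deg-zero = deg-⋃-one K k λ j j≢k → deg-cls₀-∉ (Q j) (elsewhere j j≢k)

            deg-all : deg p (C₁ k) + (deg p (C₃ k) + deg p (C₀ k)) ≡ 2
            deg-all = trans (sym (trans (deg-++ p (C₁ k) _) (cong (deg p (C₁ k) +_) (deg-++ p (C₃ k) (C₀ k)))))
                        (trans (sym (deg-≈ p (≈-trans (proj₂ (moved k)) (placed-split (Q k))))) (deg-cycle-∈ (D k) (unique k) p∈))

          deg-T≤1 : ∀ τ p → deg p (T τ) ≤ 1
          deg-T≤1 matched p = dM p
          deg-T≤1 one p with at? p
          ... | yes (k , p∈) = subst (_≤ 1) (sym (OnCycle.deg-one p∈)) (deg-cls₁ (Q k) (uq k) p)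
          ... | no none = subst (_≤ 1) (sym (trans (deg-++ p T₁ _) (trans (cong (deg p T₁ +_) (deg-⋃-none K λ k → deg-cls₁-∉ (Q k) λ p∈ → none (k , from-Q p∈))) (+-identityʳ _)))) (deg₁ p)
          deg-T≤1 three p with at? p
          ... | yes (k , p∈) = subst (_≤ 1) (sym (OnCycle.deg-three p∈)) (deg-cls₃ (Q k) (uq k) p)
          ... | no none = subst (_≤ 1) (sym (trans (deg-++ p T₃ _) (trans (cong (deg p T₃ +_) (deg-⋃-none K λ k → deg-cls₃-∉ (Q k) λ p∈ → none (k , from-Q p∈))) (+-identityʳ _)))) (deg₃ p)
          deg-T≤1 zero′ p with at? p
          ... | no none = subst (_≤ 1) (sym (deg-⋃-none K λ k → deg-cls₀-∉ (Q k) λ p∈ → none (k , from-Q p∈))) z≤n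
          ... | yes (k , p∈) = subst (_≤ 1) (sym (OnCycle.deg-zero p∈)) (single (uq k))
            where
            single : Unique (vertices (Q k)) → deg p (C₀ k) ≤ 1
            single (_ ∷ (u≢v ∷ _) ∷ _) with p ≟ u (Q k) | p ≟ v (Q k)
            ... | yes refl | yes e = ⊥-elim (u≢v e)
            ... | yes _    | no _  = ≤-refl
            ... | no _     | yes _ = ≤-refl
            ... | no _     | no _  = z≤n

          in? : ∀ k → Dec (∃ λ p → In S k p)
          in? k = any? λ p → _∈?_ _≟_ p (D k) ×-dec label≟ (lab S p) I ×-dec label≟ (lab S (m p)) O

          -- By purity no arc leaves a cycle of level two.
          level : Fin K → Level
          level k = if does (in? k) then suc (suc zero) else suc zero

          only-O : Label → Level → Level
          only-O O l = l
          only-O I l = zero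
          only-O N l = zero

          -- `o` is the level of the cycle at the two vertices where arcs may leave, and 0
          -- elsewhere. `s` is the level of the matched edge at `p`, which the class 3 edges at `p`
          -- must not undercut.
          o s : Fin n → Level
          o p = maybe′ (λ k → only-O (label (Q k) p) (level k)) zero (cycle-of p)
          s p = o p ⊔ o (m p)

          o-O : ∀ {k p} → p ∈ D k → lab S p ≡ O → o p ≡ level k
          o-O {k} {p} p∈ e rewrite cycle-of-∈ p∈ | e = refl

          o-I : ∀ {p} → lab S p ≡ I → o p ≡ zero
          o-I {p} e with cycle-of p
          ... | just k rewrite e = refl

          o-N : ∀ {p} → lab S p ≡ N → o p ≡ zero
          o-N {p} e with cycle-of p
          ... | nothing = refl
          ... | just k rewrite e = refl

          0<level : ∀ k → 0 < toℕ (level k)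
          0<level k with does (in? k)
          ... | true  = s≤s z≤n
          ... | false = s≤s z≤n

          on-cycle : ∀ {p} → lab S p ≡ O → ∃ λ j → p ∈ D j
          on-cycle {p} e with cycle-of p in eq
          ... | just j = j , cycle-of-just eq

          -- If the partner of `p` has positive level, an arc from some cycle j enters cycle `k` at
          -- `p`: then `k` has level two and, by purity, j has level one. Otherwise `s p` is 0.
          s<level : ∀ {k p} → p ∈ D k → lab S p ≡ I → toℕ (s p) < toℕ (level k)
          s<level {k} {p} p∈ lp rewrite o-I lp = go (lab S (m p)) refl
            where
            go : ∀ l → lab S (m p) ≡ l → toℕ (o (m p)) < toℕ (level k)
            go I e rewrite o-I e = 0<level k
            go N e rewrite o-N e = 0<level k
            go O e with on-cycle e
            ... | j , mp∈ rewrite o-O mp∈ e with in? j | in? k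
            ...   | yes (q , i) | _ = ⊥-elim (pure (mp∈ , e , trans (cong (lab S) (m-invol p)) lp) i)
            ...   | no _ | no none = ⊥-elim (none (p , p∈ , lp , e))
            ...   | no _ | yes _ = ≤-refl

          hue : Class → Fin n → Level
          hue three = s
          hue _     = o

          T-loopless : ∀ τ {p q} → Adj p q (T τ) → p ≢ q
          T-loopless τ a = Adj-loopless ll (Adj-≈ (≈-sym splits-T) (inject τ a))
            where
            inject : ∀ τ {p q} → Adj p q (T τ) → Adj p q (T matched ++ T one ++ T three ++ T zero′)
            inject matched a = Adj-++ˡ a
            inject one     a = Adj-++ʳ M (Adj-++ˡ a)
            inject three   a = Adj-++ʳ M (Adj-++ʳ (T one) (Adj-++ˡ a))
            inject zero′   a = Adj-++ʳ M (Adj-++ʳ (T one) (Adj-++ʳ (T three) a))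

          private
            outer∈ : ∀ k → outer-end (Q k) ∈ D k
            outer∈ k = from-Q (proj₁ (proj₁ (ends-∈ (Q k))))
            outer-next∈ : ∀ k → outer-next (Q k) ∈ D k
            outer-next∈ k = from-Q (proj₂ (proj₁ (ends-∈ (Q k))))
            inner∈ : ∀ k → inner-end (Q k) ∈ D k
            inner∈ k = from-Q (proj₁ (proj₂ (ends-∈ (Q k))))
            inner-next∈ : ∀ k → inner-next (Q k) ∈ D k
            inner-next∈ k = from-Q (proj₂ (proj₂ (ends-∈ (Q k))))

            outer-edge-T : ∀ k → Adj (outer-end (Q k)) (outer-next (Q k)) (T one)
            outer-edge-T k = Adj-++ʳ T₁ (Adj-⋃⁺ K k (outer-edge (Q k) (rest-odd k)))
            inner-edge-T : ∀ k → Adj (inner-end (Q k)) (inner-next (Q k)) (T three)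
            inner-edge-T k = Adj-++ʳ T₃ (Adj-⋃⁺ K k (inner-edge (Q k) (rest-odd k)))

            third-absent : ∀ {a b c} → a + (b + c) ≡ 2 → a ≢ 0 → b ≢ 0 → c ≡ 0
            third-absent {zero}        _ a≢0 _ = ⊥-elim (a≢0 refl)
            third-absent {suc a} {zero}  _ _ b≢0 = ⊥-elim (b≢0 refl)
            third-absent {suc zero} {suc zero} {c} e _ _ = suc-injective (suc-injective e)
            third-absent {suc zero} {suc (suc b)} () _ _
            third-absent {suc (suc a)} {suc b} {c} e _ _ with () ← trans (sym (+-suc a (b + c))) (suc-injective (suc-injective e))

          one-zero-proper : ∀ {p q r} → Adj p q (T one) → Adj p r (T zero′) → Compatible (shade one (o p) (o q)) (shade zero′ (o p) (o r))
          one-zero-proper {p} {q} {r} a b with Adj-⋃⁻ K b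
          ... | k , b′ with zero-ends (Q k) b′
          ...   | inj₁ (refl , refl) = subst₃ (one-zero (level k))
            where
            q≡ : q ≡ outer-next (Q k)
            q≡ = unique-neighbour (deg-T≤1 one p) (T-loopless one a) (T-loopless one (outer-edge-T k)) a (outer-edge-T k)
            op : o p ≡ level k
            op = o-O (outer∈ k) (trans (lab-∈ S (outer∈ k)) (label-outer-end (Q k) (uq k)))
            oq : o q ≡ level k
            oq = trans (cong o q≡) (o-O (outer-next∈ k) (trans (lab-∈ S (outer-next∈ k)) (label-outer-next (Q k) (uq k))))
            or : o r ≡ zero
            or = o-I (trans (lab-∈ S (inner∈ k)) (label-inner-end (Q k) (uq k)))
            subst₃ : Compatible (shade one (level k) (level k)) (shade zero′ (level k) zero) → Compatible (shade one (o p) (o q)) (shade zero′ (o p) (o r))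
            subst₃ h rewrite op | oq | or = h
          -- At the inner end the classes 3 and 0 use up both cycle edges, so no edge of class 1 is
          -- there.
          ...   | inj₂ (refl , refl) = ⊥-elim (Adj⇒deg a (trans (OnCycle.deg-one (inner∈ k)) (third-absent sum′ (Adj⇒deg (inner-edge (Q k) (rest-odd k))) (Adj⇒deg b′))))
            where
            sum′ : deg p (C₃ k) + (deg p (C₀ k) + deg p (C₁ k)) ≡ 2
            sum′ = trans (lemma (deg p (C₃ k)) (deg p (C₀ k)) (deg p (C₁ k))) (OnCycle.deg-all (inner∈ k))
              where
              lemma : ∀ a b c → a + (b + c) ≡ c + (a + b)
              lemma = solve-∀

          three-zero-proper : ∀ {p q r} → Adj p q (T three) → Adj p r (T zero′) → Compatible (shade three (s p) (s q)) (shade zero′ (o p) (o r))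
          three-zero-proper {p} {q} {r} a b with Adj-⋃⁻ K b
          ... | k , b′ with zero-ends (Q k) b′
          ...   | inj₂ (refl , refl) = subst₂′ (three-zero (s p) (s q) (level k) (s<level (inner∈ k) lp) sq<)
            where
            q≡ : q ≡ inner-next (Q k)
            q≡ = unique-neighbour (deg-T≤1 three p) (T-loopless three a) (T-loopless three (inner-edge-T k)) a (inner-edge-T k)
            lp : lab S p ≡ I
            lp = trans (lab-∈ S (inner∈ k)) (label-inner-end (Q k) (uq k))
            sq< : toℕ (s q) < toℕ (level k)
            sq< rewrite q≡ = s<level (inner-next∈ k) (trans (lab-∈ S (inner-next∈ k)) (label-inner-next (Q k) (uq k)))
            or : o r ≡ level k
            or = o-O (outer∈ k) (trans (lab-∈ S (outer∈ k)) (label-outer-end (Q k) (uq k)))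
            subst₂′ : Compatible (shade three (s p) (s q)) (shade zero′ (level k) zero) → Compatible (shade three (s p) (s q)) (shade zero′ (o p) (o r))
            subst₂′ = subst (λ c → Compatible (shade three (s p) (s q)) c) (trans (shade-comm zero′ (level k) zero) (sym (cong₂ (shade zero′) (o-I lp) or)))
          ...   | inj₁ (refl , refl) = ⊥-elim (Adj⇒deg a (trans (OnCycle.deg-three (outer∈ k)) (third-absent sum′ (Adj⇒deg (outer-edge (Q k) (rest-odd k))) (Adj⇒deg b′))))
            where
            sum′ : deg p (C₁ k) + (deg p (C₀ k) + deg p (C₃ k)) ≡ 2
            sum′ = trans (lemma (deg p (C₁ k)) (deg p (C₀ k)) (deg p (C₃ k))) (OnCycle.deg-all (outer∈ k))
              where
              lemma : ∀ a b c → a + (b + c) ≡ a + (c + b)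
              lemma = solve-∀

          mate : ∀ {p q} → Adj p q M → m p ≡ q
          mate = Adj-partner llM dM

          proper′ : ∀ {τ σ p q r} → τ ≢ σ → Adj p q (T τ) → Adj p r (T σ) →
                    Compatible (shade τ (hue τ p) (hue τ q)) (shade σ (hue σ p) (hue σ r))
          proper′ {matched} {matched} h a b = ⊥-elim (h refl)
          proper′ {one}     {one}     h a b = ⊥-elim (h refl)
          proper′ {three}   {three}   h a b = ⊥-elim (h refl)
          proper′ {zero′}   {zero′}   h a b = ⊥-elim (h refl)
          proper′ {matched} {one}   {p} {q} {r} h a b with refl ← mate a = matched-one (o p) (o q) (o r)
          proper′ {one} {matched}   {p} {q} {r} h a b with refl ← mate b = compatible-sym (matched-one (o p) (o r) (o q))
          proper′ {matched} {three} {p} {q} {r} h a b with refl ← mate a = matched-three (o p) (o q) (s r)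
          proper′ {three} {matched} {p} {q} {r} h a b with refl ← mate b = compatible-sym (matched-three (o p) (o r) (s q))
          proper′ {matched} {zero′} {p} {q} {r} h a b = matched-zero (o p) (o q) (o r)
          proper′ {zero′} {matched} {p} {q} {r} h a b = compatible-sym (matched-zero (o p) (o r) (o q))
          proper′ {one} {three}     {p} {q} {r} h a b = one-three (o p) (o q) (s p) (s r)
          proper′ {three} {one}     {p} {q} {r} h a b = compatible-sym (one-three (o p) (o r) (s p) (s q))
          proper′ {one} {zero′}                 h a b = one-zero-proper a b
          proper′ {zero′} {one}                 h a b = compatible-sym (one-zero-proper b a)
          proper′ {three} {zero′}               h a b = three-zero-proper a b
          proper′ {zero′} {three}               h a b = compatible-sym (three-zero-proper b a)

          pure-scheme : Scheme L
          pure-scheme = record { T = T ; splits = splits-T ; deg≤1 = deg-T≤1 ; hue = hue ; proper = proper′ }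

      scheme : (∀ k → 5 ≤ length (D k)) → (∀ k → Search.NotHouse m m-invol (D k)) → Scheme L
      scheme long house = pure-scheme long (proj₁ st) (proj₂ st)
        where
        open Energy m m-invol D unique odd long disjoint
        st : Σ State Pure
        st = pure-state house

  open import Defs using (Graph; #V; #E; ends; loopless; Joins; Incident; incident?; degree; maxDegree; ReachableVia; TwoEdgeConnected; _≅_; H₁; H₂; Coloring; lineGraph)

  -- From edge lists to graphs

  module _ {n : ℕ} where

    total-length : ∀ (L : List (Edge n)) → total (λ _ → 1) L ≡ length L
    total-length []      = refl
    total-length (e ∷ L) = cong suc (total-length L)

  module _ {n : ℕ} {A : Set} where

    labelAt : ∀ {k} {g : Fin k → Edge n} → Labels A (tabulate g) → Fin k → A
    labelAt (a ∷ as) zero    = a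
    labelAt (a ∷ as) (suc i) = labelAt as i

    tabulateLabels : ∀ {k} (g : Fin k → Edge n) → (Fin k → A) → Labels A (tabulate g)
    tabulateLabels {zero}  g t = []
    tabulateLabels {suc k} g t = t zero ∷ tabulateLabels (g ∘ suc) (t ∘ suc)

    module _ (f : A → Bool) where

      weight-sel : ∀ ω {k} (g : Fin k → Edge n) ls i → f (labelAt {g = g} ls i) ≡ true → ω (g i) ≤ total ω (sel f ls)
      weight-sel ω g (a ∷ as) zero    e rewrite e = m≤m+n _ _
      weight-sel ω g (a ∷ as) (suc i) e with f a
      ... | true  = ≤-trans (weight-sel ω (g ∘ suc) as i e) (m≤n+m _ (ω (g zero)))
      ... | false = weight-sel ω (g ∘ suc) as i e

      -- Applied with weight 1 to show that a label occurs only once, and with `inc v` to show that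
      -- two edges of one class do not share the vertex v.
      weight-sel₂ : ∀ ω {k} (g : Fin k → Edge n) ls {i j} → i ≢ j → f (labelAt {g = g} ls i) ≡ true → f (labelAt {g = g} ls j) ≡ true →
                    ω (g i) + ω (g j) ≤ total ω (sel f ls)
      weight-sel₂ ω g (a ∷ as) {zero}  {zero}  i≢j _ _ = ⊥-elim (i≢j refl)
      weight-sel₂ ω g (a ∷ as) {zero}  {suc j} _ e e′ rewrite e = +-mono-≤ ≤-refl (weight-sel ω (g ∘ suc) as j e′)
      weight-sel₂ ω g (a ∷ as) {suc i} {zero}  _ e e′ rewrite e′ | +-comm (ω (g (suc i))) (ω (g zero)) =
        +-mono-≤ ≤-refl (weight-sel ω (g ∘ suc) as i e)
      weight-sel₂ ω g (a ∷ as) {suc i} {suc j} i≢j e e′ with f a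
      ... | true  = ≤-trans (weight-sel₂ ω (g ∘ suc) as (λ { refl → i≢j refl }) e e′) (m≤n+m _ (ω (g zero)))
      ... | false = weight-sel₂ ω (g ∘ suc) as (λ { refl → i≢j refl }) e e′

      Adj-labelled : ∀ {k} (g : Fin k → Edge n) ls i → f (labelAt {g = g} ls i) ≡ true → Adj (proj₁ (g i)) (proj₂ (g i)) (sel f ls)
      Adj-labelled g (a ∷ as) zero    e rewrite e = here
      Adj-labelled g (a ∷ as) (suc i) e with f a
      ... | true  = there (Adj-labelled (g ∘ suc) as i e)
      ... | false = Adj-labelled (g ∘ suc) as i e

      labelled-exists : ∀ {k} (g : Fin k → Edge n) ls → 1 ≤ length (sel f ls) → ∃ λ i → f (labelAt {g = g} ls i) ≡ true
      labelled-exists {zero}  g []       ()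
      labelled-exists {suc k} g (a ∷ as) le with f a in e
      ... | true  = zero , e
      ... | false with labelled-exists (g ∘ suc) as le
      ...   | i , h = suc i , h

  edgesOf : (G : Graph) → List (Edge (#V G))
  edgesOf G = tabulate (ends G)

  module _ (G H : Graph) (φ : Fin (#V H) → Fin (#V G)) (ψ : Fin (#V G) → Fin (#V H))
           (φψ : ∀ p → φ (ψ p) ≡ p) (ψφ : ∀ p → ψ (φ p) ≡ p) where
    private
      image : Fin (#E H) → Edge (#V G)
      image h = φ (proj₁ (ends H h)) , φ (proj₂ (ends H h))

      is : Fin (#E H) → Fin (#E H) → Bool
      is h h′ = does (h′ ≟ h)

      is-refl : ∀ h → is h h ≡ true
      is-refl h with h ≟ h
      ... | yes _ = refl
      ... | no h≢h = ⊥-elim (h≢h refl)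

      is-≡ : ∀ {h h′} → is h h′ ≡ true → h′ ≡ h
      is-≡ {h} {h′} e with h′ ≟ h
      ... | yes e′ = e′

      sel-none : ∀ {k} (g : Fin k → Edge (#V G)) t (f : Fin (#E H) → Bool) → (∀ i → f (t i) ≡ false) → sel f (tabulateLabels g t) ≡ []
      sel-none {zero}  g t f no′ = refl
      sel-none {suc k} g t f no′ rewrite no′ zero = sel-none (g ∘ suc) (t ∘ suc) f (no′ ∘ suc)

      sel-one : ∀ {k} (g : Fin k → Edge (#V G)) t (f : Fin (#E H) → Bool) i → f (t i) ≡ true → (∀ j → j ≢ i → f (t j) ≡ false) →
                sel f (tabulateLabels g t) ≡ g i ∷ []
      sel-one {suc k} g t f zero    e no′ rewrite e = cong (g zero ∷_) (sel-none (g ∘ suc) (t ∘ suc) f λ i → no′ (suc i) λ ())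
      sel-one {suc k} g t f (suc i) e no′ rewrite no′ zero (λ ()) =
        sel-one (g ∘ suc) (t ∘ suc) f i e (λ j j≢i → no′ (suc j) λ { refl → j≢i refl })

    -- The edges of `H` are labelled by their own indices. Transported to `G`, every label selects a
    -- single entry, which gives the bijection of the edges even when some are parallel.
    ≅-fromEdges : edgesOf G ≈ tabulate image → G ≅ H
    ≅-fromEdges r with transport r (tabulateLabels image id)
    ... | ls , same = record { vertices = mk↔ₛ′ ψ φ ψφ φψ ; edges = mk↔ₛ′ to from to-from from-to ; preserves = λ {e} → preserves e }
      where
      to : Fin (#E G) → Fin (#E H)
      to = labelAt {g = ends G} ls
      class : ∀ h → sel (is h) ls ≈ image h ∷ []
      class h = subst (sel (is h) ls ≈_) (sel-one image id (is h) h (is-refl h) (λ j j≢h → other j j≢h)) (same (is h))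
        where
        other : ∀ j → j ≢ h → is h j ≡ false
        other j j≢h with j ≟ h
        ... | yes e = ⊥-elim (j≢h e)
        ... | no _  = refl
      pre : ∀ h → ∃ λ e → is h (to e) ≡ true
      pre h = labelled-exists (is h) (ends G) ls (≤-reflexive (sym (≈-length (class h))))
      from : Fin (#E H) → Fin (#E G)
      from h = proj₁ (pre h)
      to-from : ∀ h → to (from h) ≡ h
      to-from h = is-≡ (proj₂ (pre h))
      injective : ∀ {e e′} → to e ≡ to e′ → e ≡ e′
      injective {e} {e′} eq with e ≟ e′
      ... | yes p = p
      ... | no e≢e′ with ≤-trans (weight-sel₂ (is (to e)) (λ _ → 1) (ends G) ls e≢e′ (is-refl (to e)) (subst (λ h → is (to e) h ≡ true) eq (is-refl (to e))))
                          (≤-reflexive (trans (total-length (sel (is (to e)) ls)) (≈-length (class (to e)))))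
      ...   | s≤s ()
      from-to : ∀ e → from (to e) ≡ e
      from-to e = injective (to-from (to e))
      adjacent : ∀ {p q h} → Adj p q (image h ∷ []) → Joins H h (ψ p) (ψ q)
      adjacent {h = h} a with Adj-∷⁻ a
      ... | inj₁ (refl , refl)        = inj₁ (cong₂ _,_ (sym (ψφ _)) (sym (ψφ _)))
      ... | inj₂ (inj₁ (refl , refl)) = inj₂ (cong₂ _,_ (sym (ψφ _)) (sym (ψφ _)))
      found : ∀ e → Adj (proj₁ (ends G e)) (proj₂ (ends G e)) (image (to e) ∷ [])
      found e = Adj-≈ (class (to e)) (Adj-labelled (is (to e)) (ends G) ls e (is-refl (to e)))
      preserves : ∀ e {x y} → Joins G e x y → Joins H (to e) (ψ x) (ψ y)
      preserves e {x} {y} (inj₁ eq) = adjacent (subst (λ (p , q) → Adj p q (image (to e) ∷ [])) eq (found e))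
      preserves e {x} {y} (inj₂ eq) = adjacent (Adj-sym (subst (λ (p , q) → Adj p q (image (to e) ∷ [])) eq (found e)))

  class≟ : (τ σ : Class) → Dec (τ ≡ σ)
  class≟ matched matched = yes refl
  class≟ matched one     = no λ ()
  class≟ matched three   = no λ ()
  class≟ matched zero′   = no λ ()
  class≟ one     matched = no λ ()
  class≟ one     one     = yes refl
  class≟ one     three   = no λ ()
  class≟ one     zero′   = no λ ()
  class≟ three   matched = no λ ()
  class≟ three   one     = no λ ()
  class≟ three   three   = yes refl
  class≟ three   zero′   = no λ ()
  class≟ zero′   matched = no λ ()
  class≟ zero′   one     = no λ ()
  class≟ zero′   three   = no λ ()
  class≟ zero′   zero′   = yes refl

  isClass : Class → Class → Bool
  isClass τ σ = does (class≟ σ τ)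

  module _ {n : ℕ} where

    constant : {A : Set} → A → (L : List (Edge n)) → Labels A L
    constant a []      = []
    constant a (e ∷ L) = a ∷ constant a L

    _⧺_ : {A : Set} {K L : List (Edge n)} → Labels A K → Labels A L → Labels A (K ++ L)
    _⧺_ {K = []}    []       bs = bs
    _⧺_ {K = _ ∷ _} (a ∷ as) bs = a ∷ as ⧺ bs

    sel-⧺ : {A : Set} (f : A → Bool) {K L : List (Edge n)} (as : Labels A K) (bs : Labels A L) → sel f (as ⧺ bs) ≡ sel f as ++ sel f bs
    sel-⧺ f {[]}    []       bs = refl
    sel-⧺ f {e ∷ K} (a ∷ as) bs with f a
    ... | true  = cong (e ∷_) (sel-⧺ f as bs)
    ... | false = sel-⧺ f as bs

    sel-constant-true : {A : Set} (f : A → Bool) {a : A} (L : List (Edge n)) → f a ≡ true → sel f (constant a L) ≡ L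
    sel-constant-true f []      e = refl
    sel-constant-true f (x ∷ L) e rewrite e = cong (x ∷_) (sel-constant-true f L e)

    sel-constant-false : {A : Set} (f : A → Bool) {a : A} (L : List (Edge n)) → f a ≡ false → sel f (constant a L) ≡ []
    sel-constant-false f []      e = refl
    sel-constant-false f (x ∷ L) e rewrite e = sel-constant-false f L e

    classLabels : (T : Class → List (Edge n)) → Labels Class (T matched ++ T one ++ T three ++ T zero′)
    classLabels T = constant matched (T matched) ⧺ (constant one (T one) ⧺ (constant three (T three) ⧺ constant zero′ (T zero′)))

    sel-classLabels : ∀ T τ → sel (isClass τ) (classLabels T) ≡ T τ
    sel-classLabels T τ = trans (sel-⧺ f (constant matched (T matched)) _) (trans (cong (sel f (constant matched (T matched)) ++_)
        (trans (sel-⧺ f (constant one (T one)) _) (cong (sel f (constant one (T one)) ++_) (sel-⧺ f (constant three (T three)) (constant zero′ (T zero′))))))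
        (pick τ))
      where
      f = isClass τ
      only : Class → Class → List (Edge n)
      only τ σ = if isClass τ σ then T σ else []
      blank : ∀ τ σ → sel (isClass τ) (constant σ (T σ)) ≡ only τ σ
      blank τ σ with isClass τ σ in e
      ... | true  = sel-constant-true (isClass τ) (T σ) e
      ... | false = sel-constant-false (isClass τ) (T σ) e
      go : ∀ τ → only τ matched ++ only τ one ++ only τ three ++ only τ zero′ ≡ T τ
      go matched = ++-identityʳ (T matched)
      go one     = ++-identityʳ (T one)
      go three   = ++-identityʳ (T three)
      go zero′   = refl
      pick : ∀ τ → sel (isClass τ) (constant matched (T matched)) ++ sel (isClass τ) (constant one (T one)) ++
                   sel (isClass τ) (constant three (T three)) ++ sel (isClass τ) (constant zero′ (T zero′)) ≡ T τ
      pick τ rewrite blank τ matched | blank τ one | blank τ three | blank τ zero′ = go τ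

  -- Transported class labels tell the class of each edge of `G`. Adjacent edges of different
  -- classes are compatible by `proper`, and two of the same class at a vertex would exceed the
  -- bound `deg≤1`.
  scheme⇒colouring : (G : Graph) → Scheme (edgesOf G) → Coloring 11 3 (lineGraph G)
  scheme⇒colouring G s with transport (Scheme.splits s) (classLabels (Scheme.T s))
  ... | ls , same = f , λ {e} {e′} → proper-at e e′
    where
    open Scheme s
    t : Fin (#E G) → Class
    t = labelAt {g = ends G} ls
    f : Fin (#E G) → Fin 11
    f e = colour (t e) (proj₁ (ends G e)) (proj₂ (ends G e))
    class : ∀ τ → sel (isClass τ) ls ≈ T τ
    class τ = subst (sel (isClass τ) ls ≈_) (sel-classLabels T τ) (same (isClass τ))
    self : ∀ τ → isClass τ τ ≡ true
    self matched = refl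
    self one     = refl
    self three   = refl
    self zero′   = refl
    found : ∀ e → Adj (proj₁ (ends G e)) (proj₂ (ends G e)) (T (t e))
    found e = Adj-≈ (class (t e)) (Adj-labelled (isClass (t e)) (ends G) ls e (self (t e)))
    oriented : ∀ {v} e → Incident G v e → ∃ λ q → Adj v q (T (t e)) × f e ≡ colour (t e) v q
    oriented e (inj₁ refl) = _ , found e , refl
    oriented e (inj₂ refl) = _ , Adj-sym (found e) , shade-comm (t e) _ _
    incident-inc : ∀ {v} e → Incident G v e → 1 ≤ inc v (ends G e)
    incident-inc {v} e (inj₁ refl) = 1≤inc-fst v _
    incident-inc {v} e (inj₂ refl) = 1≤inc-snd v _
    proper-at : ∀ e e′ → (e ≢ e′ × ∃ λ v → Incident G v e × Incident G v e′) →
                3 ≤ ∣ toℕ (f e) - toℕ (f e′) ∣ × ∣ toℕ (f e) - toℕ (f e′) ∣ ≤ 8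
    proper-at e e′ (e≢e′ , v , i , i′) with class≟ (t e) (t e′) | oriented e i | oriented e′ i′
    ... | no τ≢σ | q , a , eq | r , b , eq′ = Compatible.bounds (subst₂ Compatible (sym eq) (sym eq′) (proper τ≢σ a b))
    ... | yes τ≡σ | _ | _ with ≤-trans (+-mono-≤ (incident-inc e i) (incident-inc e′ i′))
            (≤-trans (weight-sel₂ (isClass (t e)) (inc v) (ends G) ls e≢e′ (self (t e)) (subst (λ σ → isClass (t e) σ ≡ true) τ≡σ (self (t e))))
              (≤-trans (≤-reflexive (trans (sym (deg≡total v (sel (isClass (t e)) ls))) (deg-≈ v (class (t e))))) (deg≤1 (t e) v)))
    ...   | s≤s ()

  -- Connectedness, bridges and degrees of the graph in terms of cuts

  module _ {n : ℕ} where

    cut-tabulate-0 : ∀ X {k} (g : Fin k → Edge n) → cut X (tabulate g) ≡ 0 → ∀ i → X (proj₁ (g i)) ≡ X (proj₂ (g i))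
    cut-tabulate-0 X {suc k} g eq i with xr-split (X (proj₁ (g zero))) (X (proj₂ (g zero)))
    ... | inj₂ (_ , o) rewrite o with () ← eq
    cut-tabulate-0 X {suc k} g eq zero    | inj₁ (p , _) = p
    cut-tabulate-0 X {suc k} g eq (suc i) | inj₁ (_ , o) rewrite o = cut-tabulate-0 X (g ∘ suc) eq i

    cut-tabulate-1 : ∀ X {k} (g : Fin k → Edge n) → cut X (tabulate g) ≡ 1 →
      ∃ λ i → X (proj₁ (g i)) ≡ not (X (proj₂ (g i))) × ∀ j → j ≢ i → X (proj₁ (g j)) ≡ X (proj₂ (g j))
    cut-tabulate-1 X {suc k} g eq with xr-split (X (proj₁ (g zero))) (X (proj₂ (g zero)))
    ... | inj₂ (d , o) rewrite o = zero , d , rest-same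
      where
      rest-same : ∀ j → j ≢ zero → X (proj₁ (g j)) ≡ X (proj₂ (g j))
      rest-same zero    h = ⊥-elim (h refl)
      rest-same (suc j) h = cut-tabulate-0 X (g ∘ suc) (suc-injective eq) j
    ... | inj₁ (p , o) rewrite o with cut-tabulate-1 X (g ∘ suc) eq
    ...   | i , d , h = suc i , d , same
      where
      same : ∀ j → j ≢ suc i → X (proj₁ (g j)) ≡ X (proj₂ (g j))
      same zero    _ = p
      same (suc j) e = h j λ { refl → e refl }

    sel-split : {L : List (Edge n)} (ms : Labels Bool L) → L ≈ sel id ms ++ sel not ms
    sel-split {[]}    []           = ≈-refl
    sel-split {e ∷ L} (true ∷ ms)  = ≈-prep e (sel-split ms)
    sel-split {e ∷ L} (false ∷ ms) = ≈-trans (≈-prep e (sel-split ms)) (≈-sym (≈-shift e (sel id ms) (sel not ms)))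

    ⋃-extract : ∀ K (f : Fin K → List (Edge n)) k → ∃ λ R → ⋃ K f ≈ f k ++ R
    ⋃-extract (suc K) f zero = ⋃ K (f ∘ suc) , ≈-refl
    ⋃-extract (suc K) f (suc k) with ⋃-extract K (f ∘ suc) k
    ... | R , r = f zero ++ R , ≈-trans (≈-++ˡ (f zero) r) (≈-exchange (f zero) (f (suc k)) R)

  another : ∀ {n} → 2 ≤ n → (p : Fin n) → ∃ λ q → q ≢ p
  another {suc (suc n)} _ zero    = suc zero , λ ()
  another {suc (suc n)} _ (suc p) = zero , λ ()
  another {suc zero} (s≤s ())

  module _ (G : Graph) where

    private
      L : List (Edge (#V G))
      L = edgesOf G

    edges-loopless : Loopless L
    edges-loopless = tabulate⁺ (loopless G)

    deg≡degree : ∀ p → deg p L ≡ degree G p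
    deg≡degree p = go (#E G) id
      where
      go : ∀ k (h : Fin k → Fin (#E G)) → deg p (tabulate (ends G ∘ h)) ≡ length (filter (incident? G p) (tabulate h))
      go zero    h = refl
      go (suc k) h with incident? G p (h zero)
      ... | yes i rewrite filter-accept (incident? G p) {x = h zero} {tabulate (h ∘ suc)} i = cong₂ _+_ (one-end i) (go k (h ∘ suc))
        where
        one-end : Incident G p (h zero) → inc p (ends G (h zero)) ≡ 1
        one-end (inj₁ refl) rewrite δ-refl p | δ-≢ (loopless G (h zero)) = refl
        one-end (inj₂ refl) rewrite δ-refl p | δ-≢ (≢-sym (loopless G (h zero))) = refl
      ... | no ¬i rewrite filter-reject (incident? G p) {x = h zero} {tabulate (h ∘ suc)} ¬i =
        cong₂ _+_ (cong₂ _+_ (δ-≢ (¬i ∘ inj₁)) (δ-≢ (¬i ∘ inj₂))) (go k (h ∘ suc))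

    constant-along : ∀ (X : Fin (#V G) → Bool) {P : Fin (#E G) → Set} {x y} → (∀ e → P e → X (proj₁ (ends G e)) ≡ X (proj₂ (ends G e))) →
                     ReachableVia G P x y → X x ≡ X y
    constant-along X h ε = refl
    constant-along X h ((e , Pe , inj₁ refl) ◅ s) = trans (h e Pe) (constant-along X h s)
    constant-along X h ((e , Pe , inj₂ refl) ◅ s) = trans (sym (h e Pe)) (constant-along X h s)

    module Main (tec : TwoEdgeConnected G) (max≡3 : maxDegree G ≡ 3) where

      connected-G : ∀ (X : Fin (#V G) → Bool) → cut X L ≡ 0 → ∀ p q → X p ≡ X q
      connected-G X c p q = constant-along X (λ e _ → cut-tabulate-0 X (ends G) c e) (proj₁ tec p q)

      bridgeless-G : Bridgeless L
      bridgeless-G X c with cut-tabulate-1 X (ends G) c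
      -- The ends of `e` lie on different sides of `X`, but a path without `e` never changes sides.
      ... | e , d , same = proj₂ (proj₂ tec) e (_ , _ , proj₁ tec _ _ , λ path → not-fixed _ (trans (sym (constant-along X same path)) d))

      degree≤3 : ∀ p → deg p L ≤ 3
      degree≤3 p = subst₂ _≤_ (sym (deg≡degree p)) max≡3
        (All.lookup (Extrema.xs≤max 0 (map (degree G) (allFin (#V G)))) (∈-map⁺ (degree G) (∈-allFin p)))

      cubic-vertex : ∃ λ p → deg p L ≡ 3
      cubic-vertex with any? (λ p → deg p L ℕ.≟ 3)
      ... | yes h = h
      ... | no none with subst (_≤ 2) max≡3 (Extrema.max≤v⁺ {xs = map (degree G) (allFin (#V G))} z≤n (map⁺ (tabulate⁺ small)))
        where
        small : ∀ p → degree G p ≤ 2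
        small p = subst (_≤ 2) (deg≡degree p) (below (deg p L) (degree≤3 p) (λ e → none (p , e)))
          where
          below : ∀ d → d ≤ 3 → d ≢ 3 → d ≤ 2
          below 0 _ _ = z≤n
          below 1 _ _ = s≤s z≤n
          below 2 _ _ = ≤-refl
          below 3 _ h = ⊥-elim (h refl)
          below (suc (suc (suc (suc _)))) (s≤s (s≤s (s≤s ()))) _
      ...   | s≤s (s≤s ())

      G₂₃ : Bridgeless₂₃ L
      G₂₃ = record
        { degrees    = degs
        ; loopless   = edges-loopless
        ; bridgeless = bridgeless-G
        ; connected  = λ X p q _ _ c → connected-G X c p q
        }
        where
        degs : ∀ p → Subcubic (deg p L)
        degs p = classify (deg p L) refl (degree≤3 p)
          where
          single : cut (member (p ∷ [])) L ≡ deg p L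
          single = cut-single L edges-loopless (member⁺ {xs = p ∷ []} (here refl)) λ q e → inj₁ (only (member⁻ (p ∷ []) e))
            where
            only : ∀ {q} → q ∈ p ∷ [] → q ≡ p
            only (here e) = e
          -- An isolated vertex contradicts connectedness, as there is a second vertex; the edge at
          -- a vertex of degree one is a bridge.
          classify : ∀ d → deg p L ≡ d → d ≤ 3 → Subcubic d
          classify 0 e _ with another (proj₁ (proj₂ tec)) p
          ... | q , q≢p with member⁻ (p ∷ []) (trans (connected-G (member (p ∷ [])) (trans single e) q p) (member⁺ {xs = p ∷ []} (here refl)))
          ...   | here q≡p = ⊥-elim (q≢p q≡p)
          classify 1 e _ = ⊥-elim (bridgeless-G (member (p ∷ [])) (trans single e))
          classify 2 _ _ = deg2
          classify 3 _ _ = deg3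
          classify (suc (suc (suc (suc _)))) _ (s≤s (s≤s (s≤s ())))

      closed⇒all : ∀ S {p} → p ∈ S → cut (member S) L ≡ 0 → ∀ q → q ∈ S
      closed⇒all S {p} p∈ c q = member⁻ S (trans (connected-G (member S) c q p) (member⁺ p∈))

      -- Recognising H₁ and H₂

      module _ {x y z : Fin (#V G)} (x≢y : x ≢ y) (y≢z : y ≢ z) (z≢x : z ≢ x) (all∈ : ∀ q → q ∈ x ∷ y ∷ z ∷ []) where

        is-H₁ : L ≈ (x , y) ∷ (y , z) ∷ (z , x) ∷ (x , y) ∷ [] → G ≅ H₁
        is-H₁ r = ≅-fromEdges G H₁ φ ψ φψ ψφ (≈-trans r
          (≈-trans (≈-shift (y , z) ((x , y) ∷ []) _) (≈-trans (≈-flip y z)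
            (≈-prep _ (≈-trans (≈-shift (z , x) ((x , y) ∷ []) _) (≈-flip z x))))))
          where
          -- The vertex `z` is the one that subdivides an edge between `x` and `y`.
          φ : Fin 3 → Fin (#V G)
          φ zero             = z
          φ (suc zero)       = x
          φ (suc (suc zero)) = y
          ψ : Fin (#V G) → Fin 3
          ψ p = if does (p ≟ z) then zero else if does (p ≟ x) then suc zero else suc (suc zero)
          φψ : ∀ p → φ (ψ p) ≡ p
          φψ p with p ≟ z | p ≟ x | all∈ p
          ... | yes e | _     | _                         = sym e
          ... | no _  | yes e | _                         = sym e
          ... | no a  | no b  | here e                    = ⊥-elim (b e)
          ... | no a  | no b  | there (here e)            = sym e
          ... | no a  | no b  | there (there (here e))    = ⊥-elim (a e)
          ψφ : ∀ i → ψ (φ i) ≡ i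
          ψφ zero with z ≟ z
          ... | yes _ = refl
          ... | no h  = ⊥-elim (h refl)
          ψφ (suc zero) with x ≟ z | x ≟ x
          ... | yes e | _     = ⊥-elim (z≢x (sym e))
          ... | no _  | yes _ = refl
          ... | no _  | no h  = ⊥-elim (h refl)
          ψφ (suc (suc zero)) with y ≟ z | y ≟ x
          ... | yes e | _     = ⊥-elim (y≢z e)
          ... | no _  | yes e = ⊥-elim (x≢y (sym e))
          ... | no _  | no _  = refl

        -- The four edges saturate `x` and `y`, so any further edge would be a loop at `z`.
        double-edge : ∀ {R} → L ≈ (x , y) ∷ (y , z) ∷ (z , x) ∷ (x , y) ∷ R → G ≅ H₁
        double-edge {[]} r = is-H₁ r
        double-edge {R@((c , d) ∷ R′)} r = ⊥-elim (lacks (loopless-≈ r edges-loopless))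
          where
          spentˣ : deg x R ≡ 0
          spentˣ = n≤0⇒n≡0 (≤-pred (≤-pred (≤-pred (subst (_≤ 3) (trans (deg-≈ x r) count) (degree≤3 x)))))
            where
            count : deg x ((x , y) ∷ (y , z) ∷ (z , x) ∷ (x , y) ∷ R) ≡ 3 + deg x R
            count rewrite δ-refl x | δ-≢ x≢y | δ-≢ (≢-sym z≢x) = refl
          spentʸ : deg y R ≡ 0
          spentʸ = n≤0⇒n≡0 (≤-pred (≤-pred (≤-pred (subst (_≤ 3) (trans (deg-≈ y r) count) (degree≤3 y)))))
            where
            count : deg y ((x , y) ∷ (y , z) ∷ (z , x) ∷ (x , y) ∷ R) ≡ 3 + deg y R
            count rewrite δ-refl y | δ-≢ (≢-sym x≢y) | δ-≢ y≢z = refl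
          is-z : ∀ {p q} → Adj p q R → p ≡ z
          is-z {p} a with all∈ p
          ... | here refl                 = ⊥-elim (Adj⇒deg a spentˣ)
          ... | there (here refl)         = ⊥-elim (Adj⇒deg a spentʸ)
          ... | there (there (here e))    = e
          lacks : ¬ Loopless ((x , y) ∷ (y , z) ∷ (z , x) ∷ (x , y) ∷ R)
          lacks (_ ∷ _ ∷ _ ∷ _ ∷ c≢d ∷ _) = c≢d (trans (is-z here) (sym (is-z here˘)))

      module _ (not-H₁ : ¬ (G ≅ H₁)) where

        -- By connectedness a closed triangle contains all vertices. A fourth edge is parallel to
        -- one of its sides, which makes the graph H₁; without one the graph is K₃ and has no vertex
        -- of degree three.
        noClosed-G : NoClosedTriangle (λ _ → false) L
        noClosed-G {x} {y} {z} _ (triangle a b c x≢y y≢z z≢x) cut≡0 with triangle-extract edges-loopless a b c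
        ... | [] , r = ⊥-elim (low (cubic-vertex))
          where
          all∈ : ∀ q → q ∈ x ∷ y ∷ z ∷ []
          all∈ = closed⇒all (x ∷ y ∷ z ∷ []) (here refl) cut≡0
          low : ¬ (∃ λ p → deg p L ≡ 3)
          low (p , e) with all∈ p | trans (sym (deg-≈ p r)) e
          ... | here refl                 | e′ rewrite δ-refl x | δ-≢ x≢y | δ-≢ (≢-sym z≢x) with () ← e′
          low (p , e) | there (here refl) | e′ rewrite δ-refl y | δ-≢ (≢-sym x≢y) | δ-≢ y≢z with () ← e′
          low (p , e) | there (there (here refl)) | e′ rewrite δ-refl z | δ-≢ z≢x | δ-≢ (≢-sym y≢z) with () ← e′
        ... | (c′ , d) ∷ R , r = not-H₁ (by-ends (loopless-≈ r edges-loopless) (all∈ c′) (all∈ d))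
          where
          all∈ : ∀ q → q ∈ x ∷ y ∷ z ∷ []
          all∈ = closed⇒all (x ∷ y ∷ z ∷ []) (here refl) cut≡0
          turn : ∀ {x y z} → (∀ q → q ∈ x ∷ y ∷ z ∷ []) → ∀ q → q ∈ y ∷ z ∷ x ∷ []
          turn h q with h q
          ... | here e                 = there (there (here e))
          ... | there (here e)         = here e
          ... | there (there (here e)) = there (here e)
          cyc : ∀ {x y z} {K : List (Edge (#V G))} → (x , y) ∷ (y , z) ∷ (z , x) ∷ K ≈ (y , z) ∷ (z , x) ∷ (x , y) ∷ K
          cyc = ≈-trans (≈-swap _ _) (≈-prep _ (≈-swap _ _))
          last-flip : ∀ {e₁ e₂ e₃ p q} {K : List (Edge (#V G))} → e₁ ∷ e₂ ∷ e₃ ∷ (p , q) ∷ K ≈ e₁ ∷ e₂ ∷ e₃ ∷ (q , p) ∷ K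
          last-flip = ≈-prep _ (≈-prep _ (≈-prep _ (≈-flip _ _)))
          at-xy : ∀ {K} → L ≈ (x , y) ∷ (y , z) ∷ (z , x) ∷ (x , y) ∷ K → G ≅ H₁
          at-xy = double-edge x≢y y≢z z≢x all∈
          at-yz : ∀ {K} → L ≈ (x , y) ∷ (y , z) ∷ (z , x) ∷ (y , z) ∷ K → G ≅ H₁
          at-yz s = double-edge y≢z z≢x x≢y (turn all∈) (≈-trans s cyc)
          at-zx : ∀ {K} → L ≈ (x , y) ∷ (y , z) ∷ (z , x) ∷ (z , x) ∷ K → G ≅ H₁
          at-zx s = double-edge z≢x x≢y y≢z (turn (turn all∈)) (≈-trans s (≈-trans cyc cyc))
          by-ends : Loopless ((x , y) ∷ (y , z) ∷ (z , x) ∷ (c′ , d) ∷ R) → c′ ∈ x ∷ y ∷ z ∷ [] → d ∈ x ∷ y ∷ z ∷ [] → G ≅ H₁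
          by-ends (_ ∷ _ ∷ _ ∷ n ∷ _) (here refl) (here refl)                                 = ⊥-elim (n refl)
          by-ends _ (here refl) (there (here refl))                                           = at-xy r
          by-ends _ (here refl) (there (there (here refl)))                                   = at-zx (≈-trans r last-flip)
          by-ends _ (there (here refl)) (here refl)                                           = at-xy (≈-trans r last-flip)
          by-ends (_ ∷ _ ∷ _ ∷ n ∷ _) (there (here refl)) (there (here refl))                 = ⊥-elim (n refl)
          by-ends _ (there (here refl)) (there (there (here refl)))                           = at-yz r
          by-ends _ (there (there (here refl))) (here refl)                                   = at-zx r
          by-ends _ (there (there (here refl))) (there (here refl))                           = at-yz (≈-trans r last-flip)
          by-ends (_ ∷ _ ∷ _ ∷ n ∷ _) (there (there (here refl))) (there (there (here refl))) = ⊥-elim (n refl)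

      -- Only `x₂` can have a further edge, which would be a bridge. So, by connectedness, the
      -- five-cycle with its two chords is the whole graph: K₄ on the other four vertices, with `x₂`
      -- subdividing the edge `x₁ x₃`.
      module House {x₀ x₁ x₂ x₃ x₄ : Fin (#V G)} {R : List (Edge (#V G))} (u : Unique (x₀ ∷ x₁ ∷ x₂ ∷ x₃ ∷ x₄ ∷ []))
                   (r : L ≈ (x₃ , x₀) ∷ (x₁ , x₄) ∷ cycle (x₀ ∷ x₁ ∷ x₂ ∷ x₃ ∷ x₄ ∷ []) ++ R)
                   (fresh : ∀ {p} → p ∈ x₀ ∷ x₁ ∷ x₂ ∷ x₃ ∷ x₄ ∷ [] → p ≡ x₂ ⊎ deg p R ≡ 0)
                   (tip : deg x₂ R ≤ 1) where

        S : List (Fin (#V G))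
        S = x₀ ∷ x₁ ∷ x₂ ∷ x₃ ∷ x₄ ∷ []

        Z : List (Edge (#V G))
        Z = (x₃ , x₀) ∷ (x₁ , x₄) ∷ cycle S

        0∈ : x₀ ∈ S
        0∈ = here refl
        1∈ : x₁ ∈ S
        1∈ = there (here refl)
        2∈ : x₂ ∈ S
        2∈ = there (there (here refl))
        3∈ : x₃ ∈ S
        3∈ = there (there (there (here refl)))
        4∈ : x₄ ∈ S
        4∈ = there (there (there (there (here refl))))

        inside : Inside S Z
        inside = (3∈ , 0∈) ∷ (1∈ , 4∈) ∷ (0∈ , 1∈) ∷ (1∈ , 2∈) ∷ (2∈ , 3∈) ∷ (3∈ , 4∈) ∷ (4∈ , 0∈) ∷ []

        llR : Loopless R
        llR = loopless-++ʳ Z (loopless-≈ r edges-loopless)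

        tip≡0 : deg x₂ R ≡ 0
        tip≡0 = small (deg x₂ R) tip (no-single-exit S x₂ (bridgeless-≈ r bridgeless-G) llR inside 2∈ fresh)
          where
          small : ∀ d → d ≤ 1 → d ≢ 1 → d ≡ 0
          small 0 _ _ = refl
          small 1 _ h = ⊥-elim (h refl)
          small (suc (suc _)) (s≤s ()) _

        all-fresh : ∀ {p} → p ∈ S → deg p R ≡ 0
        all-fresh p∈ with fresh p∈
        ... | inj₁ refl = tip≡0
        ... | inj₂ e    = e

        all∈ : ∀ q → q ∈ S
        all∈ = closed⇒all S 0∈ (trans (cut-≈ (member S) r) (trans (cut-inside {S = S} {Z} R inside)
                 (cut-none R λ p e → all-fresh (member⁻ S e))))

        empty : ∀ K → (∀ {p} → p ∈ S → deg p K ≡ 0) → K ≡ []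
        empty []            h = refl
        empty ((a , b) ∷ K) h = ⊥-elim (Adj⇒deg {y = b} {L = (a , b) ∷ K} here (h (all∈ a)))

        is-H₂ : G ≅ H₂
        is-H₂ with r′ ← subst (λ K → L ≈ Z ++ K) (empty R all-fresh) r = ≅-fromEdges G H₂ φ ψ φψ ψφ (≈-trans r′ reorder)
          where
          reorder : Z ++ [] ≈ (x₂ , x₁) ∷ (x₃ , x₂) ∷ (x₃ , x₄) ∷ (x₃ , x₀) ∷ (x₁ , x₄) ∷ (x₁ , x₀) ∷ (x₄ , x₀) ∷ []
          reorder =
            ≈-trans (≈-shift (x₁ , x₂) ((x₃ , x₀) ∷ (x₁ , x₄) ∷ (x₀ , x₁) ∷ []) _) (≈-trans (≈-flip x₁ x₂) (≈-prep _
            (≈-trans (≈-shift (x₂ , x₃) ((x₃ , x₀) ∷ (x₁ , x₄) ∷ (x₀ , x₁) ∷ []) _) (≈-trans (≈-flip x₂ x₃) (≈-prep _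
            (≈-trans (≈-shift (x₃ , x₄) ((x₃ , x₀) ∷ (x₁ , x₄) ∷ (x₀ , x₁) ∷ []) _) (≈-prep _ (≈-prep _ (≈-prep _ (≈-flip x₀ x₁))))))))))
          φ : Fin 5 → Fin (#V G)
          φ zero                               = x₂
          φ (suc zero)                         = x₃
          φ (suc (suc zero))                   = x₁
          φ (suc (suc (suc zero)))             = x₄
          φ (suc (suc (suc (suc zero))))       = x₀
          ψ : Fin (#V G) → Fin 5
          ψ p = if does (p ≟ x₂) then zero else if does (p ≟ x₃) then suc zero else if does (p ≟ x₁) then suc (suc zero)
                else if does (p ≟ x₄) then suc (suc (suc zero)) else suc (suc (suc (suc zero)))
          φψ : ∀ p → φ (ψ p) ≡ p
          φψ p with p ≟ x₂ | p ≟ x₃ | p ≟ x₁ | p ≟ x₄ | all∈ p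
          ... | yes e | _     | _     | _     | _ = sym e
          ... | no _  | yes e | _     | _     | _ = sym e
          ... | no _  | no _  | yes e | _     | _ = sym e
          ... | no _  | no _  | no _  | yes e | _ = sym e
          ... | no _  | no _  | no _  | no _  | here e = sym e
          ... | no _  | no _  | no h  | no _  | there (here e) = ⊥-elim (h e)
          ... | no h  | no _  | no _  | no _  | there (there (here e)) = ⊥-elim (h e)
          ... | no _  | no h  | no _  | no _  | there (there (there (here e))) = ⊥-elim (h e)
          ... | no _  | no _  | no _  | no h  | there (there (there (there (here e)))) = ⊥-elim (h e)
          ψφ : ∀ i → ψ (φ i) ≡ i
          ψφ i = undo i u
            where
            undo : ∀ i → Unique S → ψ (φ i) ≡ i
            undo zero _ with x₂ ≟ x₂
            ... | yes _ = refl
            ... | no h  = ⊥-elim (h refl)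
            undo (suc zero) (_ ∷ _ ∷ (n₂₃ ∷ _) ∷ _) with x₃ ≟ x₂ | x₃ ≟ x₃
            ... | yes e | _     = ⊥-elim (n₂₃ (sym e))
            ... | no _  | yes _ = refl
            ... | no _  | no h  = ⊥-elim (h refl)
            undo (suc (suc zero)) (_ ∷ (n₁₂ ∷ n₁₃ ∷ _) ∷ _) with x₁ ≟ x₂ | x₁ ≟ x₃ | x₁ ≟ x₁
            ... | yes e | _     | _     = ⊥-elim (n₁₂ e)
            ... | no _  | yes e | _     = ⊥-elim (n₁₃ e)
            ... | no _  | no _  | yes _ = refl
            ... | no _  | no _  | no h  = ⊥-elim (h refl)
            undo (suc (suc (suc zero))) (_ ∷ (_ ∷ _ ∷ n₁₄ ∷ _) ∷ (_ ∷ n₂₄ ∷ _) ∷ (n₃₄ ∷ _) ∷ _) with x₄ ≟ x₂ | x₄ ≟ x₃ | x₄ ≟ x₁ | x₄ ≟ x₄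
            ... | yes e | _     | _     | _     = ⊥-elim (n₂₄ (sym e))
            ... | no _  | yes e | _     | _     = ⊥-elim (n₃₄ (sym e))
            ... | no _  | no _  | yes e | _     = ⊥-elim (n₁₄ (sym e))
            ... | no _  | no _  | no _  | yes _ = refl
            ... | no _  | no _  | no _  | no h  = ⊥-elim (h refl)
            undo (suc (suc (suc (suc zero)))) ((n₀₁ ∷ n₀₂ ∷ n₀₃ ∷ n₀₄ ∷ _) ∷ _) with x₀ ≟ x₂ | x₀ ≟ x₃ | x₀ ≟ x₁ | x₀ ≟ x₄
            ... | yes e | _     | _     | _     = ⊥-elim (n₀₂ e)
            ... | no _  | yes e | _     | _     = ⊥-elim (n₀₃ e)
            ... | no _  | no _  | yes e | _     = ⊥-elim (n₀₁ e)
            ... | no _  | no _  | no _  | yes e = ⊥-elim (n₀₄ e)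
            ... | no _  | no _  | no _  | no _  = refl

      -- From the hitting matching to the colouring

      module Unmatched {M F : List (Edge (#V G))} (split : L ≈ M ++ F) (dM : ∀ p → deg p M ≤ 1) (dF : DegreeTwo F)
                       (hit : ∀ {x y z} → ¬ Triangle F x y z) (trail : Trails F) (not-H₂ : ¬ (G ≅ H₂)) where

        module A = Assemble {M = M} {F = F} split edges-loopless dM dF trail

        llF : Loopless F
        llF = loopless-++ʳ M (loopless-≈ split edges-loopless)

        cycle⊆F : ∀ {k p q} → Adj p q (cycle (A.D k)) → Adj p q F
        cycle⊆F {k} a = Adj-≈ (≈-sym A.split′) (Adj-++ʳ (Trails.T₁ trail) (Adj-++ʳ (Trails.T₃ trail) (Adj-⋃⁺ A.K k a)))

        -- A cycle of length one is a loop, and one of length three is a triangle that the matching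
        -- misses.
        five≤ : ∀ c → Odd (length c) → (∀ {p q} → Adj p q (cycle c) → Adj p q F) → 5 ≤ length c
        five≤ (a ∷ []) _ sub = ⊥-elim (Adj-loopless llF (sub here) refl)
        five≤ (a ∷ b ∷ []) (odd-s (even-s ())) sub
        five≤ (a ∷ b ∷ c ∷ []) _ sub = ⊥-elim (hit
          (triangle ab bc ca (Adj-loopless llF ab) (Adj-loopless llF bc) (Adj-loopless llF ca)))
          where
          ab : Adj a b F
          ab = sub here
          bc : Adj b c F
          bc = sub (there here)
          ca : Adj c a F
          ca = sub (there (there here))
        five≤ (a ∷ b ∷ c ∷ d ∷ []) (odd-s (even-s (odd-s (even-s ())))) sub
        five≤ (a ∷ b ∷ c ∷ d ∷ e ∷ _) _ sub = s≤s (s≤s (s≤s (s≤s (s≤s z≤n))))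

        long : ∀ k → 5 ≤ length (A.D k)
        long k = five≤ (A.D k) (A.odd k) cycle⊆F

        -- The cycle edges exhaust the degree in `F` of all five vertices and the chords the matched
        -- edge at four of them, so at most one further edge remains, at `x₂`.
        not-house : ∀ k → Search.NotHouse A.m A.m-invol (A.D k)
        not-house k {x₀} {x₁} {x₂} {x₃} {x₄} c~ m₃ m₁ _ = not-H₂ (House.is-H₂ u (≈-trans split spelled) fresh tip)
          where
          c : List (Fin (#V G))
          c = x₀ ∷ x₁ ∷ x₂ ∷ x₃ ∷ x₄ ∷ []
          u : Unique c
          u = unique-↭ (proj₁ c~) (A.unique k)
          distinct : x₀ ≢ x₁ × x₀ ≢ x₃ × x₀ ≢ x₄ × x₁ ≢ x₃ × x₁ ≢ x₄ × x₃ ≢ x₄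
          distinct with u
          ... | (n₀₁ ∷ _ ∷ n₀₃ ∷ n₀₄ ∷ _) ∷ (_ ∷ n₁₃ ∷ n₁₄ ∷ _) ∷ _ ∷ (n₃₄ ∷ _) ∷ _ = n₀₁ , n₀₃ , n₀₄ , n₁₃ , n₁₄ , n₃₄
          mates : ∀ {p q} → A.m p ≡ q → p ≢ q → Adj p q M
          mates {p} refl p≢q with partner-Adj M p
          ... | inj₁ e = ⊥-elim (p≢q (sym e))
          ... | inj₂ a = a
          others : ∃ λ R → F ≈ cycle c ++ R
          others with ⋃-extract A.K (cycle ∘ A.D) k
          ... | R , s = T₁′ ++ T₃′ ++ R , ≈-trans A.split′ (≈-trans (≈-++ˡ T₁′ (≈-++ˡ T₃′ (≈-trans s (≈-++ʳ R (proj₂ c~))))) regroup)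
            where
            T₁′ T₃′ : List (Edge (#V G))
            T₁′ = Trails.T₁ trail
            T₃′ = Trails.T₃ trail
            regroup : T₁′ ++ T₃′ ++ cycle c ++ R ≈ cycle c ++ T₁′ ++ T₃′ ++ R
            regroup = ≈-trans (≈-++ˡ T₁′ (≈-exchange T₃′ (cycle c) R)) (≈-exchange T₁′ (cycle c) (T₃′ ++ R))
          R₁ : List (Edge (#V G))
          R₁ = proj₁ others
          fresh₁ : ∀ {p} → p ∈ c → deg p R₁ ≡ 0
          fresh₁ {p} p∈ = done (trans (sym (deg-++ p (cycle c) R₁)) (sym (deg-≈ p (proj₂ others)))) (deg-cycle-∈ c u p∈) (dF p)
            where
            done : ∀ {a b d} → a + b ≡ d → a ≡ 2 → d ≤ 2 → b ≡ 0
            done refl refl (s≤s (s≤s le)) = n≤0⇒n≡0 le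
          chords : ∃ λ R → M ≈ (x₃ , x₀) ∷ (x₁ , x₄) ∷ R
          chords with Adj-extract (mates m₃ (≢-sym (proj₁ (proj₂ distinct))))
          ... | R , s with Adj-∷⁻ (Adj-≈ s (mates m₁ (proj₁ (proj₂ (proj₂ (proj₂ (proj₂ distinct)))))))
          ...   | inj₁ (e , _)        = ⊥-elim (proj₁ (proj₂ (proj₂ (proj₂ distinct))) e)
          ...   | inj₂ (inj₁ (e , _)) = ⊥-elim (proj₁ distinct (sym e))
          ...   | inj₂ (inj₂ a) with Adj-extract a
          ...     | R′ , s′ = R′ , ≈-trans s (≈-prep _ s′)
          R₂ : List (Edge (#V G))
          R₂ = proj₁ chords
          bound : ∀ p → inc p (x₃ , x₀) + (inc p (x₁ , x₄) + deg p R₂) ≤ 1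
          bound p = subst (_≤ 1) (deg-≈ p (proj₂ chords)) (dM p)
          full : ∀ {a b d} → 1 ≤ a → a + (b + d) ≤ 1 → d ≡ 0
          full {suc a} {b} _ (s≤s le) = m+n≡0⇒n≡0 b (m+n≡0⇒n≡0 a (n≤0⇒n≡0 le))
          full′ : ∀ {a b d} → 1 ≤ b → a + (b + d) ≤ 1 → d ≡ 0
          full′ {a} {b} {d} 1≤b le = full 1≤b (subst (_≤ 1) (swap₃ a b d) le)
            where
            swap₃ : ∀ a b d → a + (b + d) ≡ b + (a + d)
            swap₃ = solve-∀
          spelled : M ++ F ≈ (x₃ , x₀) ∷ (x₁ , x₄) ∷ cycle c ++ (R₂ ++ R₁)
          spelled = ≈-trans (≈-++ (proj₂ chords) (proj₂ others)) (≈-prep _ (≈-prep _ (≈-exchange R₂ (cycle c) R₁)))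
          both : ∀ {p} → p ∈ c → deg p R₂ ≡ 0 → deg p (R₂ ++ R₁) ≡ 0
          both {p} p∈ e = trans (deg-++ p R₂ R₁) (cong₂ _+_ e (fresh₁ p∈))
          fresh : ∀ {p} → p ∈ c → p ≡ x₂ ⊎ deg p (R₂ ++ R₁) ≡ 0
          fresh p∈@(here refl)                                 = inj₂ (both p∈ (full {b = inc x₀ (x₁ , x₄)} (1≤inc-snd x₀ x₃) (bound x₀)))
          fresh p∈@(there (here refl))                         = inj₂ (both p∈ (full′ {a = inc x₁ (x₃ , x₀)} (1≤inc-fst x₁ x₄) (bound x₁)))
          fresh (there (there (here e)))                       = inj₁ e
          fresh p∈@(there (there (there (here refl))))         = inj₂ (both p∈ (full {b = inc x₃ (x₁ , x₄)} (1≤inc-fst x₃ x₀) (bound x₃)))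
          fresh p∈@(there (there (there (there (here refl))))) = inj₂ (both p∈ (full′ {a = inc x₄ (x₃ , x₀)} (1≤inc-snd x₄ x₁) (bound x₄)))
          tip : deg x₂ (R₂ ++ R₁) ≤ 1
          tip = subst (_≤ 1) (sym (trans (deg-++ x₂ R₂ R₁) (trans (cong (deg x₂ R₂ +_) (fresh₁ (there (there (here refl))))) (+-identityʳ _))))
                  (≤-trans (m≤n+m _ (inc x₂ (x₁ , x₄))) (≤-trans (m≤n+m _ (inc x₂ (x₃ , x₀))) (bound x₂)))

        colouring : Coloring 11 3 (lineGraph G)
        colouring = scheme⇒colouring G (A.scheme long not-house)

      module _ (not-H₁ : ¬ (G ≅ H₁)) where

        private
          hitting-G : HittingMatching (λ _ → false) L
          hitting-G = hitting-matching (length L) (λ _ → false) ≤-refl G₂₃ (noClosed-G not-H₁)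

          open HittingMatching hitting-G

          M F : List (Edge (#V G))
          M = sel id marks
          F = sel not marks

          split : L ≈ M ++ F
          split = sel-split marks

          dF : DegreeTwo F
          dF p = rest-degree (Bridgeless₂₃.degrees G₂₃ p) (deg-split p marks) (proj₂ (covers p))
            where
            -- A vertex of degree three loses its matched edge; the other degrees are at most two
            -- anyway.
            rest-degree : ∀ {d a b} → Subcubic d → a + b ≡ d → (d ≡ 3 → a ≡ 1) → b ≤ 2
            rest-degree {a = a} {b = b} deg0 e _ = subst (_≤ 2) (sym (m+n≡0⇒n≡0 a e)) z≤n
            rest-degree {a = a} {b = b} deg2 e _ = subst (b ≤_) e (m≤n+m b a)
            rest-degree deg3 e h with refl ← h refl = ≤-reflexive (suc-injective e)

          trail : Trails F
          trail = trails (length F) F ≤-refl (loopless-++ʳ M (loopless-≈ split edges-loopless)) dF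

        colouring-G : ¬ (G ≅ H₂) → Coloring 11 3 (lineGraph G)
        colouring-G = Unmatched.colouring split (λ p → proj₁ (covers p)) dF (hits (refl , refl , refl)) trail

open import Defs
open import Data.Integer using (+_)
open import Data.Nat using (z≤n; s≤s)
open import Data.Product using (_,_)
open import Data.Rational using (_/_)
open import Relation.Binary.PropositionalEquality using (_≡_; refl)
open import Relation.Nullary using (¬_)

theorem1p7 : (G : Graph) → TwoEdgeConnected G → maxDegree G ≡ 3 →
    ¬ (G ≅ H₁) → ¬ (G ≅ H₂) → χ′c G ≤ ⌜ + 11 / 3 ⌝
theorem1p7 G tec max≡3 not-H₁ not-H₂ =
  inf-lowerBound {S = ColoringRatio (lineGraph G)}
    (11 , 3 , _ , s≤s (s≤s (s≤s z≤n)) , EdgeColouring.Main.colouring-G G tec max≡3 not-H₁ not-H₂ , refl)
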